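{- Let $d\ge 1$, $k\ge 2$, $h\ge 2$ and $r\ge kh$ be fixed integers. Then: (1) For every $\varepsilon>0$ there is $n_0$ such that for all $n\ge n_0$ and every subset $A\subseteq [n]^d$ with $|A|\ge n^d-\frac{n^d}{\log n}$, $$(1-\varepsilon)\binom{r}{kh-1}(kh-1)^{|A|}\le g_r(A)\le (1+\varepsilon)\binom{r}{kh-1}(kh-1)^{|A|},$$ i.e. $g_r(A)=(1+o(1))\binom{r}{kh-1}(kh-1)^{|A|}$. (2) Moreover, for such $A$, all but an $o(1)$ proportion (as $n\to\infty$) of the $r$-colorings of $A$ without rainbow solutions to the $B_{k,h}$-equation use at most $kh-1$ distinct colors. (3) Furthermore, for all sufficiently large $n$, among all subsets $A\subseteq[n]^d$, the set $[n]^d$ is the unique subset maximizing $g_r(A)$; that is, $g_r(A)<g_r([n]^d)$ for every $A\subsetneq [n]^d$.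
   Context: For positive integers $n,d$, $[n]=\{1,\dots,n\}$ and $[n]^d$ is the $d$-dimensional grid, whose points are vectors in $\mathbb{Z}^d$ with all coordinates in $[n]$; addition is coordinatewise. For integers $k,h\ge2$, the $B_{k,h}$-equation is $\sum_{i=1}^h x_{1,i}=\sum_{i=1}^h x_{2,i}=\cdots=\sum_{i=1}^h x_{k,i}$ in $kh$ points $x_{\ell,i}$ ($\ell\in[k],i\in[h]$). An $r$-coloring of $A\subseteq[n]^d$ is a map $c:A\to[r]$. A solution (in $A$) is rainbow under $c$ if the colors $c(x_{\ell,i})$, $\ell\in[k],i\in[h]$, are pairwise distinct (so in particular the $kh$ points are pairwise distinct). For $r\ge kh$, $g_r(A)$ denotes the number of $r$-colorings of $A$ with no rainbow solution to the $B_{k,h}$-equation. Logarithms are base 2. -}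

module Defs where

open import Data.Bool using (Bool; true; false; T)
open import Data.Nat using (ℕ; zero; suc; _+_; _*_; _∸_; _^_; _≤_; _<_)
import Data.Nat.Properties as ℕP
open import Data.Fin using (Fin; toℕ)
import Data.Fin.Properties as FinP
open import Data.List using (List; []; _∷_; [_]; map; concatMap; concat; length; filter; filterᵇ; allFin; lookup; deduplicate)
open import Data.Vec using (Vec; []; _∷_; replicate; zipWith; toList)
import Data.Vec as Vec
import Data.Vec.Properties as VecP
open import Data.List.Relation.Unary.Any using (Any; any?)
open import Data.List.Relation.Unary.AllPairs using (AllPairs; allPairs?)
import Data.List.Relation.Unary.Unique.DecPropositional as UniqueDec
open import Relation.Binary.PropositionalEquality using (_≡_)
open import Relation.Nullary using (Dec; ¬_; ¬?)
open import Relation.Nullary.Decidable using (_×-dec_)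
open import Data.Product using (_×_)
open import Function using (_∘_)

allVec : {X : Set} → List X → (n : ℕ) → List (Vec X n)
allVec xs zero    = [ [] ]
allVec xs (suc n) = concatMap (λ x → map (x ∷_) (allVec xs n)) xs

-- The grid [n]^d.  A point is a vector of d coordinates; coordinate
-- j : Fin n stands for the integer  toℕ j + 1  ∈ [n] = {1,…,n}.

Point : ℕ → ℕ → Set
Point d n = Vec (Fin n) d

coords : {d n : ℕ} → Point d n → Vec ℕ d
coords = Vec.map (suc ∘ toℕ)

grid : (d n : ℕ) → List (Point d n)
grid d n = allVec (allFin n) d

SubsetGrid : ℕ → ℕ → Set
SubsetGrid d n = Point d n → Bool

fullGrid : (d n : ℕ) → SubsetGrid d n
fullGrid d n _ = true

elems : {d n : ℕ} → SubsetGrid d n → List (Point d n)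
elems {d} {n} A = filterᵇ A (grid d n)

size : {d n : ℕ} → SubsetGrid d n → ℕ
size A = length (elems A)

-- r-colorings of A.  Since the elements of A are enumerated as
-- elems A = (a_0, …, a_{|A|-1}), a coloring c : A → [r] is the vector
-- (c a_0, …, c a_{|A|-1}) ∈ (Fin r)^|A|.

Coloring : {d n : ℕ} → SubsetGrid d n → ℕ → Set
Coloring A r = Vec (Fin r) (size A)

allColorings : {d n : ℕ} (A : SubsetGrid d n) (r : ℕ) → List (Coloring A r)
allColorings A r = allVec (allFin r) (size A)

-- Candidate solutions of the B_{k,h}-equation in A: a k×h array of
-- points of A, x_{ℓ,i} = elems A ! (X ℓ i).

Candidate : {d n : ℕ} → SubsetGrid d n → ℕ → ℕ → Set
Candidate A k h = Vec (Vec (Fin (size A)) h) k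

allCandidates : {d n : ℕ} (A : SubsetGrid d n) (k h : ℕ) → List (Candidate A k h)
allCandidates A k h = allVec (allVec (allFin (size A)) h) k

pt : {d n : ℕ} (A : SubsetGrid d n) → Fin (size A) → Point d n
pt A = lookup (elems A)

vsum : {d : ℕ} → List (Vec ℕ d) → Vec ℕ d
vsum {d} [] = replicate d 0
vsum (v ∷ vs) = zipWith _+_ v (vsum vs)

rowSums : {d n k h : ℕ} (A : SubsetGrid d n) → Candidate A k h → List (Vec ℕ d)
rowSums A X = toList (Vec.map (λ row → vsum (toList (Vec.map (coords ∘ pt A) row))) X)

IsSolution : {d n k h : ℕ} (A : SubsetGrid d n) → Candidate A k h → Set
IsSolution A X = AllPairs _≡_ (rowSums A X)

colorsOf : {d n k h r : ℕ} (A : SubsetGrid d n) → Coloring A r → Candidate A k h → List (Fin r)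
colorsOf A c X = concat (toList (Vec.map (λ row → toList (Vec.map (Vec.lookup c) row)) X))

IsRainbow : {d n k h r : ℕ} (A : SubsetGrid d n) → Coloring A r → Candidate A k h → Set
IsRainbow {r = r} A c X = IsSolution A X × UniqueDec.Unique (FinP._≟_ {r}) (colorsOf A c X)

isRainbow? : {d n k h r : ℕ} (A : SubsetGrid d n) (c : Coloring A r) (X : Candidate A k h) → Dec (IsRainbow A c X)
isRainbow? {d} {r = r} A c X =
  allPairs? (VecP.≡-dec ℕP._≟_) (rowSums A X) ×-dec UniqueDec.unique? (FinP._≟_ {r}) (colorsOf A c X)

HasRainbow : {d n r : ℕ} (k h : ℕ) (A : SubsetGrid d n) → Coloring A r → Set
HasRainbow k h A c = Any (IsRainbow A c) (allCandidates A k h)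

hasRainbow? : {d n r : ℕ} (k h : ℕ) (A : SubsetGrid d n) (c : Coloring A r) → Dec (HasRainbow k h A c)
hasRainbow? k h A c = any? (isRainbow? A c) (allCandidates A k h)

goodColorings : {d n : ℕ} (k h r : ℕ) (A : SubsetGrid d n) → List (Coloring A r)
goodColorings k h r A = filter (λ c → ¬? (hasRainbow? k h A c)) (allColorings A r)

g : {d n : ℕ} (k h r : ℕ) (A : SubsetGrid d n) → ℕ
g k h r A = length (goodColorings k h r A)

numColors : {d n r : ℕ} (A : SubsetGrid d n) → Coloring A r → ℕ
numColors {r = r} A c = length (deduplicate (FinP._≟_ {r}) (toList c))

gBad : {d n : ℕ} (k h r : ℕ) (A : SubsetGrid d n) → ℕ
gBad k h r A = length (filter (λ c → (k * h ∸ 1) ℕP.<? numColors A c) (goodColorings k h r A))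

-- The density hypothesis  |A| ≥ n^d − n^d / log₂ n.
-- With m = n^d − |A| this reads  m · log₂ n ≤ n^d, i.e. (exactly,
-- for n ≥ 2)  n^m ≤ 2^(n^d).

Dense : {d n : ℕ} → SubsetGrid d n → Set
Dense {d} {n} A = n ^ (n ^ d ∸ size A) ≤ 2 ^ (n ^ d)

open import Data.Integer using (+_)
open import Data.Rational using (ℚ; _/_)

toℚ : ℕ → ℚ
toℚ m = + m / 1

{-# OPTIONS --safe #-}
-- Write m = kh − 1.  Two ideas replace the hypergraph containers one might expect here.
--
-- (i) A Sauer–Shelah lemma for lists.  A family of words of length B over a finite alphabet with many more than Mᴮ
-- members shatters a positive proportion of the coordinates by one common list of M + 1 letters.  Take M = m and
-- single points as coordinates: a dense set of points contains a solution of the equation by the pigeonhole principle,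
-- and m + 1 = kh independent colors at each point make it rainbow.  Hence g(A) ≤ m^|A| · 2^(o(n^d)) for every A.
--
-- (ii) For colorings using kh colors, fix points p₁, …, p_kh of distinct colors and let each coordinate be a whole
-- cluster of T points which contains, for every t, a solution through p_t; the clusters are disjoint, cover a positive
-- proportion of A and depend affinely on a parameter.  Take M = mᵀ − 1.  Shattering by mᵀ blocks, together with (i) and
-- with solutions mixing two positions of the clusters, forces the list of blocks to be Pᵀ for one palette P of m
-- colors.  Some p_t has a color outside P, and its solution in a single cluster can be made rainbow.  So these
-- colorings are exponentially rarer than m^|A|, and almost all others use exactly the colors of one of the C(r, m)
-- palettes.
module Submission where

open import Defs
open import Data.Bool using (Bool; true; false; T; T?; _∧_)
open import Data.Nat using (ℕ; zero; suc; _+_; _*_; _∸_; _^_; _≤_; _<_; z≤n; s≤s; >-nonZero)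
open import Data.Nat.Properties
open import Data.Fin as Fin using (Fin; zero; suc; toℕ)
import Data.Fin.Properties as FinP
open import Data.List using (List; []; _∷_; [_]; map; concatMap; concat; length; filter; filterᵇ; allFin; lookup; deduplicate; _++_; cartesianProduct; tabulate; take; upTo)
import Data.List.Properties as ListP
open import Data.Vec using (Vec; []; _∷_)
import Data.Vec as Vec
import Data.Vec.Properties as VecP
open import Data.List.Relation.Unary.Any as Any using (here; there)
open import Data.List.Relation.Unary.All as All using (All; []; _∷_)
import Data.List.Relation.Unary.All.Properties as AllP
open import Data.List.Relation.Unary.AllPairs as AllPairs using (AllPairs; []; _∷_)
import Data.List.Relation.Unary.AllPairs.Properties as AllPairsP
open import Data.List.Relation.Unary.Unique.Propositional using (Unique)
import Data.List.Relation.Unary.Unique.Propositional.Properties as UniqueP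
open import Data.List.Membership.Propositional using (_∈_; _∉_; find; lose)
open import Data.List.Membership.Propositional.Properties
open import Data.List.Relation.Binary.Subset.Propositional using (_⊆_)
open import Data.Product using (_×_; _,_; Σ; ∃; proj₁; proj₂; map₁)
open import Data.Sum as Sum using (_⊎_; inj₁; inj₂)
open import Data.Empty using (⊥; ⊥-elim)
open import Data.Unit using (tt)
open import Function using (_∘_; id)
open import Relation.Nullary using (¬_; Dec; yes; no; does; ¬?)
open import Relation.Unary using (Decidable)
open import Relation.Binary.Definitions using (DecidableEquality; tri<; tri≈; tri>)
open import Relation.Binary.PropositionalEquality hiding ([_])
open import Data.Bool.ListAction using (any; all)
open import Data.Maybe using (Maybe; just; nothing)
open import Data.Nat.Tactic.RingSolver using (solve-∀)
open import Data.List.Relation.Unary.Any.Properties using (lookup-index)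
import Data.List.Membership.DecPropositional as DecMembership
open import Data.List.Relation.Unary.Unique.DecPropositional.Properties using (deduplicate-!)
open import Relation.Nullary.Decidable using (_×-dec_; _→-dec_; dec-true)
open import Data.Nat.DivMod using (_/_; _%_; m≡m%n+[m/n]*n; m%n<n; m/n*n≤m; /-monoˡ-≤; m*n/n≡m; m≥n⇒m/n>0)
open import Data.Nat.Combinatorics using (_C_; nCk+nC[k+1]≡[n+1]C[k+1])
open import Data.Rational using (ℚ; mkℚ; 0ℚ; 1ℚ) renaming (_+_ to _+ℚ_; _-_ to _-ℚ_; _*_ to _*ℚ_; _≤_ to _≤ℚ_; _<_ to _<ℚ_)
import Data.Rational.Base as ℚB
import Data.Rational.Properties as ℚP
open import Data.Rational.Unnormalised.Base as ℚᵘ using (mkℚᵘ; *≤*; *≡*)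
import Data.Rational.Unnormalised.Properties as ℚᵘP
import Data.Integer.Base as ℤ
import Data.Integer.Properties as ℤP


-- Finite counting

-- The order of choices is the obstacle in (ii). Block words are prescribed before a coloring
-- realising them is handed over, and only that coloring reveals which p_t has a color outside P. A
-- cluster therefore has (kh)² positions: for each t it carries a copy of one fixed integer
-- solution, scaled by its own power of a constant, and a single word prepares all copies at once.
-- Fixing the p_t costs a factor of at most (n^d)^(kh). The saving must beat this and the slack from
-- (i), so the number of disjoint clusters has to be proportional to n^d: the affine parameter is
-- itself a d-dimensional vector, from a box of side proportional to n. The grid enters through
-- base-β codes, which turn the vector equation into one equation in ℕ and order the points, so the
-- pigeonhole search for solutions is one-dimensional. In (3), a set missing a positive proportion
-- of the grid is beaten by (i) alone; any other proper subset loses a factor m in the main term,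
-- and m is at least 3.

⊆-length : {X : Set} {xs ys : List X} → Unique xs → xs ⊆ ys → length xs ≤ length ys
⊆-length [] sub = z≤n
⊆-length {xs = x ∷ xs} {ys} (x∉ ∷ u) sub with ∈-∃++ (sub (here refl))
... | as , bs , refl = begin
    suc (length xs)            ≤⟨ s≤s (⊆-length u sub′) ⟩
    suc (length (as ++ bs))    ≡⟨ cong suc (ListP.length-++ as) ⟩
    suc (length as + length bs) ≡⟨ sym (+-suc (length as) (length bs)) ⟩
    length as + suc (length bs) ≡⟨ sym (ListP.length-++ as) ⟩
    length (as ++ x ∷ bs) ∎
  where
  open ≤-Reasoning
  sub′ : xs ⊆ as ++ bs
  sub′ {y} y∈ with ∈-++⁻ as (sub (there y∈))
  ... | inj₁ p = ∈-++⁺ˡ p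
  ... | inj₂ (here refl) = ⊥-elim (All.lookup x∉ y∈ refl)
  ... | inj₂ (there p) = ∈-++⁺ʳ as p

unique-map : {X Y : Set} (f : X → Y) {xs : List X} →
  (∀ {x y} → x ∈ xs → y ∈ xs → f x ≡ f y → x ≡ y) → Unique xs → Unique (map f xs)
unique-map f inj [] = []
unique-map f inj (x∉ ∷ u) =
  AllP.map⁺ (All.tabulate λ y∈ eq → All.lookup x∉ y∈ (inj (here refl) (there y∈) eq))
  ∷ unique-map f (λ p q → inj (there p) (there q)) u

injection-length : {X Y : Set} (f : X → Y) {xs : List X} {ys : List Y} → Unique xs →
  (∀ {x} → x ∈ xs → f x ∈ ys) →
  (∀ {x y} → x ∈ xs → y ∈ xs → f x ≡ f y → x ≡ y) → length xs ≤ length ys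
injection-length f {xs} {ys} u into inj = subst (_≤ length ys) (ListP.length-map f xs)
  (⊆-length (unique-map f inj u) sub)
  where
  sub : map f xs ⊆ ys
  sub y∈ with ∈-map⁻ f y∈
  ... | x , x∈ , refl = into x∈

⊆-length-full : {X : Set} → DecidableEquality X → {xs ys : List X} → Unique xs → xs ⊆ ys →
  length ys ≤ length xs → ys ⊆ xs
⊆-length-full _≟_ {xs} {ys} u sub le {y} y∈ with Any.any? (y ≟_) xs
... | yes p = p
... | no ¬p = ⊥-elim (<-irrefl refl (≤-trans (⊆-length u′ sub′) le))
  where
  u′ : Unique (y ∷ xs)
  u′ = AllP.¬Any⇒All¬ xs ¬p ∷ u
  sub′ : (y ∷ xs) ⊆ ys
  sub′ (here refl) = y∈
  sub′ (there p) = sub p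

∈-concatMap-intro : {X Y : Set} (f : X → List Y) {xs : List X} {x : X} {y : Y} →
  x ∈ xs → y ∈ f x → y ∈ concatMap f xs
∈-concatMap-intro f x∈ y∈ = ∈-concatMap⁺ f (lose x∈ y∈)

∈-concatMap-elim : {X Y : Set} (f : X → List Y) (xs : List X) {y : Y} →
  y ∈ concatMap f xs → ∃ λ x → x ∈ xs × y ∈ f x
∈-concatMap-elim f xs y∈ = find (∈-concatMap⁻ f {xs} y∈)

length-concatMap-≤ : {X Y : Set} (f : X → List Y) (c : ℕ) (xs : List X) →
  (∀ {x} → x ∈ xs → length (f x) ≤ c) → length (concatMap f xs) ≤ length xs * c
length-concatMap-≤ f c [] le = z≤n
length-concatMap-≤ f c (x ∷ xs) le = begin
  length (f x ++ concatMap f xs) ≡⟨ ListP.length-++ (f x) ⟩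
  length (f x) + length (concatMap f xs)
    ≤⟨ +-mono-≤ (le (here refl)) (length-concatMap-≤ f c xs (le ∘ there)) ⟩
  c + length xs * c ∎
  where open ≤-Reasoning

length-concatMap-≥ : {X Y : Set} (f : X → List Y) (c : ℕ) (xs : List X) →
  (∀ {x} → x ∈ xs → c ≤ length (f x)) → length xs * c ≤ length (concatMap f xs)
length-concatMap-≥ f c [] le = z≤n
length-concatMap-≥ f c (x ∷ xs) le = begin
  c + length xs * c
    ≤⟨ +-mono-≤ (le (here refl)) (length-concatMap-≥ f c xs (le ∘ there)) ⟩
  length (f x) + length (concatMap f xs) ≡⟨ sym (ListP.length-++ (f x)) ⟩
  length (f x ++ concatMap f xs) ∎
  where open ≤-Reasoning

length-filter-partition : {X : Set} {P : X → Set} (P? : Decidable P) (xs : List X) →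
  length (filter P? xs) + length (filter (¬? ∘ P?) xs) ≡ length xs
length-filter-partition P? [] = refl
length-filter-partition P? (x ∷ xs) with P? x
... | yes _ = cong suc (length-filter-partition P? xs)
... | no _ = trans (+-suc _ _) (cong suc (length-filter-partition P? xs))

filter-∧-length : {X : Set} {P Q : X → Set} (P? : Decidable P) (Q? : Decidable Q) (xs : List X) →
  (∀ {x} → x ∈ xs → Q x → P x) → length (filter Q? (filter P? xs)) ≡ length (filter Q? xs)
filter-∧-length P? Q? [] imp = refl
filter-∧-length P? Q? (x ∷ xs) imp with P? x
... | yes p with Q? x
...   | yes q = cong suc (filter-∧-length P? Q? xs (imp ∘ there))
...   | no _ = filter-∧-length P? Q? xs (imp ∘ there)
filter-∧-length P? Q? (x ∷ xs) imp | no ¬p with Q? x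
...   | yes q = ⊥-elim (¬p (imp (here refl) q))
...   | no _ = filter-∧-length P? Q? xs (imp ∘ there)

pigeonhole : {X L : Set} → DecidableEquality L → (f : X → L) (labs : List L) (xs : List X) (u : ℕ) →
  (∀ {x} → x ∈ xs → f x ∈ labs) → length labs * u < length xs →
  ∃ λ (ℓ : L) → Σ (Decidable (λ x → f x ≡ ℓ)) λ P? → u < length (filter P? xs)
pigeonhole _≟_ f [] [] u into ()
pigeonhole _≟_ f [] (x ∷ xs) u into lt with into (here refl)
... | ()
pigeonhole _≟_ f (ℓ ∷ ls) xs u into lt with u <? length (filter (λ x → f x ≟ ℓ) xs)
... | yes p = ℓ , (λ x → f x ≟ ℓ) , p
... | no ¬p = finish (pigeonhole _≟_ f ls (filter Q? xs) u into′ lt′)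
  where
  P? = λ x → f x ≟ ℓ
  Q? = ¬? ∘ P?
  into′ : ∀ {x} → x ∈ filter Q? xs → f x ∈ ls
  into′ x∈ with ∈-filter⁻ Q? x∈
  ... | x∈xs , ¬q with into x∈xs
  ...   | here e = ⊥-elim (¬q e)
  ...   | there p = p
  lt′ : length ls * u < length (filter Q? xs)
  lt′ = +-cancelˡ-< u _ _ (begin-strict
    u + length ls * u <⟨ lt ⟩
    length xs ≡⟨ sym (length-filter-partition P? xs) ⟩
    length (filter P? xs) + length (filter Q? xs) ≤⟨ +-monoˡ-≤ _ (≮⇒≥ ¬p) ⟩
    u + length (filter Q? xs) ∎)
    where open ≤-Reasoning
  finish : _ → _
  finish (ℓ′ , P′ , lt″) with ℓ′ ≟ ℓ
  -- The recursive class is taken inside a list purged of the label `ℓ`; if the label found were `ℓ`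
  -- again (`labs` may repeat it), that class would be empty.
  ... | yes refl = ⊥-elim (n≮0 (<-≤-trans lt″ (≤-reflexive (cong length (ListP.filter-none P′
        (All.tabulate λ x∈ → proj₂ (∈-filter⁻ Q? {xs = xs} x∈)))))))
  ... | no ne = ℓ′ , P′ , <-≤-trans lt″ (≤-reflexive (filter-∧-length Q? P′ xs λ _ e e′ → ne (trans (sym e) e′)))

-- Vectors over a list of letters

∈-allVec : {X : Set} {xs : List X} {n : ℕ} (v : Vec X n) → (∀ i → Vec.lookup v i ∈ xs) → v ∈ allVec xs n
∈-allVec [] p = here refl
∈-allVec {xs = xs} {suc n} (x ∷ v) p =
  ∈-concatMap-intro (λ x → map (x ∷_) (allVec xs n)) (p zero) (∈-map⁺ (x ∷_) (∈-allVec v (p ∘ suc)))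

∈-allVec⁻ : {X : Set} (xs : List X) {n : ℕ} {v : Vec X n} → v ∈ allVec xs n → ∀ i → Vec.lookup v i ∈ xs
∈-allVec⁻ xs {suc n} v∈ i with ∈-concatMap-elim (λ x → map (x ∷_) (allVec xs n)) xs v∈
... | x , x∈ , q with ∈-map⁻ (x ∷_) q
∈-allVec⁻ xs v∈ zero | x , x∈ , q | w , w∈ , refl = x∈
∈-allVec⁻ xs v∈ (suc i) | x , x∈ , q | w , w∈ , refl = ∈-allVec⁻ xs w∈ i

length-allVec : {X : Set} (xs : List X) (n : ℕ) → length (allVec xs n) ≡ length xs ^ n
length-allVec xs zero = refl
length-allVec xs (suc n) = ≤-antisym
  (subst (λ z → length (allVec xs (suc n)) ≤ length xs * z) (length-allVec xs n)
    (length-concatMap-≤ _ _ xs λ {x} _ → ≤-reflexive (ListP.length-map (x ∷_) (allVec xs n))))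
  (subst (λ z → length xs * z ≤ length (allVec xs (suc n))) (length-allVec xs n)
    (length-concatMap-≥ _ _ xs λ {x} _ → ≤-reflexive (sym (ListP.length-map (x ∷_) (allVec xs n)))))

-- `allVec` enumerates lexicographically, so a relation between earlier and later letters lifts to
-- words. Used with inequality for the absence of repetitions and with the order of codes for the
-- sortedness of the grid.
allVec-pairs : {X : Set} {n : ℕ} {R : X → X → Set} {S : ∀ {n} → Vec X n → Vec X n → Set} →
  (∀ {n x y} {v w : Vec X n} → R x y → S (x ∷ v) (y ∷ w)) →
  (∀ {n x} {v w : Vec X n} → S v w → S (x ∷ v) (x ∷ w)) →
  {xs : List X} → AllPairs R xs → AllPairs S (allVec xs n)
allVec-pairs {n = zero} hd tl ps = [] ∷ []
allVec-pairs {X} {suc n} {R} {S} hd tl {xs} ps = AllPairsP.concat⁺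
  (AllP.map⁺ (All.tabulate λ {x} _ → AllPairsP.map⁺ (AllPairs.map tl (allVec-pairs {n = n} {R} {S} hd tl ps))))
  (AllPairsP.map⁺ (AllPairs.map (λ r → AllP.map⁺ (All.tabulate λ _ → AllP.map⁺ (All.tabulate λ _ → hd r))) ps))

allVec-unique : {X : Set} {xs : List X} {n : ℕ} → Unique xs → Unique (allVec xs n)
allVec-unique = allVec-pairs {S = _≢_} (λ ne e → ne (VecP.∷-injectiveˡ e)) (λ ne e → ne (VecP.∷-injectiveʳ e))

-- The sublists of length k in the order of `xs`; when `xs` has no repetitions they represent its
-- k-element subsets, each once. They serve both as the lists that may be shattered and as the
-- palettes.
combs : {X : Set} → ℕ → List X → List (List X)
combs zero xs = [ [] ]
combs (suc k) [] = []
combs (suc k) (x ∷ xs) = map (x ∷_) (combs k xs) ++ combs (suc k) xs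

combs-length : {X : Set} (k : ℕ) (xs : List X) {L : List X} → L ∈ combs k xs → length L ≡ k
combs-length zero xs (here refl) = refl
combs-length (suc k) (x ∷ xs) L∈ with ∈-++⁻ (map (x ∷_) (combs k xs)) L∈
... | inj₂ q = combs-length (suc k) xs q
... | inj₁ q with ∈-map⁻ (x ∷_) q
...   | L′ , p , refl = cong suc (combs-length k xs p)

combs-⊆ : {X : Set} (k : ℕ) (xs : List X) {L : List X} → L ∈ combs k xs → L ⊆ xs
combs-⊆ zero xs (here refl) ()
combs-⊆ (suc k) (x ∷ xs) L∈ y∈ with ∈-++⁻ (map (x ∷_) (combs k xs)) L∈
... | inj₂ q = there (combs-⊆ (suc k) xs q y∈)
... | inj₁ q with ∈-map⁻ (x ∷_) q
combs-⊆ (suc k) (x ∷ xs) L∈ (here refl) | inj₁ q | L′ , p , refl = here refl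
combs-⊆ (suc k) (x ∷ xs) L∈ (there y∈) | inj₁ q | L′ , p , refl = there (combs-⊆ k xs p y∈)

combs-unique : {X : Set} (k : ℕ) {xs : List X} {L : List X} → Unique xs → L ∈ combs k xs → Unique L
combs-unique zero u (here refl) = []
combs-unique (suc k) {x ∷ xs} (x∉ ∷ u) L∈ with ∈-++⁻ (map (x ∷_) (combs k xs)) L∈
... | inj₂ q = combs-unique (suc k) u q
... | inj₁ q with ∈-map⁻ (x ∷_) q
...   | L′ , p , refl = All.tabulate (λ y∈ → All.lookup x∉ (combs-⊆ k xs p y∈)) ∷ combs-unique k u p

lookup-mono : {X : Set} {R : X → X → Set} {xs : List X} → AllPairs R xs →
  ∀ {i j} → i Fin.< j → R (lookup xs i) (lookup xs j)
lookup-mono (p ∷ ps) {zero} {suc j} lt = All.lookup p (∈-lookup j)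
lookup-mono (p ∷ ps) {suc i} {suc j} (s≤s lt) = lookup-mono ps lt

lookup-injective : {X : Set} {xs : List X} → Unique xs → ∀ {i j} → lookup xs i ≡ lookup xs j → i ≡ j
lookup-injective u {i} {j} e with FinP.<-cmp i j
... | tri< lt _ _ = ⊥-elim (lookup-mono u lt e)
... | tri≈ _ eq _ = eq
... | tri> _ _ gt = ⊥-elim (lookup-mono u gt (sym e))

-- A Sauer–Shelah lemma for lists

lsum : {X : Set} → List X → (X → ℕ) → ℕ
lsum [] f = 0
lsum (x ∷ xs) f = f x + lsum xs f

lsum-mono : {X : Set} (xs : List X) {f g : X → ℕ} → (∀ x → f x ≤ g x) → lsum xs f ≤ lsum xs g
lsum-mono [] le = z≤n
lsum-mono (x ∷ xs) le = +-mono-≤ (le x) (lsum-mono xs le)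

+-interchange : ∀ a b c d → (a + b) + (c + d) ≡ (a + c) + (b + d)
+-interchange = solve-∀

lsum-+ : {X : Set} (xs : List X) (f g : X → ℕ) → lsum xs (λ x → f x + g x) ≡ lsum xs f + lsum xs g
lsum-+ [] f g = refl
lsum-+ (x ∷ xs) f g rewrite lsum-+ xs f g = +-interchange (f x) (g x) (lsum xs f) (lsum xs g)

lsum-* : {X : Set} (xs : List X) (c : ℕ) (f : X → ℕ) → lsum xs (λ x → c * f x) ≡ c * lsum xs f
lsum-* [] c f = sym (*-zeroʳ c)
lsum-* (x ∷ xs) c f rewrite lsum-* xs c f = sym (*-distribˡ-+ c (f x) (lsum xs f))

lsum-≤ : {X : Set} (xs : List X) {f : X → ℕ} {c : ℕ} → (∀ {x} → x ∈ xs → f x ≤ c) → lsum xs f ≤ length xs * c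
lsum-≤ [] le = z≤n
lsum-≤ (x ∷ xs) le = +-mono-≤ (le (here refl)) (lsum-≤ xs (le ∘ there))

lsum-∈ : {X : Set} {xs : List X} {x : X} (f : X → ℕ) → x ∈ xs → f x ≤ lsum xs f
lsum-∈ f (here refl) = m≤m+n _ _
lsum-∈ f (there p) = ≤-trans (lsum-∈ f p) (m≤n+m _ _)

bool→ℕ : Bool → ℕ
bool→ℕ true = 1
bool→ℕ false = 0

bool→ℕ≤1 : ∀ b → bool→ℕ b ≤ 1
bool→ℕ≤1 true = ≤-refl
bool→ℕ≤1 false = z≤n

length-filterᵇ : {X : Set} (G : X → Bool) (xs : List X) → length (filterᵇ G xs) ≡ lsum xs (bool→ℕ ∘ G)
length-filterᵇ G [] = refl
length-filterᵇ G (x ∷ xs) with G x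
... | true = cong suc (length-filterᵇ G xs)
... | false = length-filterᵇ G xs

any-true : {X : Set} (G : X → Bool) {xs : List X} {x : X} → x ∈ xs → G x ≡ true → any G xs ≡ true
any-true G {y ∷ xs} (here refl) e rewrite e = refl
any-true G {y ∷ xs} (there p) e with G y
... | true = refl
... | false = any-true G p e

any-find : {X : Set} (G : X → Bool) (xs : List X) → any G xs ≡ true → ∃ λ x → x ∈ xs × G x ≡ true
any-find G (x ∷ xs) e with G x in eq
... | true = x , here refl , eq
... | false with any-find G xs e
...   | y , p , q = y , there p , q

all-true : {X : Set} (G : X → Bool) (xs : List X) {x : X} → all G xs ≡ true → x ∈ xs → G x ≡ true
all-true G (y ∷ xs) e p with G y in eq
all-true G (y ∷ xs) e (here refl) | true = eq
all-true G (y ∷ xs) e (there p) | true = all-true G xs e p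

combs-filter : {X : Set} (G : X → Bool) (k : ℕ) (xs : List X) → k ≤ lsum xs (bool→ℕ ∘ G) →
  ∃ λ L → L ∈ combs k xs × all G L ≡ true
combs-filter G zero xs le = [] , here refl , refl
combs-filter G (suc k) (x ∷ xs) le with G x in eq
... | false with combs-filter G (suc k) xs le
...   | L , p , q = L , ∈-++⁺ʳ (map (x ∷_) (combs k xs)) p , q
combs-filter G (suc k) (x ∷ xs) (s≤s le) | true with combs-filter G k xs le
...   | L , p , q = x ∷ L , ∈-++⁺ˡ (∈-map⁺ (x ∷_) p) , trans (cong (_∧ all G L) eq) q

module Counting {X : Set} (xs : List X) where

  -- The first letter is summed innermost, contrary to the nesting of `allVec`, so that an estimate
  -- for the fibre over a fixed tail can be inserted by `csum-mono`. `csum-allVec` exchanges the two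
  -- orders.
  csum : (B : ℕ) → (Vec X B → ℕ) → ℕ
  csum zero f = f []
  csum (suc B) f = csum B (λ v → lsum xs (λ x → f (x ∷ v)))

  csum-mono : ∀ B {f g : Vec X B → ℕ} → (∀ v → f v ≤ g v) → csum B f ≤ csum B g
  csum-mono zero le = le []
  csum-mono (suc B) le = csum-mono B (λ v → lsum-mono xs (λ x → le (x ∷ v)))

  csum-cong : ∀ B {f g : Vec X B → ℕ} → (∀ v → f v ≡ g v) → csum B f ≡ csum B g
  csum-cong B e = ≤-antisym (csum-mono B (≤-reflexive ∘ e)) (csum-mono B (≤-reflexive ∘ sym ∘ e))

  csum-+ : ∀ B (f g : Vec X B → ℕ) → csum B (λ v → f v + g v) ≡ csum B f + csum B g
  csum-+ zero f g = refl
  csum-+ (suc B) f g = trans (csum-cong B (λ v → lsum-+ xs _ _)) (csum-+ B _ _)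

  csum-* : ∀ B (c : ℕ) (f : Vec X B → ℕ) → csum B (λ v → c * f v) ≡ c * csum B f
  csum-* zero c f = refl
  csum-* (suc B) c f = trans (csum-cong B (λ v → lsum-* xs c _)) (csum-* B c _)

  csum-0 : ∀ B → csum B (λ _ → 0) ≡ 0
  csum-0 B = csum-* B 0 (λ _ → 0)

  csum-lsum : ∀ B {Y : Set} (ys : List Y) (f : Y → Vec X B → ℕ) →
    csum B (λ v → lsum ys (λ y → f y v)) ≡ lsum ys (λ y → csum B (f y))
  csum-lsum B [] f = csum-0 B
  csum-lsum B (y ∷ ys) f = trans (csum-+ B _ _) (cong (csum B (f y) +_) (csum-lsum B ys f))

  count : (B : ℕ) → (Vec X B → Bool) → ℕ
  count B F = csum B (bool→ℕ ∘ F)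

  lsum-concatMap : {Y Z : Set} (f : Z → ℕ) (g : Y → List Z) (ys : List Y) →
    lsum (concatMap g ys) f ≡ lsum ys (λ y → lsum (g y) f)
  lsum-concatMap f g [] = refl
  lsum-concatMap f g (y ∷ ys) = trans (lsum-++ (g y)) (cong (lsum (g y) f +_) (lsum-concatMap f g ys))
    where
    lsum-++ : ∀ as {bs} → lsum (as ++ bs) f ≡ lsum as f + lsum bs f
    lsum-++ [] = refl
    lsum-++ (a ∷ as) {bs} = trans (cong (f a +_) (lsum-++ as)) (sym (+-assoc (f a) _ _))

  lsum-map : {Y Z : Set} (f : Z → ℕ) (g : Y → Z) (ys : List Y) → lsum (map g ys) f ≡ lsum ys (f ∘ g)
  lsum-map f g [] = refl
  lsum-map f g (y ∷ ys) = cong (f (g y) +_) (lsum-map f g ys)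

  csum-allVec : ∀ B (f : Vec X B → ℕ) → lsum (allVec xs B) f ≡ csum B f
  csum-allVec zero f = +-identityʳ (f [])
  csum-allVec (suc B) f = begin
    lsum (concatMap (λ x → map (x ∷_) (allVec xs B)) xs) f ≡⟨ lsum-concatMap f _ xs ⟩
    lsum xs (λ x → lsum (map (x ∷_) (allVec xs B)) f)
      ≡⟨ lsum-cong xs (λ x → trans (lsum-map f (x ∷_) (allVec xs B)) (csum-allVec B _)) ⟩
    lsum xs (λ x → csum B (λ v → f (x ∷ v))) ≡⟨ sym (csum-lsum B xs _) ⟩
    csum (suc B) f ∎
    where
    open ≡-Reasoning
    lsum-cong : {Y : Set} (ys : List Y) {f g : Y → ℕ} → (∀ y → f y ≡ g y) → lsum ys f ≡ lsum ys g
    lsum-cong ys e = ≤-antisym (lsum-mono ys (≤-reflexive ∘ e)) (lsum-mono ys (≤-reflexive ∘ sym ∘ e))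

  length-allVec-filterᵇ : ∀ B (F : Vec X B → Bool) → length (filterᵇ F (allVec xs B)) ≡ count B F
  length-allVec-filterᵇ B F = trans (length-filterᵇ F (allVec xs B)) (csum-allVec B (bool→ℕ ∘ F))

  count-witness : ∀ B (F : Vec X B → Bool) → (count B F ≡ 0) ⊎ ∃ λ v → v ∈ allVec xs B × F v ≡ true
  count-witness B F with filterᵇ F (allVec xs B) in eq
  ... | [] = inj₁ (trans (sym (length-allVec-filterᵇ B F)) (cong length eq))
  ... | v ∷ vs with ∈-filter⁻ (λ w → T? (F w)) {xs = allVec xs B} (subst (v ∈_) (sym eq) (here refl))
  ...   | v∈ , t = inj₂ (v , v∈ , T-true (F v) t)
    where
    T-true : ∀ b → T b → b ≡ true
    T-true true _ = refl

module Shattering {X : Set} (xs : List X) (M : ℕ) where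
  open Counting xs

  lists : List (List X)
  lists = combs (suc M) xs

  R : ℕ
  R = length lists

  proj : ∀ {B} → (Vec X (suc B) → Bool) → Vec X B → Bool
  proj F v = any (λ x → F (x ∷ v)) xs

  section : ∀ {B} → Fin R → (Vec X (suc B) → Bool) → Vec X B → Bool
  section i F v = all (λ x → F (x ∷ v)) (lookup lists i)

  -- Either at most M letters satisfy G, and the first term suffices, or G holds on one of the
  -- sublists with M + 1 letters, and the second term is at least the size of the alphabet.
  fibre-bound : (G : X → Bool) → lsum xs (bool→ℕ ∘ G) ≤
    M * bool→ℕ (any G xs) + length xs * lsum (allFin R) (λ i → bool→ℕ (all G (lookup lists i)))
  fibre-bound G with suc M ≤? lsum xs (bool→ℕ ∘ G)
  ... | yes le with combs-filter G (suc M) xs le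
  ...   | L , L∈ , eq = ≤-trans (lsum-≤ xs {c = 1} (λ {x} _ → bool→ℕ≤1 (G x)))
            (≤-trans (*-monoʳ-≤ (length xs) one) (m≤n+m _ _))
    where
    one : 1 ≤ lsum (allFin R) (λ i → bool→ℕ (all G (lookup lists i)))
    one = ≤-trans (≤-reflexive (cong bool→ℕ (sym (trans (cong (all G) (sym (lookup-index L∈))) eq))))
            (lsum-∈ (λ i → bool→ℕ (all G (lookup lists i))) (∈-allFin (Any.index L∈)))
  fibre-bound G | no ¬le with any G xs in eq
  ... | true = ≤-trans (≤-trans (≤-pred (≰⇒> ¬le)) (≤-reflexive (sym (*-identityʳ M)))) (m≤m+n _ _)
  ... | false = ≤-trans (≤-reflexive (none xs eq)) z≤n
    where
    none : ∀ ys → any G ys ≡ false → lsum ys (bool→ℕ ∘ G) ≡ 0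
    none [] e = refl
    none (y ∷ ys) e with G y
    ... | false = none ys e

  -- A pattern marks the shattered coordinates, each with the list of letters it realises.
  Pattern : ℕ → Set
  Pattern = Vec (Maybe (Fin R))

  -- An unmarked coordinate is quantified existentially, a marked one universally over its list, the
  -- last coordinate outermost. Letters at unmarked coordinates may depend on those further right,
  -- which still gives a word for every choice at the marked ones.
  Shatters : ∀ {B} → (Vec X B → Bool) → Pattern B → Set
  Shatters F [] = F [] ≡ true
  Shatters F (nothing ∷ ps) = Shatters (proj F) ps
  Shatters F (just i ∷ ps) = Shatters (section i F) ps

  entries : ∀ {B} → Pattern B → List (Fin B × Fin R)
  entries [] = []
  entries (nothing ∷ ps) = map (map₁ suc) (entries ps)
  entries (just i ∷ ps) = (zero , i) ∷ map (map₁ suc) (entries ps)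


  shatters-∅ : ∀ B (F : Vec X B → Bool) v → v ∈ allVec xs B → F v ≡ true →
    ∃ λ ps → Shatters F ps × length (entries ps) ≡ 0
  shatters-∅ zero F [] v∈ e = [] , e , refl
  shatters-∅ (suc B) F (x ∷ v) v∈ e with shatters-∅ B (proj F) v (∈-allVec v (∈-allVec⁻ xs v∈ ∘ suc))
      (any-true _ (∈-allVec⁻ xs v∈ zero) e)
  ... | ps , s , eq = nothing ∷ ps , s , trans (ListP.length-map _ (entries ps)) eq

  growth : ℕ
  growth = suc (length xs * R)

  all-or-some : {Y : Set} {P Q : Y → Set} (ys : List Y) → (∀ y → P y ⊎ Q y) →
    (∀ {y} → y ∈ ys → P y) ⊎ ∃ Q
  all-or-some [] f = inj₁ λ ()
  all-or-some (y ∷ ys) f with f y | all-or-some ys f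
  ... | inj₂ q | _ = inj₂ (y , q)
  ... | inj₁ _ | inj₂ q = inj₂ q
  ... | inj₁ p | inj₁ ps = inj₁ λ { (here refl) → p ; (there y∈) → ps y∈ }

  module _ (D : ℕ) (1≤D : 1 ≤ D) where

    -- After division by D ^ B this is (M + 1/D)^B times a factor `growth` · D for each of u marks:
    -- an exponential rate arbitrarily close to M, without a sum of binomial coefficients.
    weight : ℕ → ℕ → ℕ
    weight B u = (M * D + 1) ^ B * (growth * D) ^ u

    1≤growth^ : ∀ u → 1 ≤ (growth * D) ^ u
    1≤growth^ u = subst (_≤ (growth * D) ^ u) (^-zeroˡ u) (^-monoˡ-≤ u (*-mono-≤ {1} {growth} (s≤s z≤n) 1≤D))

    count-step : ∀ B (F : Vec X (suc B) → Bool) → count (suc B) F ≤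
      M * count B (proj F) + length xs * lsum (allFin R) (λ i → count B (section i F))
    count-step B F = begin
      count (suc B) F ≤⟨ csum-mono B (λ v → fibre-bound (λ x → F (x ∷ v))) ⟩
      csum B (λ v → M * bool→ℕ (proj F v) + length xs * lsum (allFin R) (λ i → bool→ℕ (section i F v)))
        ≡⟨ csum-+ B _ _ ⟩
      csum B (λ v → M * bool→ℕ (proj F v)) + csum B (λ v → length xs * lsum (allFin R) (λ i → bool→ℕ (section i F v)))
        ≡⟨ cong₂ _+_ (csum-* B M _) (trans (csum-* B (length xs) _) (cong (length xs *_) (csum-lsum B (allFin R) _))) ⟩
      M * count B (proj F) + length xs * lsum (allFin R) (λ i → count B (section i F)) ∎
      where open ≤-Reasoning

    -- Induction on the first coordinate. If projecting it away gives no pattern with u + 1 marks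
    -- and no section gives one with u, the bounds for both enter `count-step`. The projection
    -- accounts for M and the sections for 1/D in the new factor M + 1/D, because `growth` exceeds
    -- the alphabet size times R.
    sauer-shelah : ∀ B u (F : Vec X B → Bool) →
      (count B F * D ^ B ≤ weight B u) ⊎ ∃ λ ps → Shatters F ps × length (entries ps) ≡ u
    sauer-shelah B zero F with count-witness B F
    ... | inj₁ e rewrite e = inj₁ z≤n
    ... | inj₂ (v , v∈ , e) = inj₂ (shatters-∅ B F v v∈ e)
    sauer-shelah zero (suc u) F = inj₁ (*-mono-≤ (bool→ℕ≤1 (F [])) (1≤growth^ (suc u)))
    sauer-shelah (suc B) (suc u) F with sauer-shelah B (suc u) (proj F)
    ... | inj₂ (ps , s , e) = inj₂ (nothing ∷ ps , s , trans (ListP.length-map _ (entries ps)) e)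
    ... | inj₁ le₁ with all-or-some (allFin R) (λ i → sauer-shelah B u (section i F))
    ...   | inj₂ (i , ps , s , e) = inj₂ (just i ∷ ps , s , cong suc (trans (ListP.length-map _ (entries ps)) e))
    ...   | inj₁ le₂ = inj₁ (begin
      count (suc B) F * (D * D ^ B) ≤⟨ *-monoˡ-≤ (D * D ^ B) (count-step B F) ⟩
      (M * c₁ + q * Σc) * (D * D ^ B) ≡⟨ expand M c₁ q Σc D (D ^ B) ⟩
      D * (M * (c₁ * D ^ B) + q * (Σc * D ^ B)) ≤⟨ *-monoʳ-≤ D (+-mono-≤ (*-monoʳ-≤ M le₁) (*-monoʳ-≤ q Σ≤)) ⟩
      D * (M * weight B (suc u) + q * (R * weight B u)) ≤⟨ *-monoʳ-≤ D (+-monoʳ-≤ (M * weight B (suc u)) qR≤) ⟩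
      D * (M * weight B (suc u) + growth * weight B u) ≡⟨ collect M D growth ((M * D + 1) ^ B) ((growth * D) ^ u) ⟩
      weight (suc B) (suc u) ∎)
      where
      open ≤-Reasoning
      c₁ = count B (proj F)
      q = length xs
      Σc = lsum (allFin R) (λ i → count B (section i F))
      expand : ∀ M c q s D E → (M * c + q * s) * (D * E) ≡ D * (M * (c * E) + q * (s * E))
      expand = solve-∀
      collect : ∀ M D c E G → D * (M * (E * ((c * D) * G)) + c * (E * G)) ≡ ((M * D + 1) * E) * ((c * D) * G)
      collect = solve-∀
      Σ≤ : Σc * D ^ B ≤ R * weight B u
      Σ≤ = begin
        Σc * D ^ B ≡⟨ *-comm Σc (D ^ B) ⟩
        D ^ B * Σc ≡⟨ sym (lsum-* (allFin R) (D ^ B) _) ⟩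
        lsum (allFin R) (λ i → D ^ B * count B (section i F))
          ≤⟨ lsum-≤ (allFin R) (λ {i} i∈ → ≤-trans (≤-reflexive (*-comm (D ^ B) (count B (section i F)))) (le₂ i∈)) ⟩
        length (allFin R) * weight B u ≡⟨ cong (_* weight B u) (ListP.length-tabulate {n = R} id) ⟩
        R * weight B u ∎
      qR≤ : q * (R * weight B u) ≤ growth * weight B u
      qR≤ = ≤-trans (≤-reflexive (sym (*-assoc q R _))) (*-monoˡ-≤ (weight B u) (n≤1+n (q * R)))

  realise : ∀ {B} (F : Vec X B → Bool) (ps : Pattern B) → Shatters F ps → (a : Fin B → X) →
    (∀ {i ℓ} → (i , ℓ) ∈ entries ps → a i ∈ lookup lists ℓ) →
    ∃ λ v → F v ≡ true × (∀ {i ℓ} → (i , ℓ) ∈ entries ps → Vec.lookup v i ≡ a i)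
  realise F [] s a ok = [] , s , λ ()
  realise F (nothing ∷ ps) s a ok with realise (proj F) ps s (a ∘ suc) (λ p → ok (∈-map⁺ (map₁ suc) p))
  ... | v , e , agree with any-find _ xs e
  ...   | x , _ , e′ = x ∷ v , e′ , agree′
    where
    agree′ : ∀ {i ℓ} → (i , ℓ) ∈ map (map₁ suc) (entries ps) → Vec.lookup (x ∷ v) i ≡ a i
    agree′ p with ∈-map⁻ (map₁ suc) p
    ... | (j , _) , q , refl = agree q
  realise F (just ℓ₀ ∷ ps) s a ok with realise (section ℓ₀ F) ps s (a ∘ suc) (λ p → ok (there (∈-map⁺ (map₁ suc) p)))
  ... | v , e , agree = a zero ∷ v , all-true _ (lookup lists ℓ₀) e (ok (here refl)) , agree′
    where
    agree′ : ∀ {i ℓ} → (i , ℓ) ∈ (zero , ℓ₀) ∷ map (map₁ suc) (entries ps) → Vec.lookup (a zero ∷ v) i ≡ a i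
    agree′ (here refl) = refl
    agree′ (there p) with ∈-map⁻ (map₁ suc) p
    ... | (j , _) , q , refl = agree q

  entries-lookup : ∀ {B} (ps : Pattern B) {i ℓ} → (i , ℓ) ∈ entries ps → Vec.lookup ps i ≡ just ℓ
  entries-lookup (nothing ∷ ps) p with ∈-map⁻ (map₁ suc) p
  ... | (j , _) , q , refl = entries-lookup ps q
  entries-lookup (just x ∷ ps) (here refl) = refl
  entries-lookup (just x ∷ ps) (there p) with ∈-map⁻ (map₁ suc) p
  ... | (j , _) , q , refl = entries-lookup ps q

  entries-sorted : ∀ {B} (ps : Pattern B) → AllPairs (λ e e′ → proj₁ e Fin.< proj₁ e′) (entries ps)
  entries-sorted [] = []
  entries-sorted (nothing ∷ ps) = AllPairsP.map⁺ (AllPairs.map s≤s (entries-sorted ps))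
  entries-sorted (just i ∷ ps) = AllP.map⁺ (All.tabulate λ _ → s≤s z≤n)
    ∷ AllPairsP.map⁺ (AllPairs.map s≤s (entries-sorted ps))

  record ShatteredBy {B : ℕ} (F : Vec X B → Bool) (u : ℕ) : Set where
    field
      letters : List X
      letters-length : length letters ≡ suc M
      letters-unique : Unique xs → Unique letters
      coordinates : List (Fin B)
      increasing : AllPairs Fin._<_ coordinates
      many : u < length coordinates
      realised : (a : Fin B → X) → (∀ {z} → z ∈ coordinates → a z ∈ letters) →
        ∃ λ v → F v ≡ true × (∀ {z} → z ∈ coordinates → Vec.lookup v z ≡ a z)

  -- More than R · u marks share one of R lists more than u times. The other marks are given up by
  -- assigning them a fixed member of their own list, so every choice at the retained coordinates
  -- remains realisable.
  one-list : ∀ {B} (F : Vec X B → Bool) (u : ℕ) (ps : Pattern B) → Shatters F ps →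
    R * u < length (entries ps) → ShatteredBy F u
  one-list {B} F u ps s lt with pigeonhole FinP._≟_ proj₂ (allFin R) (entries ps) u (λ _ → ∈-allFin _)
      (subst (λ z → z * u < length (entries ps)) (sym (ListP.length-tabulate {n = R} id)) lt)
  ... | ℓ₀ , P? , many = record
    { letters = lookup lists ℓ₀
    ; letters-length = combs-length (suc M) xs (∈-lookup ℓ₀)
    ; letters-unique = λ u → combs-unique (suc M) u (∈-lookup ℓ₀)
    ; coordinates = map proj₁ (filter P? (entries ps))
    ; increasing = AllPairsP.map⁺ (AllPairsP.filter⁺ P? (entries-sorted ps))
    ; many = subst (u <_) (sym (ListP.length-map proj₁ (filter P? (entries ps)))) many
    ; realised = realised
    }
    where
    member : ∀ ℓ → ∃ λ x → x ∈ lookup lists ℓ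
    member ℓ with lookup lists ℓ | combs-length (suc M) xs (∈-lookup ℓ)
    ... | x ∷ _ | _ = x , here refl
    realised : (a : Fin B → X) → (∀ {z} → z ∈ map proj₁ (filter P? (entries ps)) → a z ∈ lookup lists ℓ₀) →
      ∃ λ v → F v ≡ true × (∀ {z} → z ∈ map proj₁ (filter P? (entries ps)) → Vec.lookup v z ≡ a z)
    realised a ok = proj₁ result , proj₁ (proj₂ result) , agree
      where
      choose : Fin B → Maybe (Fin R) → X
      choose i nothing = a i
      choose i (just ℓ) with ℓ FinP.≟ ℓ₀
      ... | yes _ = a i
      ... | no _ = proj₁ (member ℓ)
      a′ : Fin B → X
      a′ i = choose i (Vec.lookup ps i)
      ok′ : ∀ {i ℓ} → (i , ℓ) ∈ entries ps → a′ i ∈ lookup lists ℓ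
      ok′ {i} {ℓ} p rewrite entries-lookup ps p with ℓ FinP.≟ ℓ₀
      ... | yes refl = ok (∈-map⁺ proj₁ (∈-filter⁺ P? p refl))
      ... | no _ = proj₂ (member ℓ)
      a′≡a : ∀ {i} → (i , ℓ₀) ∈ entries ps → a′ i ≡ a i
      a′≡a q rewrite entries-lookup ps q with ℓ₀ FinP.≟ ℓ₀
      ... | yes _ = refl
      ... | no ne = ⊥-elim (ne refl)
      result = realise F ps s a′ ok′
      agree : ∀ {z} → z ∈ map proj₁ (filter P? (entries ps)) → Vec.lookup (proj₁ result) z ≡ a z
      agree z∈ with ∈-map⁻ proj₁ z∈
      ... | (i , ℓ) , p , refl with ∈-filter⁻ P? {xs = entries ps} p
      ...   | q , refl = trans (proj₂ (proj₂ result) q) (a′≡a q)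

  count-or-shattered : (D : ℕ) (1≤D : 1 ≤ D) (B u : ℕ) (F : Vec X B → Bool) →
    (count B F * D ^ B ≤ weight D 1≤D B (suc (R * u))) ⊎ ShatteredBy F u
  count-or-shattered D 1≤D B u F with sauer-shelah D 1≤D B (suc (R * u)) F
  ... | inj₁ le = inj₁ le
  ... | inj₂ (ps , s , e) = inj₂ (one-list F u ps s (≤-reflexive (sym e)))

-- Solutions among shattered clusters

fsum : (h : ℕ) → (Fin h → ℕ) → ℕ
fsum zero f = 0
fsum (suc h) f = f zero + fsum h (f ∘ suc)

fsum-< : ∀ h {f : Fin h → ℕ} {V} → 1 ≤ h → (∀ i → f i < V) → fsum h f < h * V
fsum-< (suc zero) {f} {V} _ lt = subst₂ _<_ (sym (+-identityʳ _)) (sym (+-identityʳ V)) (lt zero)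
fsum-< (suc (suc h)) _ lt = +-mono-< (lt zero) (fsum-< (suc h) (s≤s z≤n) (lt ∘ suc))

fsum-mono-< : ∀ h {f g : Fin h → ℕ} → 1 ≤ h → (∀ i → f i < g i) → fsum h f < fsum h g
fsum-mono-< (suc zero) _ lt = +-monoˡ-< 0 (lt zero)
fsum-mono-< (suc (suc h)) _ lt = +-mono-< (lt zero) (fsum-mono-< (suc h) (s≤s z≤n) (lt ∘ suc))

Injective₂ : {I J X : Set} → (I → J → X) → Set
Injective₂ f = ∀ {i j i′ j′} → f i j ≡ f i′ j′ → i ≡ i′ × j ≡ j′

increasing⇒injective : ∀ {B} (φ : Fin B → ℕ) → (∀ {b b′} → b Fin.< b′ → φ b < φ b′) →
  ∀ {b b′} → φ b ≡ φ b′ → b ≡ b′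
increasing⇒injective φ mono {b} {b′} e with FinP.<-cmp b b′
... | tri< lt _ _ = ⊥-elim (<-irrefl e (mono lt))
... | tri≈ _ eq _ = eq
... | tri> _ _ gt = ⊥-elim (<-irrefl (sym e) (mono gt))

length-cartesianProduct : {X Y : Set} (xs : List X) (ys : List Y) →
  length (cartesianProduct xs ys) ≡ length xs * length ys
length-cartesianProduct [] ys = refl
length-cartesianProduct (x ∷ xs) ys = trans (ListP.length-++ (map (x ,_) ys))
  (cong₂ _+_ (ListP.length-map (x ,_) ys) (length-cartesianProduct xs ys))

length-allFin : ∀ n → length (allFin n) ≡ n
length-allFin n = ListP.length-tabulate {n = n} id

-- The rows are indexed by pairs (a , b) with equal values of
-- φ′ (z a) + Σᵢ φ (z (i w + b)): since both summands are injective, two such pairs differ in both entries.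
equal-sums : (k h′ B w V : ℕ) → 1 ≤ h′ → (φ′ φ : Fin B → ℕ) → (∀ b → φ′ b < V) → (∀ b → φ b < V) →
  (∀ {b b′} → φ′ b ≡ φ′ b′ → b ≡ b′) → (∀ {b b′} → b Fin.< b′ → φ b < φ b′) →
  (zs : List (Fin B)) → AllPairs Fin._<_ zs → suc h′ * w ≤ length zs → (suc h′ * V) * k < w * w →
  ∃ λ (x : Fin k → Fin (suc h′) → Fin B) → (∀ ℓ i → x ℓ i ∈ zs) × Injective₂ x ×
    (∀ ℓ ℓ′ → φ′ (x ℓ zero) + fsum h′ (λ i → φ (x ℓ (suc i))) ≡ φ′ (x ℓ′ zero) + fsum h′ (λ i → φ (x ℓ′ (suc i))))
equal-sums k h′ B w V 1≤h′ φ′ φ φ′<V φ<V φ′-inj φ-mono zs sorted le lt = x , x∈ , x-inj , x-sum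
  where
  -- The coordinates are cut into h consecutive blocks of length w. A pair (a , b) takes place a in
  -- block 0 and place b in every later block, so `S` increases with b. The w² pairs compete for h ·
  -- V values, and more than k of them agree.
  ix : Fin (suc h′) → Fin w → Fin (suc h′ * w)
  ix = Fin.combine
  z : Fin (suc h′ * w) → Fin B
  z j = lookup zs (Fin.inject≤ j le)
  z-mono : ∀ {i j} → i Fin.< j → z i Fin.< z j
  z-mono {i} {j} lt′ = lookup-mono sorted (subst₂ _<_ (sym (FinP.toℕ-inject≤ i le)) (sym (FinP.toℕ-inject≤ j le)) lt′)
  z-inj : ∀ {i j} → z i ≡ z j → i ≡ j
  z-inj e = increasing⇒injective (toℕ ∘ z) z-mono (cong toℕ e)
  S : Fin w → ℕ
  S b = fsum h′ (λ i → φ (z (ix (suc i) b)))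
  S-inj : ∀ {b b′} → S b ≡ S b′ → b ≡ b′
  S-inj = increasing⇒injective S (λ {b} {b′} b<b′ → fsum-mono-< h′ 1≤h′ λ i → φ-mono (z-mono
    (subst₂ _<_ (sym (FinP.toℕ-combine (suc i) b)) (sym (FinP.toℕ-combine (suc i) b′)) (+-monoʳ-< _ b<b′))))
  val : Fin w × Fin w → ℕ
  val (a , b) = φ′ (z (ix zero a)) + S b
  pairs = cartesianProduct (allFin w) (allFin w)
  hole = pigeonhole _≟_ val (upTo (suc h′ * V)) pairs k
    (λ {ab} _ → ∈-upTo⁺ (+-mono-< (φ′<V (z (ix zero (proj₁ ab)))) (fsum-< h′ 1≤h′ (λ i → φ<V _))))
    (subst₂ _<_ (cong (_* k) (sym (ListP.length-upTo (suc h′ * V))))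
      (sym (trans (length-cartesianProduct (allFin w) (allFin w)) (cong₂ _*_ (length-allFin w) (length-allFin w)))) lt)
  v₀ = proj₁ hole
  P? = proj₁ (proj₂ hole)
  class = filter P? pairs
  pair : Fin k → Fin w × Fin w
  pair ℓ = lookup class (Fin.inject≤ ℓ (<⇒≤ (proj₂ (proj₂ hole))))
  pair-val : ∀ ℓ → val (pair ℓ) ≡ v₀
  pair-val ℓ = proj₂ (∈-filter⁻ P? {xs = pairs} (∈-lookup (Fin.inject≤ ℓ (<⇒≤ (proj₂ (proj₂ hole))))))
  pair-inj : ∀ {ℓ ℓ′} → pair ℓ ≡ pair ℓ′ → ℓ ≡ ℓ′
  pair-inj e = FinP.inject≤-injective _ _ _ _ (lookup-injective
    (UniqueP.filter⁺ P? (UniqueP.cartesianProduct⁺ (UniqueP.allFin⁺ w) (UniqueP.allFin⁺ w))) e)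
  entry : Fin w × Fin w → Fin (suc h′) → Fin w
  entry (a , b) zero = a
  entry (a , b) (suc i) = b
  x : Fin k → Fin (suc h′) → Fin B
  x ℓ i = z (ix i (entry (pair ℓ) i))
  x∈ : ∀ ℓ i → x ℓ i ∈ zs
  x∈ ℓ i = ∈-lookup (Fin.inject≤ (ix i (entry (pair ℓ) i)) le)
  entry-inj : ∀ p p′ i → val p ≡ val p′ → entry p i ≡ entry p′ i → p ≡ p′
  entry-inj (a , b) (a′ , b′) zero ev refl = cong (a ,_) (S-inj (+-cancelˡ-≡ _ _ _ ev))
  entry-inj (a , b) (a′ , b′) (suc i) ev refl = cong (_, b)
    (proj₂ (FinP.combine-injective {suc h′} zero a zero a′ (z-inj (φ′-inj (+-cancelʳ-≡ _ _ _ ev)))))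
  x-inj : Injective₂ x
  x-inj {ℓ} {i} {ℓ′} {i′} e with FinP.combine-injective i _ i′ _ (z-inj e)
  ... | refl , e′ = pair-inj (entry-inj (pair ℓ) (pair ℓ′) i (trans (pair-val ℓ) (sym (pair-val ℓ′))) e′) , refl
  x-sum : ∀ ℓ ℓ′ → _
  x-sum ℓ ℓ′ = trans (pair-val ℓ) (sym (pair-val ℓ′))

-- Stated for numerical codes of indexed points: the shattering argument uses only sums, size and
-- order of these codes.
RainbowFree : (k h : ℕ) {N r : ℕ} (code : Fin N → ℕ) → Vec (Fin r) N → Set
RainbowFree k h {N} code c = (x : Fin k → Fin h → Fin N) →
  (∀ ℓ ℓ′ → fsum h (code ∘ x ℓ) ≡ fsum h (code ∘ x ℓ′)) →
  Injective₂ (λ ℓ i → Vec.lookup c (x ℓ i)) → ⊥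

length-difference : {X : Set} (_≟_ : DecidableEquality X) (us ys : List X) → Unique us →
  let open DecMembership _≟_ using (_∉?_) in length us ≤ length (filter (_∉? ys) us) + length ys
length-difference _≟_ us ys u = subst (length us ≤_) (ListP.length-++ (filter (_∉? ys) us)) (⊆-length u sub)
  where
  open DecMembership _≟_ using (_∈?_; _∉?_)
  sub : us ⊆ filter (_∉? ys) us ++ ys
  sub {x} x∈ with x ∈? ys
  ... | yes p = ∈-++⁺ʳ (filter (_∉? ys) us) p
  ... | no ¬p = ∈-++⁺ˡ (∈-filter⁺ (_∉? ys) x∈ ¬p)

prodVec : {X : Set} (T : ℕ) → (Fin T → List X) → List (Vec X T)
prodVec zero Ls = [ [] ]
prodVec (suc T) Ls = concatMap (λ x → map (x ∷_) (prodVec T (Ls ∘ suc))) (Ls zero)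

∈-prodVec : {X : Set} (T : ℕ) (Ls : Fin T → List X) (v : Vec X T) → (∀ j → Vec.lookup v j ∈ Ls j) → v ∈ prodVec T Ls
∈-prodVec zero Ls [] p = here refl
∈-prodVec (suc T) Ls (x ∷ v) p =
  ∈-concatMap-intro (λ x → map (x ∷_) (prodVec T (Ls ∘ suc))) (p zero) (∈-map⁺ (x ∷_) (∈-prodVec T (Ls ∘ suc) v (p ∘ suc)))

length-prodVec : {X : Set} (T : ℕ) (Ls : Fin (suc T) → List X) →
  length (prodVec (suc T) Ls) ≤ length (Ls zero) * length (prodVec T (Ls ∘ suc))
length-prodVec T Ls = length-concatMap-≤ _ _ (Ls zero) λ {x} _ → ≤-reflexive (ListP.length-map (x ∷_) (prodVec T (Ls ∘ suc)))

length-prodVec-≤ : {X : Set} (m T : ℕ) (Ls : Fin T → List X) → (∀ j → length (Ls j) ≤ m) → length (prodVec T Ls) ≤ m ^ T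
length-prodVec-≤ m zero Ls le = ≤-refl
length-prodVec-≤ m (suc T) Ls le = ≤-trans (length-prodVec T Ls) (*-mono-≤ (le zero) (length-prodVec-≤ m T (Ls ∘ suc) (le ∘ suc)))

-- A product of T factors of size at most m reaches m ^ T only if no factor falls short: the other
-- factors are bounded by their maximum and cancelled.
length-prodVec-full : {X : Set} (m T : ℕ) (Ls : Fin T → List X) → 1 ≤ m → (∀ j → length (Ls j) ≤ m) →
  m ^ T ≤ length (prodVec T Ls) → ∀ j → m ≤ length (Ls j)
length-prodVec-full m@(suc _) (suc T) Ls 1≤m le big zero = *-cancelʳ-≤ m (length (Ls zero)) (m ^ T) {{m^n≢0 m T}}
  (≤-trans big (≤-trans (length-prodVec T Ls) (*-monoʳ-≤ (length (Ls zero)) (length-prodVec-≤ m T (Ls ∘ suc) (le ∘ suc)))))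
length-prodVec-full m@(suc _) (suc T) Ls 1≤m le big (suc j) = length-prodVec-full m T (Ls ∘ suc) 1≤m (le ∘ suc)
  (*-cancelˡ-≤ m (≤-trans big (≤-trans (length-prodVec T Ls) (*-monoˡ-≤ _ (le zero))))) j

take-⊆ : {X : Set} (n : ℕ) (xs : List X) → take n xs ⊆ xs
take-⊆ (suc n) (x ∷ xs) (here e) = here e
take-⊆ (suc n) (x ∷ xs) (there p) = there (take-⊆ n xs p)

firstRest : {X : Set} {n : ℕ} → X → X → Fin n → X
firstRest x y zero = x
firstRest x y (suc _) = y

module Clusters
  (k′ h′ m : ℕ) (1≤h′ : 1 ≤ h′) (kh : suc k′ * suc h′ ≡ suc m)
  {N r V : ℕ} (code : Fin N → ℕ) (code<V : ∀ i → code i < V)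
  {B T : ℕ} (K : Fin B → Fin T → Fin N)
  (K-mono : ∀ {b b′} j → b Fin.< b′ → code (K b j) < code (K b′ j))
  (Family : Vec (Fin r) N → Set) (family-free : ∀ {c} → Family c → RainbowFree (suc k′) (suc h′) code c)
  (F : Vec (Vec (Fin r) T) B → Bool)
  (F-family : ∀ {v} → F v ≡ true → ∃ λ c → Family c × (∀ b j → Vec.lookup (Vec.lookup v b) j ≡ Vec.lookup c (K b j)))
  (blocks : List (Vec (Fin r) T)) (blocks-unique : Unique blocks)
  (M w : ℕ) (w-large : (suc h′ * V) * suc k′ < w * w)
  (shattered : Shattering.ShatteredBy blocks M F (suc h′ * w))
  where
  open Shattering.ShatteredBy shattered

  k h : ℕ
  k = suc k′
  h = suc h′

  m≡ : m ≡ k′ + k * h′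
  m≡ = suc-injective (trans (sym kh) (trans (*-suc k h′) refl))

  default : ∃ λ v → v ∈ letters
  default with letters | letters-length
  ... | v ∷ _ | _ = v , here refl

  -- `equal-sums` finds a solution whose entries lie in pairwise different shattered clusters, with
  -- column 0 at position j′ and the other columns at j. The words of these clusters can be
  -- prescribed independently, so any kh distinct colors available at the two positions can be put
  -- on it.
  no-rainbow : (j′ j : Fin T) (col : Fin k → Fin h → Fin r) → Injective₂ col →
    (∀ ℓ i → ∃ λ v → v ∈ letters × Vec.lookup v (firstRest j′ j i) ≡ col ℓ i) → ⊥
  no-rainbow j′ j col col-inj wit = family-free (proj₁ (proj₂ real)) X sums rainbow
    where
    rows = equal-sums k h′ B w V 1≤h′ (λ b → code (K b j′)) (λ b → code (K b j)) (λ b → code<V _) (λ b → code<V _)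
      (increasing⇒injective _ (K-mono j′)) (K-mono j) coordinates increasing (<⇒≤ many) w-large
    x = proj₁ rows
    x-inj : Injective₂ x
    x-inj = proj₁ (proj₂ (proj₂ rows))
    search : ∀ b → Dec (∃ λ ℓ → ∃ λ i → x ℓ i ≡ b)
    search b = FinP.any? (λ ℓ → FinP.any? (λ i → x ℓ i FinP.≟ b))
    -- As x is injective, a cluster meets at most one entry (ℓ , i), whose word it receives; a
    -- cluster off the solution gets the default word.
    choose : ∀ b → Dec (∃ λ ℓ → ∃ λ i → x ℓ i ≡ b) → ∃ λ v → v ∈ letters
    choose b (yes (ℓ , i , _)) = proj₁ (wit ℓ i) , proj₁ (proj₂ (wit ℓ i))
    choose b (no _) = default
    choose-x : ∀ ℓ i d → proj₁ (choose (x ℓ i) d) ≡ proj₁ (wit ℓ i)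
    choose-x ℓ i (no ¬p) = ⊥-elim (¬p (ℓ , i , refl))
    choose-x ℓ i (yes (ℓ′ , i′ , e)) with x-inj {ℓ′} {i′} {ℓ} {i} e
    ... | refl , refl = refl
    assignment = realised (λ b → proj₁ (choose b (search b))) (λ {b} _ → proj₂ (choose b (search b)))
    v = proj₁ assignment
    real = F-family (proj₁ (proj₂ assignment))
    c = proj₁ real
    X : Fin k → Fin h → Fin N
    X ℓ i = K (x ℓ i) (firstRest j′ j i)
    sums : ∀ ℓ ℓ′ → fsum h (code ∘ X ℓ) ≡ fsum h (code ∘ X ℓ′)
    sums = proj₂ (proj₂ (proj₂ rows))
    v-x : ∀ ℓ i → Vec.lookup v (x ℓ i) ≡ proj₁ (wit ℓ i)
    v-x ℓ i = trans (proj₂ (proj₂ assignment) (proj₁ (proj₂ rows) ℓ i)) (choose-x ℓ i (search (x ℓ i)))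
    coloured : ∀ ℓ i → Vec.lookup c (X ℓ i) ≡ col ℓ i
    coloured ℓ i = trans (sym (proj₂ (proj₂ real) (x ℓ i) (firstRest j′ j i)))
      (trans (cong (λ u → Vec.lookup u (firstRest j′ j i)) (v-x ℓ i)) (proj₂ (proj₂ (wit ℓ i))))
    rainbow : Injective₂ (λ ℓ i → Vec.lookup c (X ℓ i))
    rainbow {ℓ} {i} {ℓ′} {i′} e = col-inj (trans (sym (coloured ℓ i)) (trans e (coloured ℓ′ i′)))

  palette : Fin T → List (Fin r)
  palette j = deduplicate FinP._≟_ (map (λ v → Vec.lookup v j) letters)

  palette-unique : ∀ j → Unique (palette j)
  palette-unique j = deduplicate-! FinP._≟_ _

  palette⁺ : ∀ j {v} → v ∈ letters → Vec.lookup v j ∈ palette j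
  palette⁺ j v∈ = ∈-deduplicate⁺ FinP._≟_ (∈-map⁺ (λ v → Vec.lookup v j) v∈)

  palette⁻ : ∀ j {α} → α ∈ palette j → ∃ λ v → v ∈ letters × Vec.lookup v j ≡ α
  palette⁻ j α∈ with ∈-map⁻ (λ v → Vec.lookup v j) (∈-deduplicate⁻ FinP._≟_ _ α∈)
  ... | v , v∈ , e = v , v∈ , sym e

  -- With j′ = j: any m + 1 = kh colors occurring at one position could be placed on a solution.
  palette-≤ : ∀ j → length (palette j) ≤ m
  palette-≤ j with suc m ≤? length (palette j)
  ... | no ¬le = ≤-pred (≰⇒> ¬le)
  ... | yes le = ⊥-elim (no-rainbow j j col col-inj wit)
    where
    le′ : k * h ≤ length (palette j)
    le′ = subst (_≤ length (palette j)) (sym kh) le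
    col : Fin k → Fin h → Fin r
    col ℓ i = lookup (palette j) (Fin.inject≤ (Fin.combine ℓ i) le′)
    col-inj : Injective₂ col
    col-inj {ℓ} {i} {ℓ′} {i′} e = FinP.combine-injective ℓ i ℓ′ i′
      (FinP.inject≤-injective _ _ _ _ (lookup-injective (palette-unique j) e))
    wit : ∀ ℓ i → ∃ λ v → v ∈ letters × Vec.lookup v (firstRest j j i) ≡ col ℓ i
    wit ℓ zero = palette⁻ j (∈-lookup {xs = palette j} (Fin.inject≤ (Fin.combine ℓ zero) le′))
    wit ℓ (suc i) = palette⁻ j (∈-lookup {xs = palette j} (Fin.inject≤ (Fin.combine ℓ (suc i)) le′))

  -- A color α of position j′ missing at j would fill column 0 together with k′ further colors of
  -- j′. These k′ occupy at most k′ of the m = k′ + k · h′ colors at j, which leaves k · h′ for the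
  -- other columns, and the solution is rainbow.
  palette-⊆ : ∀ j′ j → m ≤ length (palette j′) → m ≤ length (palette j) → palette j′ ⊆ palette j
  palette-⊆ j′ j m≤′ m≤ {α} α∈ with α ∈? palette j
    where open DecMembership (FinP._≟_ {r}) using (_∈?_; _∉?_)
  ... | yes p = p
  ... | no α∉ = ⊥-elim (no-rainbow j′ j col col-inj wit)
    where
    open DecMembership (FinP._≟_ {r}) using (_∈?_; _∉?_)
    others = filter (_∉? (α ∷ [])) (palette j′)
    k′≤others : k′ ≤ length others
    k′≤others = +-cancelʳ-≤ 1 k′ (length others) (begin
      k′ + 1 ≤⟨ +-monoʳ-≤ k′ (≤-trans 1≤h′ (m≤m+n h′ (k′ * h′))) ⟩
      k′ + k * h′ ≡⟨ sym m≡ ⟩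
      m ≤⟨ m≤′ ⟩
      length (palette j′) ≤⟨ length-difference FinP._≟_ (palette j′) (α ∷ []) (palette-unique j′) ⟩
      length others + 1 ∎)
      where open ≤-Reasoning
    ys = take k′ others
    |ys| : length ys ≡ k′
    |ys| = trans (ListP.length-take k′ others) (m≤n⇒m⊓n≡m k′≤others)
    ys⊆ : ys ⊆ others
    ys⊆ = take-⊆ k′ others
    ws = filter (_∉? ys) (palette j)
    kh′≤ws : k * h′ ≤ length ws
    kh′≤ws = +-cancelʳ-≤ k′ (k * h′) (length ws) (begin
      k * h′ + k′ ≡⟨ +-comm (k * h′) k′ ⟩
      k′ + k * h′ ≡⟨ sym m≡ ⟩
      m ≤⟨ m≤ ⟩
      length (palette j) ≤⟨ length-difference FinP._≟_ (palette j) ys (palette-unique j) ⟩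
      length ws + length ys ≡⟨ cong (length ws +_) |ys| ⟩
      length ws + k′ ∎)
      where open ≤-Reasoning
    αys-unique : Unique (α ∷ ys)
    αys-unique = All.tabulate (λ y∈ e → proj₂ (∈-filter⁻ (_∉? (α ∷ [])) {xs = palette j′} (ys⊆ y∈)) (here (sym e)))
      ∷ UniqueP.take⁺ k′ (UniqueP.filter⁺ (_∉? (α ∷ [])) (palette-unique j′))
    αys-ws : ∀ {β} → β ∈ α ∷ ys → β ∈ ws → ⊥
    αys-ws (here refl) q = α∉ (proj₁ (∈-filter⁻ (_∉? ys) {xs = palette j} q))
    αys-ws (there p) q = proj₂ (∈-filter⁻ (_∉? ys) {xs = palette j} q) p
    col : Fin k → Fin h → Fin r
    col ℓ zero = lookup (α ∷ ys) (Fin.inject≤ ℓ (≤-reflexive (cong suc (sym |ys|))))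
    col ℓ (suc i) = lookup ws (Fin.inject≤ (Fin.combine ℓ i) kh′≤ws)
    col-inj : Injective₂ col
    col-inj {ℓ} {zero} {ℓ′} {zero} e = FinP.inject≤-injective _ _ _ _ (lookup-injective αys-unique e) , refl
    col-inj {ℓ} {zero} {ℓ′} {suc i′} e = ⊥-elim (αys-ws (∈-lookup {xs = α ∷ ys} (Fin.inject≤ ℓ _)) (subst (_∈ ws) (sym e) (∈-lookup _)))
    col-inj {ℓ} {suc i} {ℓ′} {zero} e = ⊥-elim (αys-ws (∈-lookup {xs = α ∷ ys} (Fin.inject≤ ℓ′ _)) (subst (_∈ ws) e (∈-lookup _)))
    col-inj {ℓ} {suc i} {ℓ′} {suc i′} e with FinP.combine-injective ℓ i ℓ′ i′ (FinP.inject≤-injective _ _ _ _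
        (lookup-injective (UniqueP.filter⁺ (_∉? ys) (palette-unique j)) e))
    ... | refl , refl = refl , refl
    αys⊆ : (α ∷ ys) ⊆ palette j′
    αys⊆ (here refl) = α∈
    αys⊆ (there p) = proj₁ (∈-filter⁻ (_∉? (α ∷ [])) (ys⊆ p))
    wit : ∀ ℓ (i : Fin h) → ∃ λ v → v ∈ letters × Vec.lookup v (firstRest j′ j i) ≡ col ℓ i
    wit ℓ zero = palette⁻ j′ (αys⊆ (∈-lookup {xs = α ∷ ys} (Fin.inject≤ ℓ _)))
    wit ℓ (suc i) = palette⁻ j (proj₁ (∈-filter⁻ (_∉? ys) {xs = palette j} (∈-lookup {xs = ws} (Fin.inject≤ (Fin.combine ℓ i) kh′≤ws))))

  -- If position j determines the word, there are no more words than colors at j. For one-point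
  -- clusters this contradicts a list of m + 1 letters.
  letters-≤ : (j : Fin T) → (∀ {v v′ : Vec (Fin r) T} → Vec.lookup v j ≡ Vec.lookup v′ j → v ≡ v′) →
    suc M ≤ m
  letters-≤ j inj = begin
    suc M ≡⟨ sym letters-length ⟩
    length letters ≤⟨ injection-length (λ v → Vec.lookup v j) (letters-unique blocks-unique) (palette⁺ j) (λ _ _ → inj) ⟩
    length (palette j) ≤⟨ palette-≤ j ⟩
    m ∎
    where open ≤-Reasoning

  -- The words lie in the product of the palettes, each of size at most m. With m ^ T words that
  -- product is exhausted, so every palette has exactly m colors, and by `palette-⊆` all palettes
  -- agree.
  full-palette : (j₀ : Fin T) → 1 ≤ m → m ^ T ≤ suc M →
    ∃ λ (P : List (Fin r)) → Unique P × length P ≡ m × (∀ v → (∀ j → Vec.lookup v j ∈ P) → v ∈ letters)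
  full-palette j₀ 1≤m M-large = palette j₀ , palette-unique j₀ , ≤-antisym (palette-≤ j₀) (m≤palette j₀) , λ v ok →
    ⊆-length-full (VecP.≡-dec FinP._≟_) (letters-unique blocks-unique) letters⊆
      (≤-trans (length-prodVec-≤ m T palette palette-≤) (≤-trans M-large (≤-reflexive (sym letters-length))))
      (∈-prodVec T palette v λ j → palette-⊆ j₀ j (m≤palette j₀) (m≤palette j) (ok j))
    where
    letters⊆ : letters ⊆ prodVec T palette
    letters⊆ {v} v∈ = ∈-prodVec T palette v λ j → palette⁺ j v∈
    m≤palette : ∀ j → m ≤ length (palette j)
    m≤palette = length-prodVec-full m T palette 1≤m palette-≤ (≤-trans M-large
      (≤-trans (≤-reflexive (sym letters-length)) (⊆-length (letters-unique blocks-unique) letters⊆)))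

-- Bounds for families of rainbow-free colorings

module _ {N r : ℕ} where

  blockProjection : {B T : ℕ} → (Fin B → Fin T → Fin N) → Vec (Fin r) N → Vec (Vec (Fin r) T) B
  blockProjection K c = Vec.tabulate (λ b → Vec.tabulate (λ j → Vec.lookup c (K b j)))

  lookup-blockProjection : {B T : ℕ} (K : Fin B → Fin T → Fin N) (c : Vec (Fin r) N) → ∀ b j →
    Vec.lookup (Vec.lookup (blockProjection K c) b) j ≡ Vec.lookup c (K b j)
  lookup-blockProjection K c b j = trans (cong (λ v → Vec.lookup v j) (VecP.lookup∘tabulate _ b)) (VecP.lookup∘tabulate _ j)

  traces : {B T : ℕ} → (Fin B → Fin T → Fin N) → List (Vec (Fin r) N) → Vec (Vec (Fin r) T) B → Bool
  traces K cs v = does (v ∈? map (blockProjection K) cs)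
    where open DecMembership (VecP.≡-dec (VecP.≡-dec (FinP._≟_ {r}))) using (_∈?_)

  traces⁻ : {B T : ℕ} (K : Fin B → Fin T → Fin N) (cs : List (Vec (Fin r) N)) {v : Vec (Vec (Fin r) T) B} →
    traces K cs v ≡ true → ∃ λ c → c ∈ cs × (∀ b j → Vec.lookup (Vec.lookup v b) j ≡ Vec.lookup c (K b j))
  traces⁻ K cs {v} e with v ∈? map (blockProjection K) cs
    where open DecMembership (VecP.≡-dec (VecP.≡-dec (FinP._≟_ {r}))) using (_∈?_)
  ... | yes p with ∈-map⁻ (blockProjection K) p
  ...   | c , c∈ , refl = c , c∈ , lookup-blockProjection K c

  traces⁺ : {B S : ℕ} (K : Fin B → Fin S → Fin N) {cs : List (Vec (Fin r) N)} {c : Vec (Fin r) N} → c ∈ cs →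
    T (traces K cs (blockProjection K c))
  traces⁺ K {cs} {c} c∈ with blockProjection K c ∈? map (blockProjection K) cs
    where open DecMembership (VecP.≡-dec (VecP.≡-dec (FinP._≟_ {r}))) using (_∈?_)
  ... | yes p = tt
  ... | no ¬p = ⊥-elim (¬p (∈-map⁺ (blockProjection K) c∈))

blocks : (r T : ℕ) → List (Vec (Fin r) T)
blocks r T = allVec (allFin r) T

blocks-unique : ∀ r T → Unique (blocks r T)
blocks-unique r T = allVec-unique (UniqueP.allFin⁺ r)

∈-blocks : ∀ {r T} (v : Vec (Fin r) T) → v ∈ blocks r T
∈-blocks v = ∈-allVec v (λ _ → ∈-allFin _)

traceCount : {N r B T : ℕ} → (Fin B → Fin T → Fin N) → List (Vec (Fin r) N) → ℕ
traceCount {r = r} {B} {T} K cs = Counting.count (blocks r T) B (traces K cs)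

-- A coloring is determined by its traces on two systems that cover all points. The count splits
-- into clusters, where the saving is made, and leftover single points.
length-≤-traces : {N r B T B′ T′ : ℕ} (K : Fin B → Fin T → Fin N) (K′ : Fin B′ → Fin T′ → Fin N) →
  (∀ i → (∃ λ b → ∃ λ j → K b j ≡ i) ⊎ (∃ λ b → ∃ λ j → K′ b j ≡ i)) →
  (cs : List (Vec (Fin r) N)) → Unique cs → length cs ≤ traceCount K cs * traceCount K′ cs
length-≤-traces {N} {r} {B} {T} {B′} {T′} K K′ cover cs u = subst (length cs ≤_)
  (trans (length-cartesianProduct I I′) (cong₂ _*_ (Counting.length-allVec-filterᵇ (blocks r T) B (traces K cs))
    (Counting.length-allVec-filterᵇ (blocks r T′) B′ (traces K′ cs))))
  (injection-length (λ c → blockProjection K c , blockProjection K′ c) u into inj)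
  where
  I = filterᵇ (traces K cs) (allVec (blocks r T) B)
  I′ = filterᵇ (traces K′ cs) (allVec (blocks r T′) B′)
  into : ∀ {c} → c ∈ cs → (blockProjection K c , blockProjection K′ c) ∈ cartesianProduct I I′
  into {c} c∈ = ∈-cartesianProduct⁺
    (∈-filter⁺ (T? ∘ traces K cs) (∈-allVec (blockProjection K c) (λ _ → ∈-blocks _)) (traces⁺ K c∈))
    (∈-filter⁺ (T? ∘ traces K′ cs) (∈-allVec (blockProjection K′ c) (λ _ → ∈-blocks _)) (traces⁺ K′ c∈))
  agree : ∀ {B T : ℕ} (K : Fin B → Fin T → Fin N) {c c′ : Vec (Fin r) N} → blockProjection K c ≡ blockProjection K c′ →
    ∀ b j → Vec.lookup c (K b j) ≡ Vec.lookup c′ (K b j)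
  agree K {c} {c′} e b j = trans (sym (lookup-blockProjection K c b j))
    (trans (cong (λ v → Vec.lookup (Vec.lookup v b) j) e) (lookup-blockProjection K c′ b j))
  inj : ∀ {c c′} → c ∈ cs → c′ ∈ cs →
    (blockProjection K c , blockProjection K′ c) ≡ (blockProjection K c′ , blockProjection K′ c′) → c ≡ c′
  inj {c} {c′} _ _ e = trans (sym (VecP.tabulate∘lookup c)) (trans (VecP.tabulate-cong same) (VecP.tabulate∘lookup c′))
    where
    same : ∀ i → Vec.lookup c i ≡ Vec.lookup c′ i
    same i with cover i
    ... | inj₁ (b , j , refl) = agree K {c} {c′} (cong proj₁ e) b j
    ... | inj₂ (b , j , refl) = agree K′ {c} {c′} (cong proj₂ e) b j

listCount weightBase : (r T M : ℕ) → ℕ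
listCount r T M = Shattering.R (blocks r T) M
weightBase r T M = Shattering.growth (blocks r T) M

escape : {n r : ℕ} (f : Fin n → Fin r) → (∀ {t t′} → f t ≡ f t′ → t ≡ t′) → (P : List (Fin r)) → length P < n →
  ∃ λ t → f t ∉ P
escape {n} f f-inj P short with FinP.any? (λ t → ¬? (f t ∈? P))
  where open DecMembership FinP._≟_ using (_∈?_)
... | yes q = q
... | no none = ⊥-elim (<-irrefl refl (<-≤-trans short (subst (_≤ length P) (length-allFin n)
    (injection-length f (UniqueP.allFin⁺ n) (λ {t} _ → inside t) (λ _ _ → f-inj)))))
  where
  open DecMembership FinP._≟_ using (_∈?_)
  inside : ∀ t → f t ∈ P
  inside t with f t ∈? P
  ... | yes q = q
  ... | no ¬q = ⊥-elim (none (t , ¬q))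

module Bounds
  (k′ h′ : ℕ) (1≤h′ : 1 ≤ h′) {N r V : ℕ} (code : Fin N → ℕ) (code<V : ∀ i → code i < V)
  (cs : List (Vec (Fin r) N)) (cs-free : ∀ {c} → c ∈ cs → RainbowFree (suc k′) (suc h′) code c)
  (w : ℕ) (w-large : (suc h′ * V) * suc k′ < w * w)
  where

  k h m : ℕ
  k = suc k′
  h = suc h′
  -- In this form `k * h` computes to `suc m`, so `refl` proves the relation between them.
  m = h′ + k′ * suc h′

  singles-bound : {B : ℕ} (idx : Fin B → Fin N) → (∀ {b b′} → b Fin.< b′ → code (idx b) < code (idx b′)) →
    (D : ℕ) → 1 ≤ D → let K = λ b (_ : Fin 1) → idx b in
    traceCount K cs * D ^ B ≤ (m * D + 1) ^ B * (weightBase r 1 m * D) ^ suc (listCount r 1 m * (h * w))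
  singles-bound {B} idx idx-mono D 1≤D with Shattering.count-or-shattered (blocks r 1) m D 1≤D B (h * w) (traces (λ b (_ : Fin 1) → idx b) cs)
  ... | inj₁ le = le
  ... | inj₂ sh = ⊥-elim (<-irrefl refl (letters-≤ zero λ { {x ∷ []} {y ∷ []} refl → refl }))
    where
    open Clusters k′ h′ m 1≤h′ refl code code<V (λ b (_ : Fin 1) → idx b) (λ _ → idx-mono) (_∈ cs) cs-free
      (traces (λ b (_ : Fin 1) → idx b) cs) (traces⁻ (λ b (_ : Fin 1) → idx b) cs) (blocks r 1) (blocks-unique r 1) m w w-large sh

  module Gadgets
    {B T M : ℕ} (K : Fin B → Fin T → Fin N)
    (K-mono : ∀ {b b′} j → b Fin.< b′ → code (K b j) < code (K b′ j))
    (M-large : m ^ T ≤ suc M)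
    (pos : Fin (k * h) → Fin (k * h) → Fin T) (slot : Fin T → Fin (k * h)) (slot-pos : ∀ t e → slot (pos t e) ≡ e)
    (p : Fin (k * h) → Fin N)
    (p-rainbow : ∀ {c} → c ∈ cs → ∀ {t t′} → Vec.lookup c (p t) ≡ Vec.lookup c (p t′) → t ≡ t′)
    where

    -- The integer solution behind a gadget has the entry 0 at index zero, so that place is held by
    -- `p t` for every parameter b.
    gadgetPoint : Fin B → Fin (k * h) → Fin (k * h) → Fin N
    gadgetPoint b t zero = p t
    gadgetPoint b t (suc e) = K b (pos t (suc e))

    not-shattered : (∀ b t (ℓ ℓ′ : Fin k) → fsum h (λ i → code (gadgetPoint b t (Fin.combine ℓ i)))
                          ≡ fsum h (λ i → code (gadgetPoint b t (Fin.combine ℓ′ i)))) →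
      Shattering.ShatteredBy (blocks r T) M (traces K cs) (h * w) → ⊥
    not-shattered solution sh = contra
     where
     open Clusters k′ h′ m 1≤h′ refl code code<V K K-mono (_∈ cs) cs-free
       (traces K cs) (traces⁻ K cs) (blocks r T) (blocks-unique r T) M w w-large sh using (full-palette)
     open Shattering.ShatteredBy sh
     1≤m : 1 ≤ m
     1≤m = ≤-trans 1≤h′ (m≤m+n h′ _)
     fp = full-palette (pos zero zero) 1≤m M-large
     P = proj₁ fp
     |P| : length P ≡ m
     |P| = proj₁ (proj₂ (proj₂ fp))
     -- The m places `suc e` of a gadget receive the m colors of P bijectively. Place zero belongs
     -- to `p t`; the cluster position with that index gets the first color as a filler.
     paint : Fin (suc m) → Fin m
     paint zero = Fin.fromℕ< 1≤m
     paint (suc e) = e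
     colour : Fin (suc m) → Fin r
     colour e = lookup P (Fin.cast (sym |P|) (paint e))
     -- The word depends on the slot only and not on t: `t₀` becomes known from the coloring that
     -- realises this word, so the gadgets of all t have to be prepared.
     v : Vec (Fin r) T
     v = Vec.tabulate (λ j → colour (slot j))
     v∈ : v ∈ letters
     v∈ = proj₂ (proj₂ (proj₂ fp)) v λ j → subst (_∈ P) (sym (VecP.lookup∘tabulate _ j)) (∈-lookup {xs = P} _)
     z₀ : ∃ λ z → z ∈ coordinates
     z₀ with coordinates | many
     ... | z ∷ _ | _ = z , here refl
     b₀ = proj₁ z₀
     real = realised (λ _ → v) (λ _ → v∈)
     fam = traces⁻ K cs (proj₁ (proj₂ real))
     c = proj₁ fam
     c∈ : c ∈ cs
     c∈ = proj₁ (proj₂ fam)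
     coloured : ∀ t e → Vec.lookup c (K b₀ (pos t e)) ≡ colour e
     coloured t e = begin
       Vec.lookup c (K b₀ (pos t e)) ≡⟨ sym (proj₂ (proj₂ fam) b₀ (pos t e)) ⟩
       Vec.lookup (Vec.lookup (proj₁ real) b₀) (pos t e)
         ≡⟨ cong (λ u → Vec.lookup u (pos t e)) (proj₂ (proj₂ real) (proj₂ z₀)) ⟩
       Vec.lookup v (pos t e) ≡⟨ VecP.lookup∘tabulate _ (pos t e) ⟩
       colour (slot (pos t e)) ≡⟨ cong colour (slot-pos t e) ⟩
       colour e ∎
       where open ≡-Reasoning
     outside : ∃ λ t → Vec.lookup c (p t) ∉ P
     outside = escape (λ t → Vec.lookup c (p t)) (λ e → p-rainbow c∈ e) P (s≤s (≤-reflexive |P|))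
     t₀ = proj₁ outside
     y : Fin (k * h) → Fin N
     y = gadgetPoint b₀ t₀
     y-inj : ∀ e e′ → Vec.lookup c (y e) ≡ Vec.lookup c (y e′) → e ≡ e′
     y-inj zero zero eq = refl
     y-inj zero (suc e′) eq = ⊥-elim (proj₂ outside (subst (_∈ P) (sym (trans eq (coloured t₀ (suc e′)))) (∈-lookup {xs = P} _)))
     y-inj (suc e) zero eq = ⊥-elim (proj₂ outside (subst (_∈ P) (sym (trans (sym eq) (coloured t₀ (suc e)))) (∈-lookup {xs = P} _)))
     y-inj (suc e) (suc e′) eq = cong suc (FinP.toℕ-injective (trans (sym (FinP.toℕ-cast (sym |P|) e)) (trans (cong toℕ
       (lookup-injective (proj₁ (proj₂ fp)) (trans (sym (coloured t₀ (suc e))) (trans eq (coloured t₀ (suc e′))))))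
       (FinP.toℕ-cast (sym |P|) e′))))
     contra : ⊥
     contra = cs-free c∈ (λ ℓ i → y (Fin.combine ℓ i)) (solution b₀ t₀)
       (λ {ℓ} {i} {ℓ′} {i′} eq → FinP.combine-injective ℓ i ℓ′ i′ (y-inj _ _ eq))

    gadgets-bound : (∀ b t (ℓ ℓ′ : Fin k) → fsum h (λ i → code (gadgetPoint b t (Fin.combine ℓ i)))
                          ≡ fsum h (λ i → code (gadgetPoint b t (Fin.combine ℓ′ i)))) →
      (D : ℕ) → 1 ≤ D →
      traceCount K cs * D ^ B ≤ (M * D + 1) ^ B * (weightBase r T M * D) ^ suc (listCount r T M * (h * w))
    gadgets-bound solution D 1≤D =
      Sum.[ id , ⊥-elim ∘ not-shattered solution ] (Shattering.count-or-shattered (blocks r T) M D 1≤D B (h * w) (traces K cs))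

-- Encoding points by numbers

-- Base-β expansion, most significant coordinate first. It is linear in the vector without any bound
-- on the entries; `Below` matters for order and injectivity.
code : ℕ → {d : ℕ} → Vec ℕ d → ℕ
code β [] = 0
code β (_∷_ {d} x v) = x * β ^ d + code β v

Below : ℕ → {d : ℕ} → Vec ℕ d → Set
Below β v = ∀ i → Vec.lookup v i < β

code-< : ∀ β {d} (v : Vec ℕ d) → Below β v → code β v < β ^ d
code-< β [] lt = s≤s z≤n
code-< β (_∷_ {d} x v) lt = begin-strict
  x * β ^ d + code β v <⟨ +-monoʳ-< (x * β ^ d) (code-< β v (lt ∘ suc)) ⟩
  x * β ^ d + β ^ d ≡⟨ +-comm (x * β ^ d) (β ^ d) ⟩
  suc x * β ^ d ≤⟨ *-monoˡ-≤ (β ^ d) (lt zero) ⟩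
  β * β ^ d ∎
  where open ≤-Reasoning

code-lex : ∀ β {d x y} {v w : Vec ℕ d} → Below β v → x < y → code β (x ∷ v) < code β (y ∷ w)
code-lex β {d} {x} {y} {v} {w} lt x<y = begin-strict
  x * β ^ d + code β v <⟨ +-monoʳ-< (x * β ^ d) (code-< β v lt) ⟩
  x * β ^ d + β ^ d ≡⟨ +-comm (x * β ^ d) (β ^ d) ⟩
  suc x * β ^ d ≤⟨ *-monoˡ-≤ (β ^ d) x<y ⟩
  y * β ^ d ≤⟨ m≤m+n _ _ ⟩
  y * β ^ d + code β w ∎
  where open ≤-Reasoning

code-injective : ∀ β {d} (v w : Vec ℕ d) → Below β v → Below β w → code β v ≡ code β w → v ≡ w
code-injective β [] [] _ _ _ = refl
code-injective β (x ∷ v) (y ∷ w) bv bw e with <-cmp x y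
... | tri< lt _ _ = ⊥-elim (<-irrefl e (code-lex β {v = v} {w} (bv ∘ suc) lt))
... | tri> _ _ gt = ⊥-elim (<-irrefl (sym e) (code-lex β {v = w} {v} (bw ∘ suc) gt))
... | tri≈ _ refl _ = cong (x ∷_) (code-injective β v w (bv ∘ suc) (bw ∘ suc) (+-cancelˡ-≡ _ _ _ e))

-- Negative displacements stand on the other side, so that affine dependence is an identity in ℕ;
-- linearity of `code` carries it over from the coordinates.
code-affine : ∀ β {d} (μ : ℕ) (x e p b : Vec ℕ d) →
  (∀ i → Vec.lookup x i + μ * Vec.lookup e i ≡ Vec.lookup p i + μ * Vec.lookup b i) →
  code β x + μ * code β e ≡ code β p + μ * code β b
code-affine β μ [] [] [] [] eq = refl
code-affine β μ (_∷_ {d} x xs) (e ∷ es) (p ∷ ps) (b ∷ bs) eq = begin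
  (x * q + code β xs) + μ * (e * q + code β es) ≡⟨ regroup x e μ q (code β xs) (code β es) ⟩
  (x + μ * e) * q + (code β xs + μ * code β es) ≡⟨ cong₂ (λ a b → a * q + b) (eq zero) (code-affine β μ xs es ps bs (eq ∘ suc)) ⟩
  (p + μ * b) * q + (code β ps + μ * code β bs) ≡⟨ sym (regroup p b μ q (code β ps) (code β bs)) ⟩
  (p * q + code β ps) + μ * (b * q + code β bs) ∎
  where
  open ≡-Reasoning
  q = β ^ d
  regroup : ∀ x e μ q X E → (x * q + X) + μ * (e * q + E) ≡ (x + μ * e) * q + (X + μ * E)
  regroup = solve-∀

code-vsum : ∀ β {d} h (f : Fin h → Vec ℕ d) → code β (vsum (tabulate f)) ≡ fsum h (code β ∘ f)
code-vsum β {d} zero f = zeros d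
  where
  zeros : ∀ d → code β (Vec.replicate d 0) ≡ 0
  zeros zero = refl
  zeros (suc d) = zeros d
code-vsum β (suc h) f = trans (code-+ (f zero) _) (cong (code β (f zero) +_) (code-vsum β h (f ∘ suc)))
  where
  code-+ : ∀ {d} (v w : Vec ℕ d) → code β (Vec.zipWith _+_ v w) ≡ code β v + code β w
  code-+ [] [] = refl
  code-+ (_∷_ {d} x v) (y ∷ w) rewrite code-+ v w = regroup x y (β ^ d) (code β v) (code β w)
    where
    regroup : ∀ x y q v w → (x + y) * q + (v + w) ≡ (x * q + v) + (y * q + w)
    regroup = solve-∀

vsum-≤ : ∀ {d n} h (f : Fin h → Vec ℕ d) → (∀ j i → Vec.lookup (f j) i ≤ n) →
  ∀ i → Vec.lookup (vsum (tabulate f)) i ≤ h * n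
vsum-≤ zero f le i = ≤-reflexive (VecP.lookup-replicate i 0)
vsum-≤ (suc h) f le i = subst (_≤ _) (sym (VecP.lookup-zipWith _+_ i (f zero) _))
  (+-mono-≤ (le zero i) (vsum-≤ h (f ∘ suc) (le ∘ suc) i))

toList-map-tabulate : {X Y : Set} {n : ℕ} (g : X → Y) (f : Fin n → X) →
  Vec.toList (Vec.map g (Vec.tabulate f)) ≡ tabulate (g ∘ f)
toList-map-tabulate {n = zero} g f = refl
toList-map-tabulate {n = suc n} g f = cong (g (f zero) ∷_) (toList-map-tabulate g (f ∘ suc))

allVec-increasing : ∀ β {s} d (g : Fin s → ℕ) → (∀ {x y} → x Fin.< y → g x < g y) → (∀ x → g x < β) →
  AllPairs (λ u v → code β (Vec.map g u) < code β (Vec.map g v)) (grid d s)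
allVec-increasing β {s} d g mono bound = allVec-pairs {n = d} {R = Fin._<_} {S = λ u v → code β (Vec.map g u) < code β (Vec.map g v)}
  (λ {_} {x} {y} {v} {w} x<y → code-lex β {v = Vec.map g v} {Vec.map g w}
    (λ i → subst (_< β) (sym (VecP.lookup-map i g v)) (bound _)) (mono x<y))
  (λ lt → +-monoʳ-< _ lt)
  (AllPairsP.tabulate⁺-< id)

coords-≤ : ∀ {d n} (x : Point d n) i → Vec.lookup (coords x) i ≤ n
coords-≤ x i = subst (_≤ _) (sym (VecP.lookup-map i (suc ∘ toℕ) x)) (FinP.toℕ<n (Vec.lookup x i))

module PointCode {d n : ℕ} (A : SubsetGrid d n) (k h : ℕ) (1≤h : 1 ≤ h) where

  -- A sum of h points has coordinates at most h · n, hence below β, so equal sums of codes force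
  -- equal sums of points.
  β : ℕ
  β = suc (h * n)

  n<β : n < β
  n<β = s≤s (≤-trans (≤-reflexive (sym (*-identityˡ n))) (*-monoˡ-≤ n 1≤h))

  pointCode : Fin (size A) → ℕ
  pointCode i = code β (coords (pt A i))

  pointCode-< : ∀ i → pointCode i < β ^ d
  pointCode-< i = code-< β (coords (pt A i)) (λ j → ≤-<-trans (coords-≤ (pt A i) j) n<β)

  elems-increasing : AllPairs (λ u v → code β (coords u) < code β (coords v)) (elems A)
  elems-increasing = AllPairsP.filter⁺ (T? ∘ A)
    (allVec-increasing β d (suc ∘ toℕ) s≤s (λ x → ≤-<-trans (FinP.toℕ<n x) n<β))

  pointCode-mono : ∀ {i j} → i Fin.< j → pointCode i < pointCode j
  pointCode-mono = lookup-mono elems-increasing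

  good⇒free : ∀ {r} (c : Coloring A r) → ¬ HasRainbow k h A c → RainbowFree k h pointCode c
  good⇒free {r} c none x sums inj = none (lose X∈ (solution , rainbow))
    where
    X : Candidate A k h
    X = Vec.tabulate (λ ℓ → Vec.tabulate (x ℓ))
    X∈ : X ∈ allCandidates A k h
    X∈ = ∈-allVec X (λ ℓ → ∈-allVec _ (λ i → ∈-allFin _))
    rowSum : Fin k → Vec ℕ d
    rowSum ℓ = vsum (tabulate (coords ∘ pt A ∘ x ℓ))
    rowSums≡ : rowSums A X ≡ tabulate rowSum
    rowSums≡ = trans (toList-map-tabulate _ (λ ℓ → Vec.tabulate (x ℓ)))
      (ListP.tabulate-cong (λ ℓ → cong vsum (toList-map-tabulate (coords ∘ pt A) (x ℓ))))
    below : ∀ ℓ → Below β (rowSum ℓ)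
    below ℓ i = s≤s (vsum-≤ h (coords ∘ pt A ∘ x ℓ) (λ j → coords-≤ (pt A (x ℓ j))) i)
    equal : ∀ ℓ ℓ′ → rowSum ℓ ≡ rowSum ℓ′
    equal ℓ ℓ′ = code-injective β _ _ (below ℓ) (below ℓ′) (trans (code-vsum β h (coords ∘ pt A ∘ x ℓ))
      (trans (sums ℓ ℓ′) (sym (code-vsum β h (coords ∘ pt A ∘ x ℓ′)))))
    solution : IsSolution A X
    solution = subst (AllPairs _≡_) (sym rowSums≡) (AllPairsP.tabulate⁺ (λ {ℓ} {ℓ′} _ → equal ℓ ℓ′))
    row : Fin k → List (Fin r)
    row ℓ = tabulate (Vec.lookup c ∘ x ℓ)
    colours≡ : colorsOf A c X ≡ concat (tabulate row)
    colours≡ = cong concat (trans (toList-map-tabulate _ (λ ℓ → Vec.tabulate (x ℓ)))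
      (ListP.tabulate-cong (λ ℓ → toList-map-tabulate (Vec.lookup c) (x ℓ))))
    rainbow : Unique (colorsOf A c X)
    rainbow = subst Unique (sym colours≡) (UniqueP.concat⁺
      (AllP.tabulate⁺ (λ ℓ → UniqueP.tabulate⁺ (λ e → proj₂ (inj e))))
      (AllPairsP.tabulate⁺ (λ {ℓ} {ℓ′} ne (p , q) → clash ne (∈-tabulate⁻ p) (∈-tabulate⁻ q))))
      where
      clash : ∀ {ℓ ℓ′} {v : Fin r} → ℓ ≢ ℓ′ → (∃ λ i → v ≡ Vec.lookup c (x ℓ i)) → (∃ λ i → v ≡ Vec.lookup c (x ℓ′ i)) → ⊥
      clash ne (i , e) (i′ , e′) = ne (proj₁ (inj (trans (sym e) e′)))

-- A solution of the equation in ℕ with distinct entries, one of them 0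

fsum-cong : ∀ h {f g : Fin h → ℕ} → (∀ i → f i ≡ g i) → fsum h f ≡ fsum h g
fsum-cong zero e = refl
fsum-cong (suc h) e = cong₂ _+_ (e zero) (fsum-cong h (e ∘ suc))

fsum-+const : ∀ h (f : Fin h → ℕ) c → fsum h (λ i → f i + c) ≡ fsum h f + h * c
fsum-+const zero f c = refl
fsum-+const (suc h) f c rewrite fsum-+const h (f ∘ suc) c = +-interchange (f zero) c (fsum h (f ∘ suc)) (h * c)

fsum-* : ∀ h c (f : Fin h → ℕ) → fsum h (λ i → c * f i) ≡ c * fsum h f
fsum-* zero c f = sym (*-zeroʳ c)
fsum-* (suc h) c f rewrite fsum-* h c (f ∘ suc) = sym (*-distribˡ-+ c (f zero) _)

fsum-affine : ∀ h (f a : Fin h → ℕ) E q c → (∀ i → f i + a i * E ≡ q + a i * c) →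
  fsum h f + fsum h a * E ≡ h * q + fsum h a * c
fsum-affine zero f a E q c eq = refl
fsum-affine (suc h) f a E q c eq = begin
  (f zero + fsum h (f ∘ suc)) + (a zero + fsum h (a ∘ suc)) * E ≡⟨ regroup (f zero) _ (a zero) _ E ⟩
  (f zero + a zero * E) + (fsum h (f ∘ suc) + fsum h (a ∘ suc) * E)
    ≡⟨ cong₂ _+_ (eq zero) (fsum-affine h (f ∘ suc) (a ∘ suc) E q c (eq ∘ suc)) ⟩
  (q + a zero * c) + (h * q + fsum h (a ∘ suc) * c) ≡⟨ sym (regroup q (h * q) (a zero) _ c) ⟩
  (q + h * q) + (a zero + fsum h (a ∘ suc)) * c ∎
  where
  open ≡-Reasoning
  regroup : ∀ x y u v E → (x + y) + (u + v) * E ≡ (x + u * E) + (y + v * E)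
  regroup = solve-∀

quotient-unique : ∀ L {a b x y} → x < L → y < L → a * L + x ≡ b * L + y → a ≡ b × x ≡ y
quotient-unique L {a} {b} {x} {y} x<L y<L e with <-cmp a b
... | tri≈ _ refl _ = refl , +-cancelˡ-≡ (a * L) _ _ e
... | tri< a<b _ _ = ⊥-elim (<-irrefl e (begin-strict
    a * L + x <⟨ +-monoʳ-< (a * L) x<L ⟩
    a * L + L ≡⟨ +-comm (a * L) L ⟩
    suc a * L ≤⟨ *-monoˡ-≤ L a<b ⟩
    b * L ≤⟨ m≤m+n _ y ⟩
    b * L + y ∎))
  where open ≤-Reasoning
... | tri> _ _ b<a = ⊥-elim (<-irrefl (sym e) (begin-strict
    b * L + y <⟨ +-monoʳ-< (b * L) y<L ⟩
    b * L + L ≡⟨ +-comm (b * L) L ⟩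
    suc b * L ≤⟨ *-monoˡ-≤ L b<a ⟩
    a * L ≤⟨ m≤m+n _ x ⟩
    a * L + x ∎))
  where open ≤-Reasoning

module Multipliers (k′ h′ : ℕ) (1≤h′ : 1 ≤ h′) where

  -- L exceeds the variation h′ · ℓ or k′ - ℓ inside a column, Λ₁ exceeds every entry of the integer
  -- solution, c₀ leaves room for Λ₁ as one more value, and Λ bounds everything after scaling by c₀
  -- ^ t with t < k · h.
  k h L Λ₁ c₀ Λ : ℕ
  k = suc k′
  h = suc h′
  L = suc (h * k′)
  Λ₁ = h * L
  c₀ = suc Λ₁
  Λ = c₀ ^ (k * h)

  -- Row ℓ has h′ · ℓ in column 0 and the variable part k′ - ℓ in each of the h′ other columns, so
  -- its sum does not depend on ℓ. The shift of column i by i · L keeps the columns apart, and the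
  -- entry at (0 , 0) is 0.
  base : Fin k → Fin h → ℕ
  base ℓ zero = h′ * toℕ ℓ
  base ℓ (suc i) = suc (toℕ i) * L + (k′ ∸ toℕ ℓ)

  base-sum : ∀ ℓ → fsum h (base ℓ) ≡ fsum h′ (λ i → suc (toℕ i) * L) + h′ * k′
  base-sum ℓ = begin
    h′ * toℕ ℓ + fsum h′ (λ i → suc (toℕ i) * L + (k′ ∸ toℕ ℓ)) ≡⟨ cong (h′ * toℕ ℓ +_) (fsum-+const h′ _ _) ⟩
    h′ * toℕ ℓ + (S + h′ * (k′ ∸ toℕ ℓ)) ≡⟨ swap (h′ * toℕ ℓ) S _ ⟩
    S + (h′ * toℕ ℓ + h′ * (k′ ∸ toℕ ℓ)) ≡⟨ cong (S +_) (sym (*-distribˡ-+ h′ (toℕ ℓ) _)) ⟩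
    S + h′ * (toℕ ℓ + (k′ ∸ toℕ ℓ)) ≡⟨ cong (λ z → S + h′ * z) (m+[n∸m]≡n (≤-pred (FinP.toℕ<n ℓ))) ⟩
    S + h′ * k′ ∎
    where
    open ≡-Reasoning
    S = fsum h′ (λ i → suc (toℕ i) * L)
    swap : ∀ a b c → a + (b + c) ≡ b + (a + c)
    swap = solve-∀

  first<L : ∀ ℓ → base ℓ zero < L
  first<L ℓ = s≤s (≤-trans (*-monoʳ-≤ h′ (≤-pred (FinP.toℕ<n ℓ))) (*-monoˡ-≤ k′ (n≤1+n h′)))

  rest<L : ∀ x → k′ ∸ x < L
  rest<L x = s≤s (≤-trans (m∸n≤m k′ x) (m≤m+n k′ _))

  base-< : ∀ ℓ i → base ℓ i < Λ₁
  base-< ℓ zero = <-≤-trans (first<L ℓ) (m≤m+n L (h′ * L))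
  base-< ℓ (suc i) = begin-strict
    suc (toℕ i) * L + (k′ ∸ toℕ ℓ) <⟨ +-monoʳ-< (suc (toℕ i) * L) (rest<L (toℕ ℓ)) ⟩
    suc (toℕ i) * L + L ≡⟨ +-comm (suc (toℕ i) * L) L ⟩
    suc (suc (toℕ i)) * L ≤⟨ *-monoˡ-≤ L (s≤s (FinP.toℕ<n i)) ⟩
    h * L ∎
    where open ≤-Reasoning

  base-injective : Injective₂ base
  base-injective {ℓ} {zero} {ℓ′} {zero} e =
    FinP.toℕ-injective (*-cancelˡ-≡ (toℕ ℓ) (toℕ ℓ′) h′ {{>-nonZero 1≤h′}} e) , refl
  base-injective {ℓ} {zero} {ℓ′} {suc i′} e = ⊥-elim (<-irrefl e (<-≤-trans (first<L ℓ)
    (≤-trans (m≤m+n L (toℕ i′ * L)) (m≤m+n _ _))))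
  base-injective {ℓ} {suc i} {ℓ′} {zero} e = ⊥-elim (<-irrefl (sym e) (<-≤-trans (first<L ℓ′)
    (≤-trans (m≤m+n L (toℕ i * L)) (m≤m+n _ _))))
  base-injective {ℓ} {suc i} {ℓ′} {suc i′} e with quotient-unique L {suc (toℕ i)} {suc (toℕ i′)} (rest<L (toℕ ℓ)) (rest<L (toℕ ℓ′)) e
  ... | e₁ , e₂ = FinP.toℕ-injective (∸-cancelˡ-≡ (≤-pred (FinP.toℕ<n ℓ)) (≤-pred (FinP.toℕ<n ℓ′)) e₂)
      , cong suc (FinP.toℕ-injective (suc-injective e₁))

  row : Fin (k * h) → Fin k
  row e = proj₁ (Fin.remQuot {k} h e)

  column : Fin (k * h) → Fin h
  column e = proj₂ (Fin.remQuot {k} h e)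

  baseAt : Fin (k * h) → ℕ
  baseAt e = base (row e) (column e)

  baseAt-combine : ∀ (ℓ : Fin k) (i : Fin h) → baseAt (Fin.combine ℓ i) ≡ base ℓ i
  baseAt-combine ℓ i = cong (λ q → base (proj₁ q) (proj₂ q)) (FinP.remQuot-combine ℓ i)

  baseAt-zero : baseAt zero ≡ 0
  baseAt-zero = trans (baseAt-combine zero zero) (*-zeroʳ h′)

  baseAt-injective : ∀ {e e′} → baseAt e ≡ baseAt e′ → e ≡ e′
  baseAt-injective {e} {e′} eq with base-injective {row e} {column e} {row e′} {column e′} eq
  ... | e₁ , e₂ = trans (sym (FinP.combine-remQuot {k} h e))
    (trans (cong₂ Fin.combine e₁ e₂) (FinP.combine-remQuot {k} h e′))

  baseAt-< : ∀ e → baseAt e < Λ₁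
  baseAt-< e = base-< (row e) (column e)

  -- The entry 0 belongs to the given point; its cluster position is filled by a spare multiplier.
  positive : Fin (k * h) → ℕ
  positive zero = Λ₁
  positive (suc e) = baseAt (suc e)

  positive-injective : ∀ {e e′} → positive e ≡ positive e′ → e ≡ e′
  positive-injective {zero} {zero} _ = refl
  positive-injective {zero} {suc e′} eq = ⊥-elim (<-irrefl (sym eq) (baseAt-< (suc e′)))
  positive-injective {suc e} {zero} eq = ⊥-elim (<-irrefl eq (baseAt-< (suc e)))
  positive-injective {suc e} {suc e′} eq = baseAt-injective eq

  1≤positive : ∀ e → 1 ≤ positive e
  1≤positive zero = s≤s z≤n
  1≤positive (suc e) with baseAt (suc e) in eq
  ... | suc _ = s≤s z≤n
  ... | zero with baseAt-injective {suc e} {zero} (trans eq (sym baseAt-zero))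
  ...   | ()

  positive-<c₀ : ∀ e → positive e < c₀
  positive-<c₀ zero = ≤-refl
  positive-<c₀ (suc e) = <-trans (baseAt-< (suc e)) (n<1+n Λ₁)

  -- As 1 ≤ `positive e` < c₀, the multipliers for t lie between c₀ ^ t and c₀ ^ (t + 1). Scaling
  -- preserves the equation, and all positions of a cluster move with different slopes.
  multiplier : Fin (k * h) → Fin (k * h) → ℕ
  multiplier t e = c₀ ^ toℕ t * positive e

  1≤multiplier : ∀ t e → 1 ≤ multiplier t e
  1≤multiplier t e = *-mono-≤ (m^n>0 c₀ (toℕ t)) (1≤positive e)

  multiplier-< : ∀ t e → multiplier t e < c₀ ^ suc (toℕ t)
  multiplier-< t e = subst (multiplier t e <_) (*-comm (c₀ ^ toℕ t) c₀)
    (*-monoʳ-< (c₀ ^ toℕ t) {{m^n≢0 c₀ (toℕ t)}} (positive-<c₀ e))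

  multiplier-≤ : ∀ t e → multiplier t e ≤ Λ
  multiplier-≤ t e = ≤-trans (<⇒≤ (multiplier-< t e)) (^-monoʳ-≤ c₀ (FinP.toℕ<n t))

  multiplier-separated : ∀ t e t′ e′ → toℕ t < toℕ t′ → multiplier t e < multiplier t′ e′
  multiplier-separated t e t′ e′ lt = begin-strict
    multiplier t e <⟨ multiplier-< t e ⟩
    c₀ ^ suc (toℕ t) ≤⟨ ^-monoʳ-≤ c₀ lt ⟩
    c₀ ^ toℕ t′ ≡⟨ sym (*-identityʳ _) ⟩
    c₀ ^ toℕ t′ * 1 ≤⟨ *-monoʳ-≤ (c₀ ^ toℕ t′) (1≤positive e′) ⟩
    multiplier t′ e′ ∎
    where open ≤-Reasoning

  multiplier-injective : Injective₂ multiplier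
  multiplier-injective {t} {e} {t′} {e′} eq with FinP.<-cmp t t′
  ... | tri< lt _ _ = ⊥-elim (<-irrefl eq (multiplier-separated t e t′ e′ lt))
  ... | tri> _ _ gt = ⊥-elim (<-irrefl (sym eq) (multiplier-separated t′ e′ t e gt))
  ... | tri≈ _ refl _ = refl , positive-injective (*-cancelˡ-≡ _ _ (c₀ ^ toℕ t) {{m^n≢0 c₀ (toℕ t)}} eq)

-- Selecting disjoint clusters

module Greedy {Q P : Set} (_≟P_ : DecidableEquality P) {T : ℕ} (j₀ : Fin T) (K : Q → Fin T → P)
  (Ok : Q → Set) (Ok? : Decidable Ok) (S : Q → Q → Set) where

  open DecMembership _≟P_ using (_∈?_)

  cluster : Q → List P
  cluster b = tabulate (K b)

  Apart : Q → Q → Set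
  Apart b b′ = ∀ j j′ → K b j ≢ K b′ j′

  record Selection (used : List P) (bs : List Q) : Set where
    field
      kept : List Q
      kept-ok : ∀ {b} → b ∈ kept → b ∈ bs × Ok b × (∀ j → K b j ∉ used)
      kept-sorted : AllPairs S kept
      kept-apart : AllPairs Apart kept
      covers : ∀ {b} → b ∈ bs → Ok b → ∃ λ j → K b j ∈ used ++ concatMap cluster kept

  skip : ∀ {used b bs} → (Ok b → ∃ λ j → K b j ∈ used) → Selection used bs → Selection used (b ∷ bs)
  skip {used} {b} {bs} hit sel = record
    { kept = kept
    ; kept-ok = λ p → there (proj₁ (kept-ok p)) , proj₂ (kept-ok p)
    ; kept-sorted = kept-sorted
    ; kept-apart = kept-apart
    ; covers = λ { (here refl) ok → proj₁ (hit ok) , ∈-++⁺ˡ (proj₂ (hit ok)) ; (there p) ok → covers p ok }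
    }
    where open Selection sel

  -- Greedy in the given order, so the kept list stays sorted. An admissible cluster is rejected
  -- only if it meets a point already used, which is what makes the selection large.
  select : ∀ used bs → AllPairs S bs → Selection used bs
  select used [] sorted = record { kept = [] ; kept-ok = λ () ; kept-sorted = [] ; kept-apart = [] ; covers = λ () }
  select used (b ∷ bs) (s ∷ sorted) with Ok? b | FinP.any? (λ j → K b j ∈? used)
  ... | no ¬ok | _ = skip (λ ok → ⊥-elim (¬ok ok)) (select used bs sorted)
  ... | yes ok | yes hit = skip (λ _ → hit) (select used bs sorted)
  ... | yes ok | no miss = record
    { kept = b ∷ kept
    ; kept-ok = λ { (here refl) → here refl , ok , (λ j p → miss (j , p))
                  ; (there p) → there (proj₁ (kept-ok p)) , proj₁ (proj₂ (kept-ok p))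
                              , λ j q → proj₂ (proj₂ (kept-ok p)) j (∈-++⁺ʳ (cluster b) q) }
    ; kept-sorted = All.tabulate (λ p → All.lookup s (proj₁ (kept-ok p))) ∷ kept-sorted
    ; kept-apart = All.tabulate (λ p j j′ e → proj₂ (proj₂ (kept-ok p)) j′ (∈-++⁺ˡ (subst (_∈ cluster b) e (∈-tabulate⁺ j))))
                   ∷ kept-apart
    ; covers = λ { (here refl) _ → j₀ , ∈-++⁺ʳ used (∈-++⁺ˡ (∈-tabulate⁺ j₀))
                 ; (there p) ok′ → proj₁ (covers p ok′) , move (proj₂ (covers p ok′)) }
    }
    where
    open Selection (select (cluster b ++ used) bs sorted)
    move : ∀ {x} → x ∈ (cluster b ++ used) ++ concatMap cluster kept → x ∈ used ++ (cluster b ++ concatMap cluster kept)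
    move p with ∈-++⁻ (cluster b ++ used) p
    ... | inj₂ q = ∈-++⁺ʳ used (∈-++⁺ʳ (cluster b) q)
    ... | inj₁ q with ∈-++⁻ (cluster b) q
    ...   | inj₁ q′ = ∈-++⁺ʳ used (∈-++⁺ˡ q′)
    ...   | inj₂ q′ = ∈-++⁺ˡ q′

  preimages-≤ : (bs : List Q) → Unique bs → (∀ j {b b′} → K b j ≡ K b′ j → b ≡ b′) → (ps : List P) →
    length (concatMap (λ j → filter (λ b → K b j ∈? ps) bs) (allFin T)) ≤ T * length ps
  preimages-≤ bs u inj ps = subst (λ z → length (concatMap hits (allFin T)) ≤ z * length ps) (length-allFin T)
    (length-concatMap-≤ hits (length ps) (allFin T) λ {j} _ → injection-length (λ b → K b j)
      (UniqueP.filter⁺ (λ b → K b j ∈? ps) u) (λ p → proj₂ (∈-filter⁻ (λ b → K b j ∈? ps) {xs = bs} p)) (λ _ _ → inj j))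
    where
    hits : Fin T → List Q
    hits j = filter (λ b → K b j ∈? ps) bs

  -- Every admissible cluster meets one of the T · |kept| covered points, and a given point is at
  -- position j of at most one cluster, since K is injective in its parameter.
  ok-count : (bs : List Q) → Unique bs → (∀ j {b b′} → K b j ≡ K b′ j → b ≡ b′) → (sel : Selection [] bs) →
    length (filter Ok? bs) ≤ T * (length (Selection.kept sel) * T)
  ok-count bs u inj sel = ≤-trans (⊆-length (UniqueP.filter⁺ Ok? u) sub)
    (≤-trans (preimages-≤ bs u inj (concatMap cluster kept)) (*-monoʳ-≤ T
      (length-concatMap-≤ cluster T kept (λ {b} _ → ≤-reflexive (ListP.length-tabulate (K b))))))
    where
    open Selection sel
    sub : filter Ok? bs ⊆ concatMap (λ j → filter (λ b → K b j ∈? concatMap cluster kept) bs) (allFin T)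
    sub {b} p with ∈-filter⁻ Ok? {xs = bs} p
    ... | b∈ , ok with covers b∈ ok
    ...   | j , q = ∈-concatMap-intro _ (∈-allFin j) (∈-filter⁺ (λ b → K b j ∈? concatMap cluster kept) b∈ q)

-- Clusters of translates

module Translates {n s Λ : ℕ} (room : 2 * (Λ * s) ≤ n) where

  -- Points are moved away from the nearer end of each coordinate axis: upwards by μ b, or downwards by μ (s − b).
  offset : Fin n → ℕ
  offset p with toℕ p + Λ * s <? n
  ... | yes _ = 0
  ... | no _ = s

  -- Both directions stay inside the grid: a coordinate too large for upward moves is at least n - Λ
  -- · s, hence at least Λ · s. The offset on the left avoids subtraction.
  move : (μ : ℕ) → μ ≤ Λ → (p : Fin n) (b : Fin s) → ∃ λ (x : Fin n) → toℕ x + μ * offset p ≡ toℕ p + μ * toℕ b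
  move μ μ≤Λ p b with toℕ p + Λ * s <? n
  ... | yes lt = Fin.fromℕ< lt′ , trans (cong₂ _+_ (FinP.toℕ-fromℕ< lt′) (*-zeroʳ μ)) (+-identityʳ _)
    where
    lt′ : toℕ p + μ * toℕ b < n
    lt′ = ≤-<-trans (+-monoʳ-≤ (toℕ p) (*-mono-≤ μ≤Λ (<⇒≤ (FinP.toℕ<n b)))) lt
  ... | no ¬lt = Fin.fromℕ< lt′ , trans (cong (_+ μ * s) (FinP.toℕ-fromℕ< lt′)) (m∸n+n≡m (≤-trans μs≤p (m≤m+n _ _)))
    where
    Λs≤p : Λ * s ≤ toℕ p
    Λs≤p = +-cancelʳ-≤ (Λ * s) (Λ * s) (toℕ p) (≤-trans
      (≤-reflexive (cong (Λ * s +_) (sym (+-identityʳ (Λ * s))))) (≤-trans room (≮⇒≥ ¬lt)))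
    μs≤p : μ * s ≤ toℕ p
    μs≤p = ≤-trans (*-monoˡ-≤ s μ≤Λ) Λs≤p
    lt′ : toℕ p + μ * toℕ b ∸ μ * s < n
    lt′ = ≤-<-trans (≤-trans (∸-monoˡ-≤ (μ * s) (+-monoʳ-≤ (toℕ p) (*-monoʳ-≤ μ (<⇒≤ (FinP.toℕ<n b)))))
      (≤-reflexive (m+n∸n≡m (toℕ p) (μ * s)))) (FinP.toℕ<n p)

  translate : (μ : ℕ) → μ ≤ Λ → ∀ {d} → Point d n → Vec (Fin s) d → Point d n
  translate μ μ≤Λ = Vec.zipWith (λ p b → proj₁ (move μ μ≤Λ p b))

  translate-code : ∀ β μ (μ≤Λ : μ ≤ Λ) {d} (P : Point d n) (b : Vec (Fin s) d) →
    code β (coords (translate μ μ≤Λ P b)) + μ * code β (Vec.map offset P) ≡ code β (coords P) + μ * code β (Vec.map toℕ b)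
  translate-code β μ μ≤Λ P b = code-affine β μ (coords (translate μ μ≤Λ P b)) (Vec.map offset P) (coords P) (Vec.map toℕ b) λ i → begin
    Vec.lookup (coords (translate μ μ≤Λ P b)) i + μ * Vec.lookup (Vec.map offset P) i
      ≡⟨ cong₂ (λ x y → x + μ * y) (trans (VecP.lookup-map i _ (translate μ μ≤Λ P b)) (cong (suc ∘ toℕ)
          (VecP.lookup-zipWith _ i P b))) (VecP.lookup-map i offset P) ⟩
    suc (toℕ (proj₁ (move μ μ≤Λ (Vec.lookup P i) (Vec.lookup b i))) + μ * offset (Vec.lookup P i))
      ≡⟨ cong suc (proj₂ (move μ μ≤Λ (Vec.lookup P i) (Vec.lookup b i))) ⟩
    suc (toℕ (Vec.lookup P i) + μ * toℕ (Vec.lookup b i))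
      ≡⟨ sym (cong₂ (λ x y → x + μ * y) (VecP.lookup-map i _ P) (VecP.lookup-map i toℕ b)) ⟩
    Vec.lookup (coords P) i + μ * Vec.lookup (Vec.map toℕ b) i ∎
    where open ≡-Reasoning

  cross : ∀ {μ p e x y b c} → x + μ * e ≡ p + μ * b → y + μ * e ≡ p + μ * c → x + μ * c ≡ y + μ * b
  cross {μ} {p} {e} {x} {y} {b} {c} e₁ e₂ = +-cancelʳ-≡ (μ * e) _ _ (begin
    (x + μ * c) + μ * e ≡⟨ swap x (μ * c) (μ * e) ⟩
    (x + μ * e) + μ * c ≡⟨ cong (_+ μ * c) e₁ ⟩
    (p + μ * b) + μ * c ≡⟨ swap p (μ * b) (μ * c) ⟩
    (p + μ * c) + μ * b ≡⟨ cong (_+ μ * b) (sym e₂) ⟩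
    (y + μ * e) + μ * b ≡⟨ swap y (μ * e) (μ * b) ⟩
    (y + μ * b) + μ * e ∎)
    where
    open ≡-Reasoning
    swap : ∀ a b c → (a + b) + c ≡ (a + c) + b
    swap = solve-∀

  -- Both equations express the same difference y - x as a slope times c - b.
  slopes : ∀ {μ μ′ x y b c} → b < c → x + μ * c ≡ y + μ * b → x + μ′ * c ≡ y + μ′ * b → μ ≡ μ′
  slopes {μ} {μ′} {x} {y} {b} {c} b<c e₁ e₂ =
    *-cancelʳ-≡ μ μ′ (c ∸ b) {{>-nonZero (m<n⇒0<n∸m b<c)}} (+-cancelˡ-≡ x _ _ (trans (slope μ e₁) (sym (slope μ′ e₂))))
    where
    slope : ∀ μ → x + μ * c ≡ y + μ * b → x + μ * (c ∸ b) ≡ y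
    slope μ e = +-cancelʳ-≡ (μ * b) _ _ (trans (+-assoc x _ _) (trans (cong (x +_) (trans (sym (*-distribˡ-+ μ (c ∸ b) b))
      (cong (μ *_) (m∸n+n≡m (<⇒≤ b<c))))) e))

  move-separated : ∀ {μ μ′} (μ≤Λ : μ ≤ Λ) (μ′≤Λ : μ′ ≤ Λ) {p p′ : Fin n} {b c : Fin s} → μ ≢ μ′ →
    proj₁ (move μ μ≤Λ p b) ≡ proj₁ (move μ′ μ′≤Λ p′ b) →
    proj₁ (move μ μ≤Λ p c) ≡ proj₁ (move μ′ μ′≤Λ p′ c) → b ≡ c
  move-separated {μ} {μ′} le le′ {p} {p′} {b} {c} ne eb ec with FinP.<-cmp b c
  ... | tri≈ _ e _ = e
  ... | tri< lt _ _ = ⊥-elim (ne (slopes lt (cross {μ} {toℕ p} {offset p} (proj₂ (move μ le p b)) (proj₂ (move μ le p c)))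
      (cross {μ′} {toℕ p′} {offset p′} (subst (λ z → toℕ z + μ′ * offset p′ ≡ toℕ p′ + μ′ * toℕ b) (sym eb) (proj₂ (move μ′ le′ p′ b)))
        (subst (λ z → toℕ z + μ′ * offset p′ ≡ toℕ p′ + μ′ * toℕ c) (sym ec) (proj₂ (move μ′ le′ p′ c))))))
  ... | tri> _ _ gt = ⊥-elim (ne (slopes gt (cross {μ} {toℕ p} {offset p} (proj₂ (move μ le p c)) (proj₂ (move μ le p b)))
      (cross {μ′} {toℕ p′} {offset p′} (subst (λ z → toℕ z + μ′ * offset p′ ≡ toℕ p′ + μ′ * toℕ c) (sym ec) (proj₂ (move μ′ le′ p′ c)))
        (subst (λ z → toℕ z + μ′ * offset p′ ≡ toℕ p′ + μ′ * toℕ b) (sym eb) (proj₂ (move μ′ le′ p′ b))))))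

  -- In the first coordinate, affine functions with different slopes agree for at most one
  -- parameter. The tail of a parameter thus determines it among the collisions of two positions,
  -- which bounds their number by s ^ (d - 1).
  translate-separated : ∀ {μ μ′} (μ≤Λ : μ ≤ Λ) (μ′≤Λ : μ′ ≤ Λ) {d} {P P′ : Point (suc d) n} {b c : Vec (Fin s) (suc d)} → μ ≢ μ′ →
    translate μ μ≤Λ P b ≡ translate μ′ μ′≤Λ P′ b → translate μ μ≤Λ P c ≡ translate μ′ μ′≤Λ P′ c →
    Vec.tail b ≡ Vec.tail c → b ≡ c
  translate-separated le le′ {P = x ∷ P} {x′ ∷ P′} {b ∷ bs} {c ∷ cs} ne eb ec refl = cong (_∷ bs)
    (move-separated le le′ {x} {x′} ne (VecP.∷-injectiveˡ eb) (VecP.∷-injectiveˡ ec))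

-- Clusters of gadgets through prescribed points

length-grid : ∀ d n → length (grid d n) ≡ n ^ d
length-grid d n = trans (length-allVec (allFin n) d) (cong (_^ d) (length-allFin n))

grid-unique : ∀ d n → Unique (grid d n)
grid-unique d n = allVec-unique (UniqueP.allFin⁺ n)

∈-grid : ∀ {d n} (x : Point d n) → x ∈ grid d n
∈-grid x = ∈-allVec x (λ _ → ∈-allFin _)

module ClusterSystem
  (k′ h′ : ℕ) (1≤h′ : 1 ≤ h′) {d′ n s : ℕ} (room : 2 * (Multipliers.Λ k′ h′ 1≤h′ * s) ≤ n)
  (A : SubsetGrid (suc d′) n) {T′ : ℕ}
  (pos : Fin (suc k′ * suc h′) → Fin (suc k′ * suc h′) → Fin T′)
  (unpos : Fin T′ → Fin (suc k′ * suc h′) × Fin (suc k′ * suc h′))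
  (unpos-pos : ∀ t e → unpos (pos t e) ≡ (t , e)) (pos-unpos : ∀ j → pos (proj₁ (unpos j)) (proj₂ (unpos j)) ≡ j)
  (p : Fin (suc k′ * suc h′) → Fin (size A))
  where

  open Multipliers k′ h′ 1≤h′
  open Translates {n} {s} {Λ} room
  open PointCode A k h (s≤s z≤n)

  d : ℕ
  d = suc d′

  μ : Fin T′ → ℕ
  μ j = multiplier (proj₁ (unpos j)) (proj₂ (unpos j))

  μ≤Λ : ∀ j → μ j ≤ Λ
  μ≤Λ j = multiplier-≤ (proj₁ (unpos j)) (proj₂ (unpos j))

  μ-injective : ∀ {j j′} → μ j ≡ μ j′ → j ≡ j′
  μ-injective {j} {j′} e with multiplier-injective {proj₁ (unpos j)} {proj₂ (unpos j)} {proj₁ (unpos j′)} {proj₂ (unpos j′)} e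
  ... | e₁ , e₂ = trans (sym (pos-unpos j)) (trans (cong₂ pos e₁ e₂) (pos-unpos j′))

  centre : Fin T′ → Point d n
  centre j = pt A (p (proj₁ (unpos j)))

  K : Vec (Fin s) d → Fin T′ → Point d n
  K b j = translate (μ j) (μ≤Λ j) (centre j) b

  stepCode : Vec (Fin s) d → ℕ
  stepCode b = code β (Vec.map toℕ b)

  s≤n : s ≤ n
  s≤n = ≤-trans (≤-trans (≤-trans (≤-reflexive (sym (*-identityˡ s))) (*-monoˡ-≤ s (m^n>0 c₀ (k * h)))) (m≤m+n (Λ * s) _)) room

  K-code : ∀ b j → code β (coords (K b j)) + μ j * code β (Vec.map offset (centre j)) ≡ code β (coords (centre j)) + μ j * stepCode b
  K-code b j = translate-code β (μ j) (μ≤Λ j) (centre j) b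

  1≤μ : ∀ j → 1 ≤ μ j
  1≤μ j = 1≤multiplier (proj₁ (unpos j)) (proj₂ (unpos j))

  K-increasing : ∀ j {b b′} → stepCode b < stepCode b′ → code β (coords (K b j)) < code β (coords (K b′ j))
  K-increasing j {b} {b′} lt = +-cancelʳ-< _ _ _ (subst₂ _<_ (sym (K-code b j)) (sym (K-code b′ j))
    (+-monoʳ-< _ (*-monoʳ-< (μ j) {{>-nonZero (1≤μ j)}} lt)))

  map-toℕ-injective : ∀ {d} {u v : Vec (Fin s) d} → Vec.map toℕ u ≡ Vec.map toℕ v → u ≡ v
  map-toℕ-injective {u = []} {[]} e = refl
  map-toℕ-injective {u = x ∷ u} {y ∷ v} e = cong₂ _∷_ (FinP.toℕ-injective (VecP.∷-injectiveˡ e)) (map-toℕ-injective (VecP.∷-injectiveʳ e))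

  K-injective : ∀ j {b b′} → K b j ≡ K b′ j → b ≡ b′
  K-injective j {b} {b′} e = map-toℕ-injective (code-injective β (Vec.map toℕ b) (Vec.map toℕ b′) (below b) (below b′)
    (*-cancelˡ-≡ (stepCode b) (stepCode b′) (μ j) {{>-nonZero (1≤μ j)}} (+-cancelˡ-≡ _ _ _
      (trans (sym (K-code b j)) (trans (cong (λ x → code β (coords x) + μ j * code β (Vec.map offset (centre j))) e) (K-code b′ j))))))
    where
    below : ∀ b → Below β (Vec.map toℕ b)
    below b i = subst (_< β) (sym (VecP.lookup-map i toℕ b)) (<-trans (<-≤-trans (FinP.toℕ<n (Vec.lookup b i)) s≤n) n<β)

  Ok : Vec (Fin s) d → Set
  Ok b = (∀ j → T (A (K b j))) × (∀ j j′ → K b j ≡ K b j′ → j ≡ j′)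

  _≟P_ : DecidableEquality (Point d n)
  _≟P_ = VecP.≡-dec FinP._≟_

  Ok? : Decidable Ok
  Ok? b = FinP.all? (λ j → T? (A (K b j))) ×-dec
    FinP.all? (λ j → FinP.all? (λ j′ → (K b j ≟P K b j′) →-dec (j FinP.≟ j′)))

  open Greedy _≟P_ (pos zero zero) K Ok Ok? (λ b b′ → stepCode b < stepCode b′)

  steps : List (Vec (Fin s) d)
  steps = grid d s

  selection : Selection [] steps
  selection = select [] steps (allVec-increasing β d toℕ id (λ x → <-trans (<-≤-trans (FinP.toℕ<n x) s≤n) n<β))

  open Selection selection

  missing : List (Point d n)
  missing = filter (¬? ∘ (λ x → T? (A x))) (grid d n)

  length-missing : length missing ≡ n ^ d ∸ size A
  length-missing = trans (sym (m+n∸m≡n (size A) (length missing)))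
    (cong (_∸ size A) (trans (length-filter-partition (λ x → T? (A x)) (grid d n)) (length-grid d n)))

  open DecMembership _≟P_ using (_∈?_)

  collisions : Fin T′ × Fin T′ → List (Vec (Fin s) d)
  collisions (j , j′) with j FinP.≟ j′
  ... | yes _ = []
  ... | no _ = filter (λ b → K b j ≟P K b j′) steps

  collisions-≤ : ∀ jj′ → length (collisions jj′) ≤ s ^ d′
  collisions-≤ (j , j′) with j FinP.≟ j′
  ... | yes _ = z≤n
  ... | no ne = subst (length (filter (λ b → K b j ≟P K b j′) steps) ≤_) (length-grid d′ s) (injection-length Vec.tail
    (UniqueP.filter⁺ (λ b → K b j ≟P K b j′) (grid-unique d s)) (λ _ → ∈-grid _)
    λ {b} {c} b∈ c∈ → translate-separated (μ≤Λ j) (μ≤Λ j′) {P = centre j} {centre j′} (λ e → ne (μ-injective e))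
      (proj₂ (∈-filter⁻ (λ b → K b j ≟P K b j′) {xs = steps} b∈)) (proj₂ (∈-filter⁻ (λ b → K b j ≟P K b j′) {xs = steps} c∈)))

  ∈-collisions : ∀ {b j j′} → j ≢ j′ → K b j ≡ K b j′ → b ∈ collisions (j , j′)
  ∈-collisions {b} {j} {j′} ne e with j FinP.≟ j′
  ... | yes e′ = ⊥-elim (ne e′)
  ... | no _ = ∈-filter⁺ (λ b → K b j ≟P K b j′) (∈-grid b) e

  B : ℕ
  B = length kept

  -- A parameter fails if some position leaves A, at most T′ times for each missing point, or if two
  -- positions collide, at most s ^ d′ times for each pair. The others are admissible and fall under
  -- `ok-count`.
  steps-count : s ^ d ≤ T′ * (B * T′) + (T′ * (n ^ d ∸ size A) + (T′ * T′) * s ^ d′)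
  steps-count = begin
    s ^ d ≡⟨ sym (length-grid d s) ⟩
    length steps ≤⟨ ⊆-length (grid-unique d s) sub ⟩
    length (oks ++ (lost ++ clashing)) ≡⟨ trans (ListP.length-++ oks) (cong (length oks +_) (ListP.length-++ lost)) ⟩
    length oks + (length lost + length clashing) ≤⟨ +-mono-≤ (ok-count steps (grid-unique d s) K-injective selection)
      (+-mono-≤ (subst (λ z → length lost ≤ T′ * z) length-missing (preimages-≤ steps (grid-unique d s) K-injective missing))
        (≤-trans (length-concatMap-≤ collisions (s ^ d′) pairs (λ {jj′} _ → collisions-≤ jj′))
          (≤-reflexive (cong (_* s ^ d′) (trans (length-cartesianProduct (allFin T′) (allFin T′)) (cong₂ _*_ (length-allFin T′) (length-allFin T′))))))) ⟩
    T′ * (B * T′) + (T′ * (n ^ d ∸ size A) + (T′ * T′) * s ^ d′) ∎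
    where
    open ≤-Reasoning
    oks = filter Ok? steps
    lost = concatMap (λ j → filter (λ b → K b j ∈? missing) steps) (allFin T′)
    pairs = cartesianProduct (allFin T′) (allFin T′)
    clashing = concatMap collisions pairs
    sub : steps ⊆ oks ++ (lost ++ clashing)
    sub {b} b∈ with FinP.any? (λ j → ¬? (T? (A (K b j))))
    ... | yes (j , ¬t) = ∈-++⁺ʳ oks (∈-++⁺ˡ (∈-concatMap-intro _ (∈-allFin j) (∈-filter⁺ (λ b → K b j ∈? missing) b∈
            (∈-filter⁺ (¬? ∘ (λ x → T? (A x))) (∈-grid (K b j)) ¬t))))
    ... | no all-in with FinP.any? (λ j → FinP.any? (λ j′ → (K b j ≟P K b j′) ×-dec ¬? (j FinP.≟ j′)))
    ...   | yes (j , j′ , e , ne) = ∈-++⁺ʳ oks (∈-++⁺ʳ lost (∈-concatMap-intro collisions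
              (∈-cartesianProduct⁺ (∈-allFin j) (∈-allFin j′)) (∈-collisions ne e)))
    ...   | no distinct = ∈-++⁺ˡ (∈-filter⁺ Ok? b∈ (in-A , apart))
      where
      in-A : ∀ j → T (A (K b j))
      in-A j with T? (A (K b j))
      ... | yes t = t
      ... | no ¬t = ⊥-elim (all-in (j , ¬t))
      apart : ∀ j j′ → K b j ≡ K b j′ → j ≡ j′
      apart j j′ e with j FinP.≟ j′
      ... | yes q = q
      ... | no ne = ⊥-elim (distinct (j , j′ , e , ne))

  step : Fin B → Vec (Fin s) d
  step = lookup kept

  step-ok : ∀ b → Ok (step b)
  step-ok b = proj₁ (proj₂ (kept-ok (∈-lookup b)))

  K∈ : ∀ b j → K (step b) j ∈ elems A
  K∈ b j = ∈-filter⁺ (T? ∘ A) (∈-grid _) (proj₁ (step-ok b) j)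

  clusterPoint : Fin B → Fin T′ → Fin (size A)
  clusterPoint b j = Any.index (K∈ b j)

  pt-clusterPoint : ∀ b j → pt A (clusterPoint b j) ≡ K (step b) j
  pt-clusterPoint b j = sym (lookup-index (K∈ b j))

  clusterPoint-mono : ∀ {b b′} j → b Fin.< b′ → pointCode (clusterPoint b j) < pointCode (clusterPoint b′ j)
  clusterPoint-mono {b} {b′} j lt = subst₂ (λ x y → code β (coords x) < code β (coords y))
    (sym (pt-clusterPoint b j)) (sym (pt-clusterPoint b′ j)) (K-increasing j (lookup-mono kept-sorted lt))

  clusterPoint-injective : Injective₂ clusterPoint
  clusterPoint-injective {b} {j} {b′} {j′} e = go (FinP.<-cmp b b′)
    where
    same : K (step b) j ≡ K (step b′) j′
    same = trans (sym (pt-clusterPoint b j)) (trans (cong (pt A) e) (pt-clusterPoint b′ j′))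
    go : _ → b ≡ b′ × j ≡ j′
    go (tri< lt _ _) = ⊥-elim (lookup-mono kept-apart lt j j′ same)
    go (tri> _ _ gt) = ⊥-elim (lookup-mono kept-apart gt j′ j (sym same))
    go (tri≈ _ refl _) = refl , proj₂ (step-ok b) j j′ same

  gadgetAt : Fin B → Fin (k * h) → Fin (k * h) → Fin (size A)
  gadgetAt b t zero = p t
  gadgetAt b t (suc e) = clusterPoint b (pos t (suc e))

  -- The factor is c₀ ^ t times `baseAt e` rather than `multiplier t e`: it vanishes at e = zero, so
  -- the formula also covers `p t`.
  gadget-code : ∀ b t e → let E = code β (Vec.map offset (pt A (p t))) in
    pointCode (gadgetAt b t e) + (c₀ ^ toℕ t * baseAt e) * E ≡ pointCode (p t) + (c₀ ^ toℕ t * baseAt e) * stepCode (step b)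
  gadget-code b t zero rewrite baseAt-zero | *-zeroʳ (c₀ ^ toℕ t) = refl
  gadget-code b t (suc e) = trans (cong (λ x → code β (coords x) + multiplier t (suc e) * E) (pt-clusterPoint b (pos t (suc e)))) main
    where
    E = code β (Vec.map offset (pt A (p t)))
    main : code β (coords (K (step b) (pos t (suc e)))) + multiplier t (suc e) * E ≡ pointCode (p t) + multiplier t (suc e) * stepCode (step b)
    main = subst (λ te → code β (coords (K (step b) (pos t (suc e)))) + multiplier (proj₁ te) (proj₂ te) * code β (Vec.map offset (pt A (p (proj₁ te))))
      ≡ pointCode (p (proj₁ te)) + multiplier (proj₁ te) (proj₂ te) * stepCode (step b)) (unpos-pos t (suc e)) (K-code (step b) (pos t (suc e)))

  -- Summed over a row, the factors give c₀ ^ t times a row sum of `base`, the same for every row;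
  -- the offset terms then cancel.
  gadget-solution : ∀ b t (ℓ ℓ′ : Fin k) → fsum h (λ i → pointCode (gadgetAt b t (Fin.combine ℓ i)))
                                         ≡ fsum h (λ i → pointCode (gadgetAt b t (Fin.combine ℓ′ i)))
  gadget-solution b t ℓ ℓ′ = +-cancelʳ-≡ (Σμ * E) _ _ (trans (row-sum ℓ) (sym (row-sum ℓ′)))
    where
    E = code β (Vec.map offset (pt A (p t)))
    Σμ = c₀ ^ toℕ t * (fsum h′ (λ i → suc (toℕ i) * L) + h′ * k′)
    row-sum : ∀ ℓ → fsum h (λ i → pointCode (gadgetAt b t (Fin.combine ℓ i))) + Σμ * E
                  ≡ h * pointCode (p t) + Σμ * stepCode (step b)
    row-sum ℓ = subst (λ z → fsum h (λ i → pointCode (gadgetAt b t (Fin.combine ℓ i))) + z * E ≡ h * pointCode (p t) + z * stepCode (step b))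
      (trans (fsum-* h (c₀ ^ toℕ t) (λ i → baseAt (Fin.combine ℓ i))) (cong (c₀ ^ toℕ t *_)
        (trans (fsum-cong h (baseAt-combine ℓ)) (base-sum ℓ))))
      (fsum-affine h _ (λ i → c₀ ^ toℕ t * baseAt (Fin.combine ℓ i)) E (pointCode (p t)) (stepCode (step b))
        (λ i → gadget-code b t (Fin.combine ℓ i)))

-- Exponential estimates

^-distribʳ-* : ∀ a b n → (a * b) ^ n ≡ a ^ n * b ^ n
^-distribʳ-* a b zero = refl
^-distribʳ-* a b (suc n) rewrite ^-distribʳ-* a b n = regroup a b (a ^ n) (b ^ n)
  where
  regroup : ∀ a b x y → a * b * (x * y) ≡ a * x * (b * y)
  regroup = solve-∀

n≤2^n : ∀ n → n ≤ 2 ^ n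
n≤2^n zero = z≤n
n≤2^n (suc n) = ≤-trans (+-mono-≤ (m^n>0 2 n) (n≤2^n n)) (≤-reflexive (cong (2 ^ n +_) (sym (+-identityʳ (2 ^ n)))))

n^u≤2^nu : ∀ a u → a ^ u ≤ 2 ^ (a * u)
n^u≤2^nu a u = ≤-trans (^-monoˡ-≤ u (n≤2^n a)) (≤-reflexive (^-*-assoc 2 a u))

bernoulli : ∀ y n → y ^ suc n + suc n * y ^ n ≤ suc y ^ suc n
bernoulli y zero = ≤-reflexive (trans (cong₂ _+_ (*-identityʳ y) refl) (trans (+-comm y 1) (sym (*-identityʳ (suc y)))))
bernoulli y (suc n) = begin
  y * (y * a) + suc (suc n) * (y * a) ≤⟨ m≤m+n _ (suc n * a) ⟩
  y * (y * a) + suc (suc n) * (y * a) + suc n * a ≡⟨ regroup y a n ⟩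
  suc y * (y * a + suc n * a) ≤⟨ *-monoʳ-≤ (suc y) (bernoulli y n) ⟩
  suc y * (suc y ^ suc n) ∎
  where
  open ≤-Reasoning
  a = y ^ n
  regroup : ∀ y a n → y * (y * a) + (2 + n) * (y * a) + (1 + n) * a ≡ (1 + y) * (y * a + (1 + n) * a)
  regroup = solve-∀

double-power : ∀ y → 2 * y ^ suc y ≤ suc y ^ suc y
double-power y = ≤-trans (≤-trans (≤-reflexive (cong (y ^ suc y +_) (+-identityʳ _)))
  (+-monoʳ-≤ (y ^ suc y) (*-monoˡ-≤ (y ^ y) (n≤1+n y)))) (bernoulli y y)

^-division : ∀ (f : ℕ) B y → f ^ B ≡ (f ^ suc y) ^ (B / suc y) * f ^ (B % suc y)
^-division f B y = begin
  f ^ B ≡⟨ cong (f ^_) (trans (m≡m%n+[m/n]*n B (suc y)) (+-comm (B % suc y) _)) ⟩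
  f ^ ((B / suc y) * suc y + B % suc y) ≡⟨ ^-distribˡ-+-* f ((B / suc y) * suc y) _ ⟩
  f ^ ((B / suc y) * suc y) * f ^ (B % suc y) ≡⟨ cong (λ z → f ^ z * f ^ (B % suc y)) (*-comm (B / suc y) (suc y)) ⟩
  f ^ (suc y * (B / suc y)) * f ^ (B % suc y) ≡⟨ cong (_* f ^ (B % suc y)) (sym (^-*-assoc f (suc y) (B / suc y))) ⟩
  (f ^ suc y) ^ (B / suc y) * f ^ (B % suc y) ∎
  where open ≡-Reasoning

-- The base y + 1 gains a factor 2 over y in each group of y + 1 exponents. This is the exponential
-- saving, both for colorings with many colors and for those that miss a color of their palette.
power-gap : ∀ y B → 2 ^ (B / suc y) * y ^ B ≤ suc y ^ B
power-gap y B = begin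
  2 ^ q * y ^ B ≡⟨ cong (2 ^ q *_) (^-division y B y) ⟩
  2 ^ q * ((y ^ suc y) ^ q * y ^ ρ) ≡⟨ sym (*-assoc (2 ^ q) _ _) ⟩
  2 ^ q * (y ^ suc y) ^ q * y ^ ρ ≡⟨ cong (_* y ^ ρ) (sym (^-distribʳ-* 2 (y ^ suc y) q)) ⟩
  (2 * y ^ suc y) ^ q * y ^ ρ ≤⟨ *-mono-≤ (^-monoˡ-≤ q (double-power y)) (^-monoˡ-≤ ρ (n≤1+n y)) ⟩
  (suc y ^ suc y) ^ q * suc y ^ ρ ≡⟨ sym (^-division (suc y) B y) ⟩
  suc y ^ B ∎
  where
  open ≤-Reasoning
  q = B / suc y
  ρ = B % suc y

suc-power-≤ : ∀ y z → suc y ^ suc z ≤ y ^ suc z + suc z * suc y ^ z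
suc-power-≤ y zero = ≤-reflexive (trans (cong suc (*-identityʳ y)) (trans (+-comm 1 y) (cong (_+ 1) (sym (*-identityʳ y)))))
suc-power-≤ y (suc z) = begin
  a + y * a ≤⟨ +-monoʳ-≤ a (*-monoʳ-≤ y (suc-power-≤ y z)) ⟩
  a + y * (y ^ suc z + suc z * b) ≡⟨ regroup a y (y ^ suc z) z b ⟩
  y * y ^ suc z + (a + suc z * (y * b)) ≤⟨ +-monoʳ-≤ (y * y ^ suc z) (+-monoʳ-≤ a (*-monoʳ-≤ (suc z) (m≤n+m (y * b) b))) ⟩
  y * y ^ suc z + (a + suc z * a) ∎
  where
  open ≤-Reasoning
  b = suc y ^ z
  a = suc y ^ suc z
  regroup : ∀ a y c z b → a + y * (c + (1 + z) * b) ≡ y * c + (a + (1 + z) * (y * b))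
  regroup = solve-∀

-- By `suc-power-≤` the increase from y ^ z is at most z · (y + 1) ^ (z - 1), which is at most half
-- of (y + 1) ^ z.
half-power : ∀ y z → 2 * z ≤ suc y → suc y ^ z ≤ 2 * y ^ z
half-power y zero _ = s≤s z≤n
half-power y (suc z) le = +-cancelʳ-≤ a a (2 * y ^ suc z) (begin
  a + a ≡⟨ cong (a +_) (sym (+-identityʳ a)) ⟩
  2 * a ≤⟨ *-monoʳ-≤ 2 (suc-power-≤ y z) ⟩
  2 * (y ^ suc z + suc z * b) ≡⟨ regroup (y ^ suc z) z b ⟩
  2 * y ^ suc z + 2 * suc z * b ≤⟨ +-monoʳ-≤ (2 * y ^ suc z) (*-monoˡ-≤ b le) ⟩
  2 * y ^ suc z + a ∎)
  where
  open ≤-Reasoning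
  b = suc y ^ z
  a = suc y ^ suc z
  regroup : ∀ c z b → 2 * (c + (1 + z) * b) ≡ 2 * c + 2 * (1 + z) * b
  regroup = solve-∀

power-growth : ∀ y z n → 2 * suc z ≤ suc y → suc y ^ n ≤ 2 ^ suc (n / suc z) * y ^ n
power-growth y z n le = begin
  suc y ^ n ≡⟨ ^-division (suc y) n z ⟩
  (suc y ^ suc z) ^ q * suc y ^ ρ ≤⟨ *-mono-≤ (^-monoˡ-≤ q (half-power y (suc z) le))
      (half-power y ρ (≤-trans (*-monoʳ-≤ 2 (<⇒≤ (m%n<n n (suc z)))) le)) ⟩
  (2 * y ^ suc z) ^ q * (2 * y ^ ρ) ≡⟨ cong (_* (2 * y ^ ρ)) (^-distribʳ-* 2 (y ^ suc z) q) ⟩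
  (2 ^ q * (y ^ suc z) ^ q) * (2 * y ^ ρ) ≡⟨ regroup (2 ^ q) _ _ ⟩
  2 * 2 ^ q * ((y ^ suc z) ^ q * y ^ ρ) ≡⟨ cong (2 * 2 ^ q *_) (sym (^-division y n z)) ⟩
  2 * 2 ^ q * y ^ n ∎
  where
  open ≤-Reasoning
  q = n / suc z
  ρ = n % suc z
  regroup : ∀ a b c → (a * b) * (2 * c) ≡ 2 * a * (b * c)
  regroup = solve-∀

m<[1+m/n]*n : ∀ m n → m < suc (m / suc n) * suc n
m<[1+m/n]*n m n = subst (_< suc (m / suc n) * suc n) (sym (m≡m%n+[m/n]*n m (suc n))) (+-monoˡ-< _ (m%n<n m (suc n)))

*≤⇒≤/ : ∀ q x n → q * suc x ≤ n → q ≤ n / suc x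
*≤⇒≤/ q x n le = subst (_≤ n / suc x) (m*n/n≡m q (suc x)) (/-monoˡ-≤ (suc x) le)

/*≤ : ∀ n x → n / suc x * suc x ≤ n
/*≤ n x = m/n*n≤m n (suc x)

Eventually : (ℕ → Set) → Set
Eventually P = ∃ λ n₀ → ∀ n → n₀ ≤ n → P n

eventually-and : ∀ {P Q : ℕ → Set} → Eventually P → Eventually Q → Eventually (λ n → P n × Q n)
eventually-and (a , f) (b , g) = a + b , λ n le → f n (m+n≤o⇒m≤o a le) , g n (m+n≤o⇒n≤o a le)

eventually-≤ : ∀ c → Eventually (c ≤_)
eventually-≤ c = c , λ _ le → le

-- The pigeonhole behind `equal-sums` needs w² above c · n, while the shattering weight 2 ^ (Ω · w)
-- must stay below 2 ^ (n / (Z + 1)). A linear w = n / Q with a large constant Q does both.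
eventually-square : ∀ Z Ω c → Eventually (λ n → ∃ λ w → 1 ≤ w × Ω * w ≤ n / suc Z × c * n < w * w)
eventually-square Z Ω c = Q * Q * (2 * suc c) , λ n le →
  let
    w = n / Q
    Q2c≤w : Q * (2 * suc c) ≤ w
    Q2c≤w = *≤⇒≤/ (Q * (2 * suc c)) (Ω + Z * suc Ω) n (≤-trans (≤-reflexive (regroup Q (2 * suc c))) le)
    1≤w : 1 ≤ w
    1≤w = ≤-trans (s≤s z≤n) Q2c≤w
  in w , 1≤w , *≤⇒≤/ (Ω * w) Z n (≤-trans (≤-trans (≤-reflexive (regroup₂ Ω w Z)) (*-monoʳ-≤ w (*-monoʳ-≤ (suc Z) (n≤1+n Ω)))) (/*≤ n (Ω + Z * suc Ω)))
   , (begin-strict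
    c * n ≤⟨ *-monoˡ-≤ n (n≤1+n c) ⟩
    suc c * n <⟨ *-monoʳ-< (suc c) (m<[1+m/n]*n n (Ω + Z * suc Ω)) ⟩
    suc c * (suc w * Q) ≤⟨ *-monoʳ-≤ (suc c) (*-monoˡ-≤ Q (+-monoˡ-≤ w 1≤w)) ⟩
    suc c * ((w + w) * Q) ≡⟨ regroup₃ (suc c) w Q ⟩
    Q * (2 * suc c) * w ≤⟨ *-monoˡ-≤ w Q2c≤w ⟩
    w * w ∎)
  where
  open ≤-Reasoning
  Q = suc Z * suc Ω
  regroup : ∀ Q x → Q * x * Q ≡ Q * Q * x
  regroup = solve-∀
  regroup₂ : ∀ Ω w Z → Ω * w * (1 + Z) ≡ w * ((1 + Z) * Ω)
  regroup₂ = solve-∀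
  regroup₃ : ∀ c w Q → c * ((w + w) * Q) ≡ Q * (2 * c) * w
  regroup₃ = solve-∀

-- With s = n / Q one has n ≤ Q · 2 ^ s, so the polynomial is at most e · Q ^ c · 2 ^ (s · c); the
-- constant is absorbed by one further factor 2 ^ s.
poly≤exp : ∀ Z c e → Eventually (λ n → e * n ^ c ≤ 2 ^ (n / suc Z))
poly≤exp Z c e = Q * Λ , λ n le →
  let
    s = n / Q
    Λ≤s : Λ ≤ s
    Λ≤s = *≤⇒≤/ Λ (c + Z * suc c) n (≤-trans (≤-reflexive (*-comm Λ Q)) le)
    n≤ : n ≤ Q * 2 ^ s
    n≤ = ≤-trans (<⇒≤ (m<[1+m/n]*n n (c + Z * suc c))) (≤-trans (≤-reflexive (*-comm (suc s) Q)) (*-monoʳ-≤ Q (1+n≤2^n s)))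
  in begin
    e * n ^ c ≤⟨ *-monoʳ-≤ e (^-monoˡ-≤ c n≤) ⟩
    e * (Q * 2 ^ s) ^ c ≡⟨ cong (e *_) (^-distribʳ-* Q (2 ^ s) c) ⟩
    e * (Q ^ c * (2 ^ s) ^ c) ≡⟨ sym (*-assoc e _ _) ⟩
    Λ * (2 ^ s) ^ c ≤⟨ *-monoˡ-≤ ((2 ^ s) ^ c) (≤-trans Λ≤s (n≤2^n s)) ⟩
    (2 ^ s) ^ suc c ≡⟨ ^-*-assoc 2 s (suc c) ⟩
    2 ^ (s * suc c) ≤⟨ ^-monoʳ-≤ 2 (*≤⇒≤/ (s * suc c) Z n (≤-trans (≤-reflexive (regroup s (suc c) (suc Z))) (/*≤ n (c + Z * suc c)))) ⟩
    2 ^ (n / suc Z) ∎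
  where
  open ≤-Reasoning
  Q = suc Z * suc c
  Λ = e * Q ^ c
  1+n≤2^n : ∀ n → suc n ≤ 2 ^ n
  1+n≤2^n zero = ≤-refl
  1+n≤2^n (suc n) = ≤-trans (+-mono-≤ (m^n>0 2 n) (1+n≤2^n n)) (≤-reflexive (cong (2 ^ n +_) (sym (+-identityʳ (2 ^ n)))))
  regroup : ∀ s c z → s * c * z ≡ s * (z * c)
  regroup = solve-∀

-- Asymptotic bounds

n≤n^ : ∀ n d → n ≤ n ^ suc d
n≤n^ zero d = z≤n
n≤n^ (suc n) d = ≤-trans (≤-reflexive (sym (*-identityʳ (suc n)))) (*-monoʳ-≤ (suc n) (m^n>0 (suc n) d))

size-≤ : ∀ {d n} (A : SubsetGrid d n) → size A ≤ n ^ d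
size-≤ {d} {n} A = ≤-trans (ListP.length-filter (T? ∘ A) (grid d n)) (≤-reflexive (length-grid d n))

increasing-≤ : ∀ {B N} (idx : Fin B → Fin N) → (∀ {b b′} → b Fin.< b′ → idx b Fin.< idx b′) → B ≤ N
increasing-≤ {B} {N} idx mono = subst₂ _≤_ (length-allFin B) (length-allFin N) (injection-length idx (UniqueP.allFin⁺ B)
  (λ _ → ∈-allFin _) (λ _ _ e → increasing⇒injective (toℕ ∘ idx) mono (cong toℕ e)))

-- The points outside the clusters form one-point clusters, listed in increasing order so that the
-- bound for single points applies to them.
module Complement {B T′ N : ℕ} (K : Fin B → Fin T′ → Fin N) (K-inj : Injective₂ K) where

  hit? : (i : Fin N) → Dec (∃ λ b → ∃ λ j → K b j ≡ i)
  hit? i = FinP.any? (λ b → FinP.any? (λ j → K b j FinP.≟ i))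

  rest : List (Fin N)
  rest = filter (¬? ∘ hit?) (allFin N)

  rest-increasing : AllPairs Fin._<_ rest
  rest-increasing = AllPairsP.filter⁺ (¬? ∘ hit?) (AllPairsP.tabulate⁺-< {f = id} id)

  restIndex : Fin (length rest) → Fin N
  restIndex = lookup rest

  rest-mono : ∀ {b b′} → b Fin.< b′ → restIndex b Fin.< restIndex b′
  rest-mono = lookup-mono rest-increasing

  cover : ∀ i → (∃ λ b → ∃ λ j → K b j ≡ i) ⊎ (∃ λ b → ∃ λ (j : Fin 1) → restIndex b ≡ i)
  cover i with hit? i
  ... | yes p = inj₁ p
  ... | no ¬p = inj₂ (Any.index i∈ , zero , sym (lookup-index i∈))
    where
    i∈ : i ∈ rest
    i∈ = ∈-filter⁺ (¬? ∘ hit?) (∈-allFin i) ¬p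

  length-rest : length rest + B * T′ ≤ N
  length-rest = begin
    length rest + B * T′ ≡⟨ cong (length rest +_) (sym (trans (length-cartesianProduct (allFin B) (allFin T′))
        (cong₂ _*_ (length-allFin B) (length-allFin T′)))) ⟩
    length rest + length pairs ≡⟨ cong (length rest +_) (sym (ListP.length-map point pairs)) ⟩
    length rest + length (map point pairs) ≡⟨ sym (ListP.length-++ rest) ⟩
    length (rest ++ map point pairs) ≤⟨ ⊆-length unique (λ _ → ∈-allFin _) ⟩
    length (allFin N) ≡⟨ length-allFin N ⟩
    N ∎
    where
    open ≤-Reasoning
    pairs = cartesianProduct (allFin B) (allFin T′)
    point : Fin B × Fin T′ → Fin N
    point (b , j) = K b j
    point-inj : ∀ {x y} → point x ≡ point y → x ≡ y
    point-inj {b , j} {b′ , j′} e = cong₂ _,_ (proj₁ (K-inj e)) (proj₂ (K-inj e))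
    unique : Unique (rest ++ map point pairs)
    unique = UniqueP.++⁺ (UniqueP.filter⁺ (¬? ∘ hit?) (UniqueP.allFin⁺ N))
      (UniqueP.map⁺ point-inj (UniqueP.cartesianProduct⁺ (UniqueP.allFin⁺ B) (UniqueP.allFin⁺ T′)))
      (λ (p , q) → disjoint p q)
      where
      disjoint : ∀ {i} → i ∈ rest → i ∈ map point pairs → ⊥
      disjoint p q with ∈-map⁻ point q
      ... | (b , j) , _ , refl = proj₂ (∈-filter⁻ (¬? ∘ hit?) {xs = allFin N} p) (b , j , refl)

module Asymptotics (k′ h′ d′ r : ℕ) (1≤h′ : 1 ≤ h′) where

  k h m d c₁ : ℕ
  k = suc k′
  h = suc h′
  m = h′ + k′ * suc h′
  d = suc d′
  -- From h n + 1 ≤ 2 h n: the threshold h · (h n + 1) ^ d · k for w² is at most c₁ · n ^ d.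
  c₁ = h * k * (2 * h) ^ d

  1≤m : 1 ≤ m
  1≤m = ≤-trans 1≤h′ (m≤m+n h′ _)

  codes-bound : ∀ {n w} → 1 ≤ n → c₁ * n ^ d < w * w → (h * suc (h * n) ^ d) * k < w * w
  codes-bound {n} {w} 1≤n lt = ≤-<-trans (begin
    (h * suc (h * n) ^ d) * k ≤⟨ *-monoˡ-≤ k (*-monoʳ-≤ h (^-monoˡ-≤ d (≤-trans
        (+-monoˡ-≤ (h * n) (*-mono-≤ {1} {h} (s≤s z≤n) 1≤n)) (≤-reflexive (double h n))))) ⟩
    (h * ((2 * h) * n) ^ d) * k ≡⟨ cong (λ z → h * z * k) (^-distribʳ-* (2 * h) n d) ⟩
    (h * ((2 * h) ^ d * n ^ d)) * k ≡⟨ regroup h ((2 * h) ^ d) (n ^ d) k ⟩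
    c₁ * n ^ d ∎) lt
    where
    open ≤-Reasoning
    double : ∀ h n → h * n + h * n ≡ 2 * h * n
    double = solve-∀
    regroup : ∀ h a b k → (h * (a * b)) * k ≡ h * k * a * b
    regroup = solve-∀

  Free : ∀ {n} (A : SubsetGrid d n) → List (Coloring A r) → Set
  Free A cs = ∀ {c} → c ∈ cs → RainbowFree k h (PointCode.pointCode A k h (s≤s z≤n)) c

  SinglesBound : ℕ → ℕ → Set
  SinglesBound y n = (A : SubsetGrid d n) (cs : List (Coloring A r)) → Free A cs →
    {B : ℕ} (idx : Fin B → Fin (size A)) → (∀ {b b′} → b Fin.< b′ → idx b Fin.< idx b′) →
    traceCount (λ b (_ : Fin 1) → idx b) cs ≤ m ^ B * 2 ^ (n ^ d / suc y)

  weight-exponent : ∀ a R w → 1 ≤ w → a * suc (R * (h * w)) ≤ a * suc (R * h) * w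
  weight-exponent a R w 1≤w = ≤-trans (*-monoʳ-≤ a (+-mono-≤ 1≤w (≤-reflexive (sym (*-assoc R h w))))) (≤-reflexive (sym (*-assoc a (suc (R * h)) w)))

  singles-bound : ∀ y → Eventually (SinglesBound y)
  singles-bound y = suc (suc z + n₁) , λ n le A cs free {B} idx mono →
    let
      N₀≥ : suc z + n₁ ≤ n ^ d
      N₀≥ = ≤-trans (≤-trans (n≤1+n _) le) (n≤n^ n d′)
      sq = proj₂ square (n ^ d) (m+n≤o⇒n≤o (suc z) N₀≥)
      w = proj₁ sq
      1≤w = proj₁ (proj₂ sq)
      1≤n = ≤-trans (s≤s z≤n) le
    in main n A cs free idx mono w 1≤w (proj₁ (proj₂ (proj₂ sq)))
        (codes-bound {n} {w} 1≤n (proj₂ (proj₂ (proj₂ sq)))) (m+n≤o⇒m≤o (suc z) N₀≥)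
    where
    z D W Ω : ℕ
    -- z + 1 = 4 (y + 1) makes room for the three parts n ^ d / (z + 1) spent in `exponent`: two on
    -- the slack 1/D, one on the shattering weight. D = 2 (z + 1) is what `power-growth` asks for.
    z = 3 + y * 4
    D = 2 * suc z
    W = weightBase r 1 m * D
    Ω = W * suc (listCount r 1 m * h)
    square = eventually-square z Ω c₁
    n₁ = proj₁ square
    main : ∀ n (A : SubsetGrid d n) (cs : List (Coloring A r)) → Free A cs → {B : ℕ} (idx : Fin B → Fin (size A)) →
      (∀ {b b′} → b Fin.< b′ → idx b Fin.< idx b′) → ∀ w → 1 ≤ w → Ω * w ≤ n ^ d / suc z →
      (h * suc (h * n) ^ d) * k < w * w → suc z ≤ n ^ d →
      traceCount (λ b (_ : Fin 1) → idx b) cs ≤ m ^ B * 2 ^ (n ^ d / suc y)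
    main n A cs free {B} idx mono w 1≤w Ωw≤ large N₀≥ = *-cancelʳ-≤ X₂ (m ^ B * 2 ^ (n ^ d / suc y)) (D ^ B) {{m^n≢0 D B}} (begin
      X₂ * D ^ B ≤⟨ Bounds.singles-bound k′ h′ 1≤h′ pointCode pointCode-< cs free w large idx (λ lt → pointCode-mono (mono lt)) D (s≤s z≤n) ⟩
      (m * D + 1) ^ B * W ^ U ≡⟨ cong (λ x → x ^ B * W ^ U) (+-comm (m * D) 1) ⟩
      suc (m * D) ^ B * W ^ U ≤⟨ *-mono-≤ (power-growth (m * D) z B (≤-trans (≤-trans (≤-reflexive (sym (*-identityˡ D))) (*-monoˡ-≤ D 1≤m)) (n≤1+n (m * D)))) (n^u≤2^nu W U) ⟩
      2 ^ suc (B / suc z) * (m * D) ^ B * 2 ^ (W * U) ≡⟨ cong (λ x → 2 ^ suc (B / suc z) * x * 2 ^ (W * U)) (^-distribʳ-* m D B) ⟩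
      2 ^ suc (B / suc z) * (m ^ B * D ^ B) * 2 ^ (W * U) ≡⟨ regroup (2 ^ suc (B / suc z)) (m ^ B) (D ^ B) (2 ^ (W * U)) ⟩
      m ^ B * (2 ^ suc (B / suc z) * 2 ^ (W * U)) * D ^ B ≡⟨ cong (λ x → m ^ B * x * D ^ B) (sym (^-distribˡ-+-* 2 (suc (B / suc z)) (W * U))) ⟩
      m ^ B * 2 ^ (suc (B / suc z) + W * U) * D ^ B ≤⟨ *-monoˡ-≤ (D ^ B) (*-monoʳ-≤ (m ^ B) (^-monoʳ-≤ 2 exponent)) ⟩
      m ^ B * 2 ^ (n ^ d / suc y) * D ^ B ∎)
      where
      open PointCode A k h (s≤s z≤n)
      open ≤-Reasoning
      X₂ = traceCount (λ b (_ : Fin 1) → idx b) cs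
      U = suc (listCount r 1 m * (h * w))
      q = n ^ d / suc z
      regroup : ∀ a b c e → a * (b * c) * e ≡ b * (a * e) * c
      regroup = solve-∀
      four : ∀ q y → (q + q + (q + q)) * (1 + y) ≡ q * (4 + y * 4)
      four = solve-∀
      exponent : suc (B / suc z) + W * U ≤ n ^ d / suc y
      exponent = begin
        suc (B / suc z) + W * U ≤⟨ +-mono-≤ (+-mono-≤ {1} {q} (m≥n⇒m/n>0 N₀≥)
            (/-monoˡ-≤ (suc z) (≤-trans (increasing-≤ idx mono) (size-≤ A)))) (≤-trans (weight-exponent W (listCount r 1 m) w 1≤w) Ωw≤) ⟩
        (q + q) + q ≤⟨ +-monoʳ-≤ (q + q) (m≤m+n q q) ⟩
        (q + q) + (q + q) ≤⟨ *≤⇒≤/ _ y (n ^ d) (≤-trans (≤-reflexive (four q y)) (/*≤ (n ^ d) z)) ⟩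
        n ^ d / suc y ∎

  module ManyColours {T′ : ℕ}
    (pos : Fin (k * h) → Fin (k * h) → Fin T′) (unpos : Fin T′ → Fin (k * h) × Fin (k * h))
    (unpos-pos : ∀ t e → unpos (pos t e) ≡ (t , e)) (pos-unpos : ∀ j → pos (proj₁ (unpos j)) (proj₂ (unpos j)) ≡ j)
    where

    open Multipliers k′ h′ 1≤h′ using (Λ)

    -- n ≤ γ · s for the side s of the parameter box, whose size is thus at least n ^ d / G. With
    -- a₀, missing points spoil at most a quarter of the box; H bounds n ^ d in terms of the number
    -- B of clusters. For D = 2 the rate M + 1/D is y / 2, against (y + 1) / 2 = m ^ T′. Finally z
    -- makes four costs n ^ d / (z + 1) fit into B / (y + 1).
    γ G a₀ M y H z : ℕ
    γ = 2 * suc (2 * Λ)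
    G = γ ^ d
    a₀ = 4 * (T′ * G)
    M = m ^ T′ ∸ 1
    y = M * 2 + 1
    H = 2 * (T′ * T′) * G
    z = 3 + (H * suc y) * 4

    1≤T′ : 1 ≤ T′
    1≤T′ with pos zero zero
    ... | zero = s≤s z≤n
    ... | suc _ = s≤s z≤n

    1≤H : 1 ≤ H
    1≤H = *-mono-≤ {1} {2 * (T′ * T′)} (*-mono-≤ {1} {2} (s≤s z≤n) (*-mono-≤ 1≤T′ 1≤T′)) (m^n>0 γ d)

    suc-M : suc M ≡ m ^ T′
    suc-M = m+[n∸m]≡n (≤-trans (s≤s z≤n) (m^n>0 m {{>-nonZero 1≤m}} T′))

    suc-y : suc y ≡ 2 * m ^ T′
    suc-y = trans (regroup M) (cong (2 *_) suc-M)
      where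
      regroup : ∀ M → suc (M * 2 + 1) ≡ 2 * suc M
      regroup = solve-∀

    -- Missing points and collisions take at most a quarter of the box each, so at least half of the
    -- parameters are admissible.
    step-count : ∀ {n B x} → let s = n / suc (2 * Λ) in 1 ≤ s → 4 * (T′ * T′) ≤ s → a₀ * x ≤ n ^ d →
      s ^ d ≤ T′ * (B * T′) + (T′ * x + (T′ * T′) * s ^ d′) → n ^ d ≤ H * B
    step-count {n} {B} {x} 1≤s 4T²≤s sparse count = begin
      n ^ d ≤⟨ N₀≤ ⟩
      G * s ^ d ≤⟨ *-monoʳ-≤ G s^d≤ ⟩
      G * (2 * (T′ * T′) * B) ≡⟨ regroup₁ G (2 * (T′ * T′)) B ⟩
      H * B ∎
      where
      open ≤-Reasoning
      s = n / suc (2 * Λ)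
      regroup₁ : ∀ a b c → a * (b * c) ≡ b * a * c
      regroup₁ = solve-∀
      N₀≤ : n ^ d ≤ G * s ^ d
      N₀≤ = subst (n ^ d ≤_) (^-distribʳ-* γ s d) (^-monoˡ-≤ d (begin
        n ≤⟨ <⇒≤ (m<[1+m/n]*n n (2 * Λ)) ⟩
        suc s * suc (2 * Λ) ≤⟨ *-monoˡ-≤ (suc (2 * Λ)) (+-monoˡ-≤ s 1≤s) ⟩
        (s + s) * suc (2 * Λ) ≡⟨ regroup₂ s (suc (2 * Λ)) ⟩
        γ * s ∎))
        where
        regroup₂ : ∀ s a → (s + s) * a ≡ 2 * a * s
        regroup₂ = solve-∀
      few-missing : 4 * (T′ * x) ≤ s ^ d
      few-missing = *-cancelˡ-≤ G {{m^n≢0 γ d}} (≤-trans (≤-reflexive (regroup₃ G T′ x)) (≤-trans sparse N₀≤))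
        where
        regroup₃ : ∀ G t x → G * (4 * (t * x)) ≡ 4 * (t * G) * x
        regroup₃ = solve-∀
      few-collisions : 4 * ((T′ * T′) * s ^ d′) ≤ s ^ d
      few-collisions = ≤-trans (≤-reflexive (sym (*-assoc 4 (T′ * T′) (s ^ d′)))) (*-monoˡ-≤ (s ^ d′) 4T²≤s)
      s^d≤ : s ^ d ≤ 2 * (T′ * T′) * B
      s^d≤ = *-cancelˡ-≤ 2 (+-cancelʳ-≤ (2 * s ^ d) (2 * s ^ d) (2 * (2 * (T′ * T′) * B)) (begin
        2 * s ^ d + 2 * s ^ d ≡⟨ regroup₄ (s ^ d) ⟩
        4 * s ^ d ≤⟨ *-monoʳ-≤ 4 count ⟩
        4 * (T′ * (B * T′) + (T′ * x + (T′ * T′) * s ^ d′)) ≡⟨ regroup₅ T′ B (T′ * x) ((T′ * T′) * s ^ d′) ⟩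
        2 * (2 * (T′ * T′) * B) + (4 * (T′ * x) + 4 * ((T′ * T′) * s ^ d′)) ≤⟨ +-monoʳ-≤ (2 * (2 * (T′ * T′) * B)) (+-mono-≤ few-missing few-collisions) ⟩
        2 * (2 * (T′ * T′) * B) + (s ^ d + s ^ d) ≡⟨ cong (2 * (2 * (T′ * T′) * B) +_) (cong (s ^ d +_) (sym (+-identityʳ (s ^ d)))) ⟩
        2 * (2 * (T′ * T′) * B) + 2 * s ^ d ∎))
        where
        regroup₄ : ∀ a → 2 * a + 2 * a ≡ 4 * a
        regroup₄ = solve-∀
        regroup₅ : ∀ t b u v → 4 * (t * (b * t) + (u + v)) ≡ 2 * (2 * (t * t) * b) + (4 * u + 4 * v)
        regroup₅ = solve-∀

    Distinct : ∀ {n} (A : SubsetGrid d n) → (Fin (k * h) → Fin (size A)) → Coloring A r → Set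
    Distinct A p c = ∀ t t′ → Vec.lookup c (p t) ≡ Vec.lookup c (p t′) → t ≡ t′

    -- The factor (n ^ d) ^ (k * h) pays for the union over all placements p, and E for the required
    -- o(1).
    FamilyBound : ℕ → ℕ → Set
    FamilyBound E n = (A : SubsetGrid d n) → a₀ * (n ^ d ∸ size A) ≤ n ^ d →
      (cs : List (Coloring A r)) → Unique cs → Free A cs → (p : Fin (k * h) → Fin (size A)) → (∀ {c} → c ∈ cs → Distinct A p c) →
      E * (n ^ d) ^ (k * h) * length cs ≤ m ^ size A

    family-bound : ∀ E → Eventually (FamilyBound E)
    family-bound E = suc (2 * Λ) * suc (4 * (T′ * T′)) + (proj₁ singles + (n₂ + n₃)) , λ n le →
      let
        le₁ = m+n≤o⇒m≤o (suc (2 * Λ) * suc (4 * (T′ * T′))) le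
        le₂ = m+n≤o⇒n≤o (suc (2 * Λ) * suc (4 * (T′ * T′))) le
        le₃ = ≤-trans (m+n≤o⇒n≤o (proj₁ singles) le₂) (n≤n^ n d′)
        sq = proj₂ square (n ^ d) (m+n≤o⇒m≤o n₂ le₃)
      in main n (*≤⇒≤/ (suc (4 * (T′ * T′))) (2 * Λ) n (≤-trans (≤-reflexive (*-comm (suc (4 * (T′ * T′))) (suc (2 * Λ)))) le₁))
           (≤-trans (s≤s z≤n) le₁) (proj₂ singles n (m+n≤o⇒m≤o (proj₁ singles) le₂))
           (proj₁ sq) (proj₁ (proj₂ sq)) (proj₁ (proj₂ (proj₂ sq))) (proj₂ (proj₂ (proj₂ sq)))
           (proj₂ poly (n ^ d) (m+n≤o⇒n≤o n₂ le₃))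
      where
      W Ω : ℕ
      W = weightBase r T′ M * 2
      Ω = W * suc (listCount r T′ M * h)
      singles = singles-bound z
      square = eventually-square z Ω c₁
      poly = poly≤exp z (k * h) E
      n₂ = proj₁ square
      n₃ = proj₁ poly
      main : ∀ n → suc (4 * (T′ * T′)) ≤ n / suc (2 * Λ) → 1 ≤ n → SinglesBound z n →
        ∀ w → 1 ≤ w → Ω * w ≤ n ^ d / suc z → c₁ * n ^ d < w * w → E * (n ^ d) ^ (k * h) ≤ 2 ^ (n ^ d / suc z) → FamilyBound E n
      main n s-large 1≤n singlesB w 1≤w Ωw≤ w-large poly≤ A sparse cs u free p distinct = conclusion
        where
        s = n / suc (2 * Λ)
        room : 2 * (Λ * s) ≤ n
        room = ≤-trans (≤-trans (≤-reflexive (regroup Λ s)) (*-monoʳ-≤ s (n≤1+n (2 * Λ)))) (/*≤ n (2 * Λ))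
          where
          regroup : ∀ l s → 2 * (l * s) ≡ s * (2 * l)
          regroup = solve-∀
        open PointCode A k h (s≤s z≤n)
        open ClusterSystem k′ h′ 1≤h′ {d′} {n} {s} room A pos unpos unpos-pos pos-unpos p
          using (B; steps-count; clusterPoint; clusterPoint-mono; clusterPoint-injective; gadgetAt; gadget-solution)
        open Complement clusterPoint clusterPoint-injective
        module G₂ = Bounds.Gadgets k′ h′ 1≤h′ pointCode pointCode-< cs free w (codes-bound {n} {w} 1≤n w-large)
          {M = M} clusterPoint clusterPoint-mono (≤-reflexive (sym suc-M)) pos (proj₂ ∘ unpos)
          (λ t e → cong proj₂ (unpos-pos t e)) p (λ c∈ {t} {t′} → distinct c∈ t t′)
        open ≤-Reasoning
        q = n ^ d / suc z
        X₁ = traceCount clusterPoint cs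
        X₂ = traceCount (λ b (_ : Fin 1) → restIndex b) cs
        N₀≤HB : n ^ d ≤ H * B
        N₀≤HB = step-count {n} {B} {n ^ d ∸ size A} (≤-trans (s≤s z≤n) s-large) (≤-trans (n≤1+n _) s-large) sparse steps-count
        4q≤ : q + q + (q + q) ≤ B / suc y
        4q≤ = *≤⇒≤/ _ y B (*-cancelˡ-≤ H {{>-nonZero 1≤H}} (begin
          H * ((q + q + (q + q)) * suc y) ≡⟨ regroup H q (suc y) ⟩
          q * ((H * suc y) * 4) ≤⟨ *-monoʳ-≤ q (m≤n+m ((H * suc y) * 4) 4) ⟩
          q * suc z ≤⟨ /*≤ (n ^ d) z ⟩
          n ^ d ≤⟨ N₀≤HB ⟩
          H * B ∎))
          where
          regroup : ∀ H q y → H * ((q + q + (q + q)) * y) ≡ q * ((H * y) * 4)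
          regroup = solve-∀
        U = suc (listCount r T′ M * (h * w))
        same-gadget : ∀ b t e → G₂.gadgetPoint b t e ≡ gadgetAt b t e
        same-gadget b t zero = refl
        same-gadget b t (suc e) = refl
        solutions : ∀ b t (ℓ ℓ′ : Fin k) → fsum h (λ i → pointCode (G₂.gadgetPoint b t (Fin.combine ℓ i)))
                          ≡ fsum h (λ i → pointCode (G₂.gadgetPoint b t (Fin.combine ℓ′ i)))
        solutions b t ℓ ℓ′ = trans (fsum-cong h (λ i → cong pointCode (same-gadget b t (Fin.combine ℓ i))))
          (trans (gadget-solution b t ℓ ℓ′) (sym (fsum-cong h (λ i → cong pointCode (same-gadget b t (Fin.combine ℓ′ i))))))
        X₁≤ : X₁ * 2 ^ (B / suc y) ≤ m ^ (B * T′) * 2 ^ q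
        X₁≤ = *-cancelʳ-≤ _ _ (2 ^ B) {{m^n≢0 2 B}} (begin
          X₁ * 2 ^ (B / suc y) * 2 ^ B ≡⟨ regroup₁ X₁ (2 ^ (B / suc y)) (2 ^ B) ⟩
          2 ^ (B / suc y) * (X₁ * 2 ^ B) ≤⟨ *-monoʳ-≤ (2 ^ (B / suc y)) (G₂.gadgets-bound solutions 2 (s≤s z≤n)) ⟩
          2 ^ (B / suc y) * (y ^ B * W ^ U) ≡⟨ sym (*-assoc (2 ^ (B / suc y)) _ _) ⟩
          2 ^ (B / suc y) * y ^ B * W ^ U ≤⟨ *-mono-≤ (power-gap y B) (≤-trans (n^u≤2^nu W U) (^-monoʳ-≤ 2 (≤-trans (weight-exponent W (listCount r T′ M) w 1≤w) Ωw≤))) ⟩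
          suc y ^ B * 2 ^ q ≡⟨ cong (λ x → x ^ B * 2 ^ q) suc-y ⟩
          (2 * m ^ T′) ^ B * 2 ^ q ≡⟨ cong (_* 2 ^ q) (trans (^-distribʳ-* 2 (m ^ T′) B) (cong (2 ^ B *_) (trans (^-*-assoc m T′ B) (cong (m ^_) (*-comm T′ B))))) ⟩
          2 ^ B * m ^ (B * T′) * 2 ^ q ≡⟨ regroup₂ (2 ^ B) (m ^ (B * T′)) (2 ^ q) ⟩
          m ^ (B * T′) * 2 ^ q * 2 ^ B ∎)
          where
          regroup₁ : ∀ a b c → a * b * c ≡ b * (a * c)
          regroup₁ = solve-∀
          regroup₂ : ∀ a b c → a * b * c ≡ b * c * a
          regroup₂ = solve-∀
        X₂≤ : X₂ ≤ m ^ length rest * 2 ^ q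
        X₂≤ = singlesB A cs free restIndex rest-mono
        conclusion : E * (n ^ d) ^ (k * h) * length cs ≤ m ^ size A
        -- There are three costs of 2 ^ q: the polynomial factor, the shattering weight of the
        -- clusters and the slack on single points. Together they are at most the gain 2 ^ (B / (y +
        -- 1)).
        conclusion = *-cancelʳ-≤ _ _ (2 ^ (B / suc y)) {{m^n≢0 2 (B / suc y)}} (begin
          E * (n ^ d) ^ (k * h) * length cs * 2 ^ (B / suc y) ≤⟨ *-monoˡ-≤ (2 ^ (B / suc y)) (*-mono-≤ poly≤
              (length-≤-traces clusterPoint (λ b (_ : Fin 1) → restIndex b) cover cs u)) ⟩
          2 ^ q * (X₁ * X₂) * 2 ^ (B / suc y) ≡⟨ regroup₁ (2 ^ q) X₁ X₂ (2 ^ (B / suc y)) ⟩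
          2 ^ q * ((X₁ * 2 ^ (B / suc y)) * X₂) ≤⟨ *-monoʳ-≤ (2 ^ q) (*-mono-≤ X₁≤ X₂≤) ⟩
          2 ^ q * ((m ^ (B * T′) * 2 ^ q) * (m ^ length rest * 2 ^ q)) ≡⟨ regroup₂ (2 ^ q) (m ^ (B * T′)) (m ^ length rest) ⟩
          m ^ length rest * m ^ (B * T′) * (2 ^ q * 2 ^ q * 2 ^ q) ≡⟨ cong₂ _*_ (sym (^-distribˡ-+-* m (length rest) (B * T′)))
              (sym (trans (^-distribˡ-+-* 2 (q + q) q) (cong (_* 2 ^ q) (^-distribˡ-+-* 2 q q)))) ⟩
          m ^ (length rest + B * T′) * 2 ^ (q + q + q) ≤⟨ *-mono-≤ (^-monoʳ-≤ m {{>-nonZero 1≤m}} length-rest)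
              (^-monoʳ-≤ 2 (≤-trans (+-monoʳ-≤ (q + q) (m≤m+n q q)) 4q≤)) ⟩
          m ^ size A * 2 ^ (B / suc y) ∎)
          where
          regroup₁ : ∀ a b c e → a * (b * c) * e ≡ a * ((b * e) * c)
          regroup₁ = solve-∀
          regroup₂ : ∀ a b c → a * ((b * a) * (c * a)) ≡ c * b * (a * a * a)
          regroup₂ = solve-∀

-- Palettes

length-combs : {X : Set} (k : ℕ) (xs : List X) → length (combs k xs) ≡ length xs C k
length-combs zero xs = refl
length-combs (suc k) [] = refl
length-combs (suc k) (x ∷ xs) = trans (ListP.length-++ (map (x ∷_) (combs k xs)))
  (trans (cong₂ _+_ (trans (ListP.length-map (x ∷_) (combs k xs)) (length-combs k xs)) (length-combs (suc k) xs))
    (nCk+nC[k+1]≡[n+1]C[k+1] (length xs) k))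

-- Palettes differ as sets and not only as lists, so the sets of colorings using exactly one palette
-- are disjoint.
combs-pairs : {X : Set} (k : ℕ) {xs : List X} → Unique xs → AllPairs (λ P P′ → ¬ (P ⊆ P′ × P′ ⊆ P)) (combs k xs)
combs-pairs zero u = [] ∷ []
combs-pairs (suc k) {[]} u = []
combs-pairs (suc k) {x ∷ xs} (x∉ ∷ u) = AllPairsP.++⁺
  (AllPairsP.map⁺ (within (combs k xs) (λ P∈ → combs-⊆ k xs P∈) (combs-pairs k u)))
  (combs-pairs (suc k) u)
  (AllP.map⁺ (All.tabulate λ P∈ → All.tabulate λ P′∈ (sub , _) → All.lookup x∉ (combs-⊆ (suc k) xs P′∈ (sub (here refl))) refl))
  where
  strip : ∀ {P P′} → P ⊆ xs → (x ∷ P) ⊆ (x ∷ P′) → P ⊆ P′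
  strip P⊆ sub y∈ with sub (there y∈)
  ... | here refl = ⊥-elim (All.lookup x∉ (P⊆ y∈) refl)
  ... | there p = p
  within : ∀ Ps → (∀ {P} → P ∈ Ps → P ⊆ xs) → AllPairs (λ P P′ → ¬ (P ⊆ P′ × P′ ⊆ P)) Ps →
    AllPairs (λ P P′ → ¬ ((x ∷ P) ⊆ (x ∷ P′) × (x ∷ P′) ⊆ (x ∷ P))) Ps
  within [] _ [] = []
  within (P ∷ Ps) ⊆xs (p ∷ ps) = All.tabulate (λ P′∈ (s , s′) → All.lookup p P′∈ (strip (⊆xs (here refl)) s , strip (⊆xs (there P′∈)) s′))
    ∷ within Ps (⊆xs ∘ there) ps

-- Marked elements are taken; an unmarked one is dropped only while the rest is long enough, and
-- otherwise pads the sublist.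
combs-cover : {X : Set} (G : X → Bool) (k : ℕ) (xs : List X) → lsum xs (bool→ℕ ∘ G) ≤ k → k ≤ length xs →
  ∃ λ P → P ∈ combs k xs × (∀ {x} → x ∈ xs → G x ≡ true → x ∈ P)
combs-cover G zero [] le _ = [] , here refl , λ ()
combs-cover G zero (x ∷ xs) le _ = [] , here refl , none (x ∷ xs) le
  where
  none : ∀ xs → lsum xs (bool→ℕ ∘ G) ≤ 0 → ∀ {x} → x ∈ xs → G x ≡ true → x ∈ []
  none (y ∷ ys) le (here refl) e rewrite e = ⊥-elim (n≮0 le)
  none (y ∷ ys) le (there p) e = none ys (m+n≤o⇒n≤o (bool→ℕ (G y)) le) p e
combs-cover G (suc k) (x ∷ xs) le (s≤s k≤) with G x in eq
... | true with combs-cover G k xs (≤-pred le) k≤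
...   | P , P∈ , cover = x ∷ P , ∈-++⁺ˡ (∈-map⁺ (x ∷_) P∈) , λ { (here e) _ → here e ; (there p) e → there (cover p e) }
combs-cover G (suc k) (x ∷ xs) le (s≤s k≤) | false with suc k ≤? length xs
...   | yes k<  with combs-cover G (suc k) xs le k<
...     | P , P∈ , cover = P , ∈-++⁺ʳ (map (x ∷_) (combs k xs)) P∈ , λ { (here refl) e → ⊥-elim (absurd eq e) ; (there p) e → cover p e }
  where
  absurd : ∀ {b} → b ≡ false → b ≡ true → ⊥
  absurd refl ()
combs-cover G (suc k) (x ∷ xs) le (s≤s k≤) | false | no ¬k< with combs-cover G k xs
    (≤-trans (lsum-≤ xs {c = 1} (λ {y} _ → bool→ℕ≤1 (G y))) (≤-trans (≤-reflexive (*-identityʳ (length xs))) (≤-pred (≰⇒> ¬k<)))) k≤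
...     | P , P∈ , cover = x ∷ P , ∈-++⁺ˡ (∈-map⁺ (x ∷_) P∈) , λ { (here e) _ → here e ; (there p) e → there (cover p e) }

∈-toList⁻ : {X : Set} {n : ℕ} (v : Vec X n) {x : X} → x ∈ Vec.toList v → ∃ λ i → Vec.lookup v i ≡ x
∈-toList⁻ (y ∷ v) (here e) = zero , sym e
∈-toList⁻ (y ∷ v) (there p) with ∈-toList⁻ v p
... | i , e = suc i , e

∈-toList⁺ : {X : Set} {n : ℕ} (v : Vec X n) (i : Fin n) → Vec.lookup v i ∈ Vec.toList v
∈-toList⁺ (y ∷ v) zero = here refl
∈-toList⁺ (y ∷ v) (suc i) = there (∈-toList⁺ v i)

length-concatMap-weighted : {X Y : Set} (f : X → List Y) (a c : ℕ) (xs : List X) →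
  (∀ x → a * length (f x) ≤ c) → a * length (concatMap f xs) ≤ length xs * c
length-concatMap-weighted f a c [] le = ≤-reflexive (*-zeroʳ a)
length-concatMap-weighted f a c (x ∷ xs) le = ≤-trans (≤-reflexive (trans (cong (a *_) (ListP.length-++ (f x)))
  (*-distribˡ-+ a (length (f x)) _))) (+-mono-≤ (le x) (length-concatMap-weighted f a c xs le))

T-does : {P : Set} (P? : Dec P) → T (does P?) → P
T-does (yes p) _ = p

module Palettes (k′ h′ : ℕ) {d n r : ℕ} (A : SubsetGrid d n) where

  k h m N : ℕ
  k = suc k′
  h = suc h′
  m = h′ + k′ * suc h′
  N = size A

  palettes : List (List (Fin r))
  palettes = combs m (allFin r)

  length-palettes : length palettes ≡ r C m
  length-palettes = trans (length-combs m (allFin r)) (cong (_C m) (length-allFin r))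

  good : List (Coloring A r)
  good = goodColorings k h r A

  good-unique : Unique good
  good-unique = UniqueP.filter⁺ (λ c → ¬? (hasRainbow? k h A c)) (allVec-unique (UniqueP.allFin⁺ r))

  ∈-good : ∀ {c} → ¬ HasRainbow k h A c → c ∈ good
  ∈-good {c} none = ∈-filter⁺ (λ c → ¬? (hasRainbow? k h A c)) (∈-allVec c (λ _ → ∈-allFin _)) none

  good⁻ : ∀ {c} → c ∈ good → ¬ HasRainbow k h A c
  good⁻ c∈ = proj₂ (∈-filter⁻ (λ c → ¬? (hasRainbow? k h A c)) {xs = allColorings A r} c∈)

  good-free : ∀ {c} → c ∈ good → RainbowFree k h (PointCode.pointCode A k h (s≤s z≤n)) c
  good-free {c} c∈ = PointCode.good⇒free A k h (s≤s z≤n) c (good⁻ c∈)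

  length-colorsOf : ∀ {k} (c : Coloring A r) (X : Candidate A k h) → length (colorsOf A c X) ≡ k * h
  length-colorsOf c [] = refl
  length-colorsOf c (row ∷ X) = trans (ListP.length-++ (Vec.toList (Vec.map (Vec.lookup c) row)))
    (cong₂ _+_ (VecP.length-toList (Vec.map (Vec.lookup c) row)) (length-colorsOf c X))

  colorsOf-⊆ : ∀ {k} (c : Coloring A r) (X : Candidate A k h) {α} → α ∈ colorsOf A c X → ∃ λ i → Vec.lookup c i ≡ α
  colorsOf-⊆ c (row ∷ X) α∈ with ∈-++⁻ (Vec.toList (Vec.map (Vec.lookup c) row)) α∈
  ... | inj₂ q = colorsOf-⊆ c X q
  ... | inj₁ q with ∈-toList⁻ (Vec.map (Vec.lookup c) row) q
  ...   | i , e = Vec.lookup row i , trans (sym (VecP.lookup-map i (Vec.lookup c) row)) e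

  few-colours-good : ∀ {P c} → P ∈ palettes → c ∈ allVec P N → c ∈ good
  few-colours-good {P} {c} P∈ c∈ = ∈-good λ rainbow → contra (find rainbow)
    where
    contra : (∃ λ X → X ∈ allCandidates A k h × IsRainbow A c X) → ⊥
    contra (X , _ , _ , u) = <-irrefl refl (begin-strict
      m <⟨ n<1+n m ⟩
      k * h ≡⟨ sym (length-colorsOf c X) ⟩
      length (colorsOf A c X) ≤⟨ ⊆-length u (λ α∈ → inP (colorsOf-⊆ c X α∈)) ⟩
      length P ≡⟨ combs-length m (allFin r) P∈ ⟩
      m ∎)
      where
      open ≤-Reasoning
      inP : ∀ {α} → (∃ λ i → Vec.lookup c i ≡ α) → α ∈ P
      inP (i , refl) = ∈-allVec⁻ P c∈ i

  open DecMembership (FinP._≟_ {r}) using (_∈?_)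

  Uses : List (Fin r) → Coloring A r → Set
  Uses P c = All (_∈ Vec.toList c) P

  uses? : ∀ P c → Dec (Uses P c)
  uses? P c = All.all? (_∈? Vec.toList c) P

  onto : List (Fin r) → List (Coloring A r)
  onto P = filter (uses? P) (allVec P N)

  palette-unique : ∀ {P} → P ∈ palettes → Unique P
  palette-unique = combs-unique m (UniqueP.allFin⁺ r)

  -- A coloring over P that is not onto avoids some α in P and so uses the m - 1 other colors; the
  -- union bound over α gives the correction.
  length-onto : ∀ {P} → P ∈ palettes → m ^ N ≤ length (onto P) + m * (m ∸ 1) ^ N
  length-onto {P} P∈ = begin
    m ^ N ≡⟨ cong (_^ N) (sym |P|) ⟩
    length P ^ N ≡⟨ sym (length-allVec P N) ⟩
    length (allVec P N) ≤⟨ ⊆-length (allVec-unique (palette-unique P∈)) sub ⟩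
    length (onto P ++ concatMap avoid P) ≡⟨ ListP.length-++ (onto P) ⟩
    length (onto P) + length (concatMap avoid P) ≤⟨ +-monoʳ-≤ (length (onto P)) (length-concatMap-≤ avoid ((m ∸ 1) ^ N) P avoid-≤) ⟩
    length (onto P) + length P * (m ∸ 1) ^ N ≡⟨ cong (λ z → length (onto P) + z * (m ∸ 1) ^ N) |P| ⟩
    length (onto P) + m * (m ∸ 1) ^ N ∎
    where
    open ≤-Reasoning
    |P| : length P ≡ m
    |P| = combs-length m (allFin r) P∈
    without : Fin r → List (Fin r)
    without α = filter (λ β → ¬? (β FinP.≟ α)) P
    avoid : Fin r → List (Coloring A r)
    avoid α = allVec (without α) N
    avoid-≤ : ∀ {α} → α ∈ P → length (avoid α) ≤ (m ∸ 1) ^ N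
    avoid-≤ {α} α∈ = ≤-trans (≤-reflexive (length-allVec (without α) N)) (^-monoˡ-≤ N (∸-monoˡ-≤ {suc (length (without α))} {m} 1
      (≤-trans (⊆-length {xs = α ∷ without α} (All.tabulate (λ β∈ e → proj₂ (∈-filter⁻ (λ β → ¬? (β FinP.≟ α)) {xs = P} β∈) (sym e))
        ∷ UniqueP.filter⁺ _ (palette-unique P∈)) (λ { (here refl) → α∈ ; (there p) → proj₁ (∈-filter⁻ (λ β → ¬? (β FinP.≟ α)) p) })) (≤-reflexive |P|))))
    sub : allVec P N ⊆ onto P ++ concatMap avoid P
    sub {c} c∈ with uses? P c
    ... | yes all-used = ∈-++⁺ˡ (∈-filter⁺ (uses? P) c∈ all-used)
    ... | no ¬used with find (AllP.¬All⇒Any¬ (_∈? Vec.toList c) P ¬used)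
    ...   | α , α∈ , α∉ = ∈-++⁺ʳ (onto P) (∈-concatMap-intro avoid α∈ (∈-allVec c λ i →
              ∈-filter⁺ (λ β → ¬? (β FinP.≟ α)) (∈-allVec⁻ P c∈ i) (λ e → α∉ (subst (_∈ Vec.toList c) e (∈-toList⁺ c i)))))

  -- Fewer than kh colors exclude a rainbow solution. Counting only colorings that use their whole
  -- palette makes the contributions of the palettes disjoint.
  good-lower : (r C m) * m ^ N ≤ g k h r A + (r C m) * (m * (m ∸ 1) ^ N)
  good-lower = begin
    (r C m) * m ^ N ≡⟨ cong (_* m ^ N) (sym length-palettes) ⟩
    length palettes * m ^ N ≤⟨ sum-bound palettes id ⟩
    length (concatMap onto palettes) + length palettes * (m * (m ∸ 1) ^ N) ≤⟨ +-mono-≤ (⊆-length unique sub)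
      (≤-reflexive (cong (_* (m * (m ∸ 1) ^ N)) length-palettes)) ⟩
    g k h r A + (r C m) * (m * (m ∸ 1) ^ N) ∎
    where
    open ≤-Reasoning
    sum-bound : ∀ Ps → (∀ {P} → P ∈ Ps → P ∈ palettes) →
      length Ps * m ^ N ≤ length (concatMap onto Ps) + length Ps * (m * (m ∸ 1) ^ N)
    sum-bound [] _ = z≤n
    sum-bound (P ∷ Ps) inc = begin
      m ^ N + length Ps * m ^ N ≤⟨ +-mono-≤ (length-onto (inc (here refl))) (sum-bound Ps (inc ∘ there)) ⟩
      (length (onto P) + x) + (length (concatMap onto Ps) + length Ps * x) ≡⟨ +-interchange (length (onto P)) x _ _ ⟩
      (length (onto P) + length (concatMap onto Ps)) + (x + length Ps * x) ≡⟨ cong (_+ (x + length Ps * x)) (sym (ListP.length-++ (onto P))) ⟩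
      length (onto P ++ concatMap onto Ps) + (x + length Ps * x) ∎
      where x = m * (m ∸ 1) ^ N
    sub : concatMap onto palettes ⊆ good
    sub c∈ with ∈-concatMap-elim onto palettes c∈
    ... | P , P∈ , q = few-colours-good P∈ (proj₁ (∈-filter⁻ (uses? P) q))
    used-⊆ : ∀ {P P′ c} → c ∈ onto P → c ∈ onto P′ → P ⊆ P′
    used-⊆ {P} {P′} {c} p p′ α∈ with ∈-toList⁻ c (All.lookup (proj₂ (∈-filter⁻ (uses? P) {xs = allVec P N} p)) α∈)
    ... | i , refl = ∈-allVec⁻ P′ (proj₁ (∈-filter⁻ (uses? P′) p′)) i
    apart : ∀ {P P′} → ¬ (P ⊆ P′ × P′ ⊆ P) → ∀ {c} → ¬ (c ∈ onto P × c ∈ onto P′)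
    apart ¬both (p , p′) = ¬both (used-⊆ p p′ , used-⊆ p′ p)
    unique : Unique (concatMap onto palettes)
    unique = UniqueP.concat⁺ (AllP.map⁺ (All.tabulate λ {P} P∈ → UniqueP.filter⁺ (uses? P) (allVec-unique (palette-unique P∈))))
      (AllPairsP.map⁺ (AllPairs.map apart (combs-pairs m (UniqueP.allFin⁺ r))))

  some-palette : m ≤ r → ∃ λ P → P ∈ palettes
  some-palette m≤r with combs-cover (λ _ → false) m (allFin r) (≤-trans (lsum-≤ (allFin r) {c = 0} (λ _ → ≤-refl)) (≤-trans (≤-reflexive (*-zeroʳ (length (allFin r)))) z≤n))
      (≤-trans m≤r (≤-reflexive (sym (length-allFin r))))
  ... | P , P∈ , _ = P , P∈

  one-palette : m ≤ r → m ^ N ≤ g k h r A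
  one-palette m≤r with some-palette m≤r
  ... | P , P∈ = ≤-trans (≤-reflexive (trans (cong (_^ N) (sym (combs-length m (allFin r) P∈))) (sym (length-allVec P N))))
    (⊆-length (allVec-unique (palette-unique P∈)) (few-colours-good P∈))

  1≤rCm : m ≤ r → 1 ≤ r C m
  1≤rCm m≤r with some-palette m≤r
  ... | P , P∈ = subst (1 ≤_) length-palettes (positive P∈)
    where
    positive : ∀ {Ps : List (List (Fin r))} → P ∈ Ps → 1 ≤ length Ps
    positive (here _) = s≤s z≤n
    positive (there _) = s≤s z≤n

  -- The colors of a coloring with at most m of them lie in some palette, padded if necessary, which
  -- m ≤ r permits.
  good-upper : m ≤ r → g k h r A ≤ (r C m) * m ^ N + gBad k h r A
  good-upper m≤r = begin
    g k h r A ≡⟨ sym (length-filter-partition many? good) ⟩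
    gBad k h r A + length few ≤⟨ +-monoʳ-≤ (gBad k h r A) (⊆-length (UniqueP.filter⁺ (¬? ∘ many?) good-unique) sub) ⟩
    gBad k h r A + length (concatMap (λ P → allVec P N) palettes) ≤⟨ +-monoʳ-≤ (gBad k h r A) (length-concatMap-≤ _ (m ^ N) palettes
      (λ {P} P∈ → ≤-reflexive (trans (length-allVec P N) (cong (_^ N) (combs-length m (allFin r) P∈))))) ⟩
    gBad k h r A + length palettes * m ^ N ≡⟨ +-comm (gBad k h r A) _ ⟩
    length palettes * m ^ N + gBad k h r A ≡⟨ cong (λ z → z * m ^ N + gBad k h r A) length-palettes ⟩
    (r C m) * m ^ N + gBad k h r A ∎
    where
    open ≤-Reasoning
    many? : ∀ c → Dec (m < numColors A c)
    many? c = m <? numColors A c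
    few = filter (¬? ∘ many?) good
    sub : few ⊆ concatMap (λ P → allVec P N) palettes
    sub {c} c∈ with combs-cover G m (allFin r) count≤ (≤-trans m≤r (≤-reflexive (sym (length-allFin r))))
      where
      used = deduplicate FinP._≟_ (Vec.toList c)
      G : Fin r → Bool
      G α = does (α ∈? used)
      count≤ : lsum (allFin r) (bool→ℕ ∘ G) ≤ m
      count≤ = ≤-trans (≤-reflexive (sym (length-filterᵇ G (allFin r)))) (≤-trans
        (⊆-length (UniqueP.filter⁺ (T? ∘ G) (UniqueP.allFin⁺ r))
          (λ {α} p → T-does (α ∈? used) (proj₂ (∈-filter⁻ (T? ∘ G) {xs = allFin r} p))))
        (≮⇒≥ (proj₂ (∈-filter⁻ (¬? ∘ many?) {xs = good} c∈))))
    ... | P , P∈ , cover = ∈-concatMap-intro (λ P → allVec P N) P∈ (∈-allVec c λ i → cover (∈-allFin _)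
          (dec-true (_ ∈? _) (∈-deduplicate⁺ FinP._≟_ (∈-toList⁺ c i))))

-- Comparison of rationals with natural numbers

toℚᵘ-toℚ : ∀ a → ℚB.toℚᵘ (toℚ a) ℚᵘ.≃ mkℚᵘ (ℤ.+ a) 0
toℚᵘ-toℚ a = ℚP.toℚᵘ-fromℚᵘ (mkℚᵘ (ℤ.+ a) 0)

toℚ-mono : ∀ {a b} → a ≤ b → toℚ a ≤ℚ toℚ b
toℚ-mono {a} {b} le = ℚP.toℚᵘ-cancel-≤ (ℚᵘP.≤-respˡ-≃ (ℚᵘP.≃-sym (toℚᵘ-toℚ a)) (ℚᵘP.≤-respʳ-≃ (ℚᵘP.≃-sym (toℚᵘ-toℚ b))
  (*≤* (ℤP.*-monoʳ-≤-nonNeg (ℤ.+ 1) (ℤ.+≤+ le)))))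

toℚ-+ : ∀ a b → toℚ (a + b) ≡ toℚ a +ℚ toℚ b
toℚ-+ a b = ℚP.toℚᵘ-injective (ℚᵘP.≃-trans (toℚᵘ-toℚ (a + b)) (ℚᵘP.≃-sym (ℚᵘP.≃-trans (ℚP.toℚᵘ-homo-+ (toℚ a) (toℚ b))
  (ℚᵘP.≃-trans (ℚᵘP.+-cong (toℚᵘ-toℚ a) (toℚᵘ-toℚ b)) (*≡* eq)))))
  where
  eq : ((ℤ.+ a) ℤ.* (ℤ.+ 1) ℤ.+ (ℤ.+ b) ℤ.* (ℤ.+ 1)) ℤ.* (ℤ.+ 1) ≡ (ℤ.+ (a + b)) ℤ.* (ℤ.+ 1)
  eq = cong (ℤ._* (ℤ.+ 1)) (cong₂ ℤ._+_ (ℤP.*-identityʳ (ℤ.+ a)) (ℤP.*-identityʳ (ℤ.+ b)))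

-- The denominator E of ε satisfies 1 ≤ E ε.
toℚ-fraction : ∀ ε → 0ℚ <ℚ ε → ∀ {x y} → ℚB.↧ₙ ε * y ≤ x → toℚ y ≤ℚ ε *ℚ toℚ x
toℚ-fraction (mkℚ (ℤ.+ zero) _ _) (ℚB.*<* (ℤ.+<+ ())) le
toℚ-fraction ε@(mkℚ (ℤ.+ suc a) b-1 _) 0<ε {x} {y} le = ℚP.toℚᵘ-cancel-≤ (ℚᵘP.≤-respˡ-≃ (ℚᵘP.≃-sym (toℚᵘ-toℚ y))
  (ℚᵘP.≤-respʳ-≃ (ℚᵘP.≃-sym (ℚᵘP.≃-trans (ℚP.toℚᵘ-homo-* ε (toℚ x)) (ℚᵘP.*-cong (ℚᵘP.≃-refl {ℚB.toℚᵘ ε}) (toℚᵘ-toℚ x)))) (*≤* main)))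
  where
  main : (ℤ.+ y) ℤ.* (ℤ.+ (suc b-1 * 1)) ℤ.≤ ((ℤ.+ suc a) ℤ.* (ℤ.+ x)) ℤ.* (ℤ.+ 1)
  main = subst₂ ℤ._≤_ (ℤP.pos-* y (suc b-1 * 1)) (trans (ℤP.pos-* (suc a) x) (sym (ℤP.*-identityʳ ((ℤ.+ suc a) ℤ.* (ℤ.+ x)))))
    (ℤ.+≤+ (≤-trans (≤-reflexive (trans (cong (y *_) (*-identityʳ (suc b-1))) (*-comm y (suc b-1)))) (≤-trans le (m≤m+n x (a * x)))))
toℚ-fraction (mkℚ ℤ.-[1+ a ] _ _) (ℚB.*<* ()) le

≤-scaled-above : ∀ ε → 0ℚ <ℚ ε → ∀ {x y u} → u ≤ x + y → ℚB.↧ₙ ε * y ≤ x → toℚ u ≤ℚ (1ℚ +ℚ ε) *ℚ toℚ x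
≤-scaled-above ε 0<ε {x} {y} {u} le frac = begin
  toℚ u ≤⟨ toℚ-mono le ⟩
  toℚ (x + y) ≡⟨ toℚ-+ x y ⟩
  toℚ x +ℚ toℚ y ≤⟨ ℚP.+-monoʳ-≤ (toℚ x) (toℚ-fraction ε 0<ε frac) ⟩
  toℚ x +ℚ ε *ℚ toℚ x ≡⟨ cong (_+ℚ ε *ℚ toℚ x) (sym (ℚP.*-identityˡ (toℚ x))) ⟩
  1ℚ *ℚ toℚ x +ℚ ε *ℚ toℚ x ≡⟨ sym (ℚP.*-distribʳ-+ (toℚ x) 1ℚ ε) ⟩
  (1ℚ +ℚ ε) *ℚ toℚ x ∎
  where open ℚP.≤-Reasoning

≤-scaled-below : ∀ ε → 0ℚ <ℚ ε → ∀ {x y u} → x ≤ u + y → ℚB.↧ₙ ε * y ≤ x → (1ℚ -ℚ ε) *ℚ toℚ x ≤ℚ toℚ u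
≤-scaled-below ε 0<ε {x} {y} {u} le frac = begin
  (1ℚ -ℚ ε) *ℚ toℚ x ≡⟨ ℚP.*-distribʳ-+ (toℚ x) 1ℚ (ℚB.- ε) ⟩
  1ℚ *ℚ toℚ x +ℚ (ℚB.- ε) *ℚ toℚ x ≡⟨ cong₂ _+ℚ_ (ℚP.*-identityˡ (toℚ x)) (sym (ℚP.neg-distribˡ-* ε (toℚ x))) ⟩
  toℚ x -ℚ ε *ℚ toℚ x ≤⟨ ℚP.+-monoˡ-≤ (ℚB.- (ε *ℚ toℚ x)) (toℚ-mono le) ⟩
  toℚ (u + y) -ℚ ε *ℚ toℚ x ≡⟨ cong (_-ℚ ε *ℚ toℚ x) (toℚ-+ u y) ⟩
  (toℚ u +ℚ toℚ y) -ℚ ε *ℚ toℚ x ≤⟨ ℚP.+-monoˡ-≤ (ℚB.- (ε *ℚ toℚ x)) (ℚP.+-monoʳ-≤ (toℚ u) (toℚ-fraction ε 0<ε frac)) ⟩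
  (toℚ u +ℚ ε *ℚ toℚ x) -ℚ ε *ℚ toℚ x ≡⟨ ℚP.+-assoc (toℚ u) (ε *ℚ toℚ x) _ ⟩
  toℚ u +ℚ (ε *ℚ toℚ x -ℚ ε *ℚ toℚ x) ≡⟨ cong (toℚ u +ℚ_) (ℚP.+-inverseʳ (ε *ℚ toℚ x)) ⟩
  toℚ u +ℚ 0ℚ ≡⟨ ℚP.+-identityʳ (toℚ u) ⟩
  toℚ u ∎
  where open ℚP.≤-Reasoning

-- Density and the assembly of the three claims

^-cancelˡ-≤ : ∀ {a b} → 2 ^ a ≤ 2 ^ b → a ≤ b
^-cancelˡ-≤ {a} {b} le = ≮⇒≥ λ b<a → <-irrefl refl (<-≤-trans (^-monoʳ-< 2 (s≤s (s≤s z≤n)) b<a) le)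

-- For x missing points, 2 ^ (a · x) ≤ n ^ x ≤ 2 ^ (n ^ d). With a = a₀ this yields `Near`.
dense-missing : ∀ {d n} (a : ℕ) (A : SubsetGrid d n) → 2 ^ a ≤ n → Dense A → a * (n ^ d ∸ size A) ≤ n ^ d
dense-missing {d} {n} a A 2^a≤n dense = ^-cancelˡ-≤ (≤-trans (≤-reflexive (sym (^-*-assoc 2 a (n ^ d ∸ size A)))) (≤-trans (^-monoˡ-≤ (n ^ d ∸ size A) 2^a≤n) dense))

size-full : ∀ d n → size (fullGrid d n) ≡ n ^ d
size-full d n = trans (cong length (ListP.filter-all (λ x → T? (fullGrid d n x)) {xs = grid d n} (All.tabulate λ _ → tt))) (length-grid d n)

size-proper : ∀ {d n} (A : SubsetGrid d n) → (∃ λ p → A p ≡ false) → size A < n ^ d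
size-proper {d} {n} A (p , e) = subst (size A <_) (length-grid d n) (≤-trans (s≤s ≤-refl) (⊆-length unique (λ _ → ∈-grid _)))
  where
  unique : Unique (p ∷ elems A)
  unique = All.tabulate (λ {x} x∈ eq → subst T (trans (cong A (sym eq)) e) (proj₂ (∈-filter⁻ (T? ∘ A) {xs = grid d n} x∈)))
    ∷ UniqueP.filter⁺ (T? ∘ A) (grid-unique d n)

-- The factor E · m is at most 2 ^ (E · m) ≤ 2 ^ (N / m), which `power-gap` from m - 1 to m
-- provides.
deficient-≤ : ∀ m c E N → 1 ≤ m → E * m * m ≤ N → E * (c * (m * (m ∸ 1) ^ N)) ≤ c * m ^ N
deficient-≤ (suc y) c E N _ le = begin
  E * (c * (suc y * y ^ N)) ≡⟨ regroup E c (suc y) (y ^ N) ⟩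
  c * (E * suc y * y ^ N) ≤⟨ *-monoʳ-≤ c (*-monoˡ-≤ (y ^ N) (≤-trans (n≤2^n (E * suc y)) (^-monoʳ-≤ 2 (*≤⇒≤/ (E * suc y) y N le)))) ⟩
  c * (2 ^ (N / suc y) * y ^ N) ≤⟨ *-monoʳ-≤ c (power-gap y N) ⟩
  c * suc y ^ N ∎
  where
  open ≤-Reasoning
  regroup : ∀ E c m x → E * (c * (m * x)) ≡ c * (E * m * x)
  regroup = solve-∀

module Theorem (k′ h′ d′ r : ℕ) (1≤k′ : 1 ≤ k′) (1≤h′ : 1 ≤ h′) (kh≤r : suc k′ * suc h′ ≤ r) {T′ : ℕ}
  (pos : Fin (suc k′ * suc h′) → Fin (suc k′ * suc h′) → Fin T′)
  (unpos : Fin T′ → Fin (suc k′ * suc h′) × Fin (suc k′ * suc h′))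
  (unpos-pos : ∀ t e → unpos (pos t e) ≡ (t , e)) (pos-unpos : ∀ j → pos (proj₁ (unpos j)) (proj₂ (unpos j)) ≡ j)
  where

  k h d : ℕ
  k = suc k′
  h = suc h′
  d = suc d′

  open Asymptotics k′ h′ d′ r 1≤h′ using (m; 1≤m; singles-bound; SinglesBound; module ManyColours)
  open ManyColours pos unpos unpos-pos pos-unpos using (a₀; FamilyBound; family-bound; Distinct; 1≤T′; γ)
  open module Pal {n} = Palettes k′ h′ {d} {n} {r} using (good-lower; good-upper; one-palette; 1≤rCm; good-unique; good-free)

  m≤r : m ≤ r
  m≤r = ≤-trans (n≤1+n m) kh≤r

  3≤m : 3 ≤ m
  3≤m = +-mono-≤ 1≤h′ (*-mono-≤ 1≤k′ (s≤s 1≤h′))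

  Near : ∀ {n} → SubsetGrid d n → Set
  Near {n} A = a₀ * (n ^ d ∸ size A) ≤ n ^ d

  distinct? : ∀ {n} (A : SubsetGrid d n) (p : Vec (Fin (size A)) (k * h)) (c : Coloring A r) → Dec (Distinct A (Vec.lookup p) c)
  distinct? A p c = FinP.all? (λ t → FinP.all? (λ t′ → (Vec.lookup c (Vec.lookup p t) FinP.≟ Vec.lookup c (Vec.lookup p t′)) →-dec (t FinP.≟ t′)))

  BadBound : ℕ → ℕ → Set
  BadBound E n = (A : SubsetGrid d n) → Near A → E * gBad k h r A ≤ m ^ size A

  -- A coloring with more than m colors has kh points of distinct colors; the union over at most (n
  -- ^ d) ^ (k * h) placements of these points is paid for in `FamilyBound`.
  bad-bound : ∀ E → Eventually (BadBound E)
  bad-bound E = suc (proj₁ (family-bound E)) , λ n le A near → main n (≤-trans (s≤s z≤n) le) (proj₂ (family-bound E) n (≤-trans (n≤1+n _) le)) A near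
    where
    main : ∀ n → 1 ≤ n → FamilyBound E n → BadBound E n
    main n 1≤n bound A near = *-cancelʳ-≤ _ _ X {{m^n≢0 (n ^ d) (k * h) {{m^n≢0 n d {{>-nonZero 1≤n}}}}}} (begin
      E * gBad k h r A * X ≡⟨ regroup E (gBad k h r A) X ⟩
      E * X * gBad k h r A ≤⟨ *-monoʳ-≤ (E * X) (⊆-length (UniqueP.filter⁺ many? (good-unique A)) sub) ⟩
      E * X * length (concatMap family points) ≤⟨ length-concatMap-weighted family (E * X) (m ^ N) points family-≤ ⟩
      length points * m ^ N ≤⟨ *-monoˡ-≤ (m ^ N) (≤-trans (≤-reflexive (trans (length-allVec (allFin N) (k * h)) (cong (_^ (k * h)) (length-allFin N))))
        (^-monoˡ-≤ (k * h) (size-≤ A))) ⟩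
      X * m ^ N ≡⟨ *-comm X (m ^ N) ⟩
      m ^ N * X ∎)
      where
      open ≤-Reasoning
      N = size A
      X = (n ^ d) ^ (k * h)
      regroup : ∀ a b c → a * b * c ≡ a * c * b
      regroup = solve-∀
      many? : ∀ c → Dec (m < numColors A c)
      many? c = m <? numColors A c
      points = allVec (allFin N) (k * h)
      family : Vec (Fin N) (k * h) → List (Coloring A r)
      family p = filter (distinct? A p) (goodColorings k h r A)
      family-≤ : ∀ p → E * X * length (family p) ≤ m ^ N
      family-≤ p = bound A near (family p) (UniqueP.filter⁺ (distinct? A p) (good-unique A))
        (λ c∈ → good-free A (proj₁ (∈-filter⁻ (distinct? A p) c∈))) (Vec.lookup p)
        (λ c∈ → proj₂ (∈-filter⁻ (distinct? A p) {xs = goodColorings k h r A} c∈))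
      sub : filter many? (goodColorings k h r A) ⊆ concatMap family points
      sub {c} c∈ = ∈-concatMap-intro family {x = p} (∈-allVec p (λ _ → ∈-allFin _)) (∈-filter⁺ (distinct? A p) (proj₁ both) distinct)
        where
        both = ∈-filter⁻ many? {xs = goodColorings k h r A} c∈
        used = deduplicate FinP._≟_ (Vec.toList c)
        colour : Fin (k * h) → Fin r
        colour t = lookup used (Fin.inject≤ t (proj₂ both))
        place : ∀ t → ∃ λ i → Vec.lookup c i ≡ colour t
        place t = ∈-toList⁻ c (∈-deduplicate⁻ FinP._≟_ (Vec.toList c) (∈-lookup {xs = used} _))
        p = Vec.tabulate (proj₁ ∘ place)
        at : ∀ t → Vec.lookup c (Vec.lookup p t) ≡ colour t
        at t = trans (cong (Vec.lookup c) (VecP.lookup∘tabulate (proj₁ ∘ place) t)) (proj₂ (place t))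
        distinct : Distinct A (Vec.lookup p) c
        distinct t t′ e = FinP.inject≤-injective _ _ _ _ (lookup-injective (deduplicate-! FinP._≟_ (Vec.toList c))
          (trans (sym (at t)) (trans e (at t′))))

  2≤a₀ : 2 ≤ a₀
  2≤a₀ = ≤-trans (s≤s (s≤s z≤n)) (*-monoʳ-≤ 4 (*-mono-≤ 1≤T′ (m^n>0 γ d)))

  near-size : ∀ {n} (A : SubsetGrid d n) → Near A → n ^ d ≤ 2 * size A
  near-size {n} A near = +-cancelʳ-≤ (n ^ d) (n ^ d) (2 * size A) (begin
    n ^ d + n ^ d ≡⟨ cong (n ^ d +_) (sym (+-identityʳ (n ^ d))) ⟩
    2 * n ^ d ≡⟨ cong (2 *_) (sym (m+[n∸m]≡n (size-≤ A))) ⟩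
    2 * (size A + (n ^ d ∸ size A)) ≡⟨ *-distribˡ-+ 2 (size A) _ ⟩
    2 * size A + 2 * (n ^ d ∸ size A) ≤⟨ +-monoʳ-≤ (2 * size A) (≤-trans (*-monoˡ-≤ (n ^ d ∸ size A) 2≤a₀) near) ⟩
    2 * size A + n ^ d ∎)
    where open ≤-Reasoning

  DeficientBound : ℕ → ℕ → Set
  DeficientBound E n = (A : SubsetGrid d n) → Near A → E * ((r C m) * (m * (m ∸ 1) ^ size A)) ≤ (r C m) * m ^ size A

  deficient-bound : ∀ E → Eventually (DeficientBound E)
  deficient-bound E = 2 * (E * m * m) , λ n le A near → main n le A near
    where
    main : ∀ n → 2 * (E * m * m) ≤ n → DeficientBound E n
    main n le A near = deficient-≤ m (r C m) E (size A) 1≤m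
      (*-cancelˡ-≤ 2 (≤-trans le (≤-trans (n≤n^ n d′) (near-size A near))))

  FarBound : ℕ → Set
  FarBound n = (A : SubsetGrid d n) → ¬ Near A → g k h r A < m ^ (n ^ d)

  -- By (i), g(A) is at most m ^ N · 2 ^ q with q = n ^ d / (a₀ + 1). A set that is not near misses
  -- x > q points, and 2 ^ q < 2 ^ x ≤ m ^ x.
  far-bound : Eventually FarBound
  far-bound = proj₁ (singles-bound a₀) , λ n le → main n (proj₂ (singles-bound a₀) n le)
    where
    main : ∀ n → SinglesBound a₀ n → FarBound n
    main n bound A far = begin-strict
      g k h r A ≤⟨ length-≤-traces (λ b (_ : Fin 1) → b) empty (λ i → inj₁ (i , zero , refl)) good (good-unique A) ⟩
      traceCount (λ b (_ : Fin 1) → b) good * traceCount empty good ≤⟨ *-mono-≤ (bound A good (good-free A) id id) (bool→ℕ≤1 _) ⟩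
      m ^ N * 2 ^ q * 1 ≡⟨ *-identityʳ _ ⟩
      m ^ N * 2 ^ q <⟨ *-monoʳ-< (m ^ N) {{m^n≢0 m N {{>-nonZero 1≤m}}}} (^-monoʳ-< 2 (s≤s (s≤s z≤n)) q<x) ⟩
      m ^ N * 2 ^ x ≤⟨ *-monoʳ-≤ (m ^ N) (^-monoˡ-≤ x (≤-trans (n≤1+n 2) 3≤m)) ⟩
      m ^ N * m ^ x ≡⟨ sym (^-distribˡ-+-* m N x) ⟩
      m ^ (N + x) ≡⟨ cong (m ^_) (m+[n∸m]≡n (size-≤ A)) ⟩
      m ^ (n ^ d) ∎
      where
      open ≤-Reasoning
      N = size A
      x = n ^ d ∸ N
      q = n ^ d / suc a₀
      good = goodColorings k h r A
      -- Single points already cover everything, so the second system is empty and has at most one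
      -- trace.
      empty : Fin 0 → Fin 0 → Fin N
      empty ()
      q<x : q < x
      q<x = ≰⇒> λ x≤q → far (≤-trans (*-monoʳ-≤ a₀ x≤q) (≤-trans (≤-reflexive (*-comm a₀ q))
        (≤-trans (*-monoʳ-≤ q (n≤1+n a₀)) (/*≤ (n ^ d) a₀))))

  Goal₁ Goal₂ : ℚ → ℕ → Set
  Goal₁ ε n = (A : SubsetGrid d n) → Dense A →
          ((1ℚ -ℚ ε) *ℚ toℚ ((r C m) * m ^ size A) ≤ℚ toℚ (g k h r A))
        × (toℚ (g k h r A) ≤ℚ (1ℚ +ℚ ε) *ℚ toℚ ((r C m) * m ^ size A))
  Goal₂ ε n = (A : SubsetGrid d n) → Dense A → toℚ (gBad k h r A) ≤ℚ ε *ℚ toℚ (g k h r A)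

  m^N≤ : ∀ {n} (A : SubsetGrid d n) → m ^ size A ≤ (r C m) * m ^ size A
  m^N≤ A = ≤-trans (≤-reflexive (sym (*-identityˡ _))) (*-monoˡ-≤ (m ^ size A) (1≤rCm A m≤r))

  part₁ : (ε : ℚ) → 0ℚ <ℚ ε → Eventually (Goal₁ ε)
  part₁ ε 0<ε = proj₁ bounds , λ n le A dense → conclusion A (proj₂ bounds n le) dense
    where
    E = ℚB.↧ₙ ε
    bounds = eventually-and (eventually-≤ (2 ^ a₀)) (eventually-and (bad-bound E) (deficient-bound E))
    conclusion : ∀ {n} (A : SubsetGrid d n) → 2 ^ a₀ ≤ n × BadBound E n × DeficientBound E n → Dense A →
          ((1ℚ -ℚ ε) *ℚ toℚ ((r C m) * m ^ size A) ≤ℚ toℚ (g k h r A))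
        × (toℚ (g k h r A) ≤ℚ (1ℚ +ℚ ε) *ℚ toℚ ((r C m) * m ^ size A))
    conclusion A (large , bad , deficient) dense =
      ≤-scaled-below ε 0<ε (good-lower A) (deficient A near) ,
      ≤-scaled-above ε 0<ε (good-upper A m≤r) (≤-trans (bad A near) (m^N≤ A))
      where near = dense-missing a₀ A large dense

  part₂ : (ε : ℚ) → 0ℚ <ℚ ε → Eventually (Goal₂ ε)
  part₂ ε 0<ε = proj₁ bounds , λ n le A dense → conclusion A (proj₂ bounds n le) dense
    where
    E = ℚB.↧ₙ ε
    bounds = eventually-and (eventually-≤ (2 ^ a₀)) (bad-bound E)
    conclusion : ∀ {n} (A : SubsetGrid d n) → 2 ^ a₀ ≤ n × BadBound E n → Dense A → toℚ (gBad k h r A) ≤ℚ ε *ℚ toℚ (g k h r A)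
    conclusion A (large , bad) dense =
      toℚ-fraction ε 0<ε (≤-trans (bad A (dense-missing a₀ A large dense)) (one-palette A m≤r))

  Goal₃ : ℕ → Set
  Goal₃ n = (A : SubsetGrid d n) → (∃ λ (p : Point d n) → A p ≡ false) → g k h r A < g k h r (fullGrid d n)

  part₃ : Eventually Goal₃
  part₃ = proj₁ bounds , λ n le → main n (proj₂ bounds n le)
    where
    bounds = eventually-and far-bound (eventually-and (bad-bound 1) (deficient-bound 4))
    main : ∀ n → FarBound n × BadBound 1 n × DeficientBound 4 n → Goal₃ n
    main n (far , bad , deficient) A missing = split (a₀ * (n ^ d ∸ size A) ≤? n ^ d)
      where
      open ≤-Reasoning
      full = fullGrid d n
      -- This is the main term of a set missing one point, so the full grid has main term m · t. A
      -- proper near subset has g at most t + t by the bound with E = 1. The bound with E = 4 gives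
      -- the full grid at least (3/4) m t, hence at least (9/4) t since m ≥ 3.
      t = (r C m) * m ^ (n ^ d ∸ 1)
      x = (r C m) * (m * (m ∸ 1) ^ size full)
      regroup : ∀ t x → 4 * (2 * t + x) ≡ 8 * t + 4 * x
      regroup = solve-∀
      1≤t : 1 ≤ t
      1≤t = *-mono-≤ (1≤rCm full m≤r) (m^n>0 m {{>-nonZero 1≤m}} (n ^ d ∸ 1))
      proper : size A < n ^ d
      proper = size-proper A missing
      mt : m * t ≡ (r C m) * m ^ size full
      mt = trans (swap m (r C m) _) (cong (λ z → (r C m) * m ^ z) (trans (m+[n∸m]≡n {1} (≤-trans (s≤s z≤n) proper)) (sym (size-full d n))))
        where
        swap : ∀ a b c → a * (b * c) ≡ b * (a * c)
        swap = solve-∀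
      full-near : Near full
      full-near = ≤-trans (≤-reflexive (trans (cong (a₀ *_) (trans (cong (n ^ d ∸_) (size-full d n)) (n∸n≡0 (n ^ d)))) (*-zeroʳ a₀))) z≤n
      gA≤ : Near A → g k h r A ≤ 2 * t
      gA≤ near = begin
        g k h r A ≤⟨ good-upper A m≤r ⟩
        (r C m) * m ^ size A + gBad k h r A ≤⟨ +-monoʳ-≤ _ (≤-trans (≤-trans (≤-reflexive (sym (*-identityˡ _))) (bad A near)) (m^N≤ A)) ⟩
        (r C m) * m ^ size A + (r C m) * m ^ size A ≤⟨ +-mono-≤ smaller smaller ⟩
        t + t ≡⟨ cong (t +_) (sym (+-identityʳ t)) ⟩
        2 * t ∎
        where
        smaller : (r C m) * m ^ size A ≤ t
        smaller = *-monoʳ-≤ (r C m) (^-monoʳ-≤ m {{>-nonZero 1≤m}} (∸-monoˡ-≤ {suc (size A)} {n ^ d} 1 proper))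
      split : Dec (Near A) → g k h r A < g k h r full
      split (no ¬near) = <-≤-trans (far A ¬near) (subst (λ z → m ^ z ≤ g k h r full) (size-full d n) (one-palette full m≤r))
      split (yes near) = ≰⇒> λ le → <-irrefl refl (begin-strict
        8 * t <⟨ *-monoˡ-< t {{>-nonZero 1≤t}} (n<1+n 8) ⟩
        9 * t ≡⟨ *-assoc 3 3 t ⟩
        3 * (3 * t) ≤⟨ *-monoʳ-≤ 3 (*-monoˡ-≤ t 3≤m) ⟩
        3 * (m * t) ≤⟨ +-cancelʳ-≤ (m * t) (3 * (m * t)) (8 * t) (begin
          3 * (m * t) + m * t ≡⟨ +-comm (3 * (m * t)) (m * t) ⟩
          4 * (m * t) ≡⟨ cong (4 *_) mt ⟩
          4 * ((r C m) * m ^ size full) ≤⟨ *-monoʳ-≤ 4 (≤-trans (good-lower full) (+-monoˡ-≤ x (≤-trans le (gA≤ near)))) ⟩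
          4 * (2 * t + x) ≡⟨ regroup t x ⟩
          8 * t + 4 * x ≤⟨ +-monoʳ-≤ (8 * t) (≤-trans (deficient full full-near) (≤-reflexive (sym mt))) ⟩
          8 * t + m * t ∎) ⟩
        8 * t ∎)

theorem1p1 : (d k h r : ℕ) → 1 ≤ d → 2 ≤ k → 2 ≤ h → k * h ≤ r →
    ((ε : ℚ) → 0ℚ <ℚ ε → Σ ℕ λ n₀ → (n : ℕ) → n₀ ≤ n → (A : SubsetGrid d n) → Dense A →
    ((1ℚ -ℚ ε) *ℚ toℚ ((r C (k * h ∸ 1)) * (k * h ∸ 1) ^ size A) ≤ℚ toℚ (g k h r A))
    × (toℚ (g k h r A) ≤ℚ (1ℚ +ℚ ε) *ℚ toℚ ((r C (k * h ∸ 1)) * (k * h ∸ 1) ^ size A)))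
    ×
    ((ε : ℚ) → 0ℚ <ℚ ε → Σ ℕ λ n₀ → (n : ℕ) → n₀ ≤ n → (A : SubsetGrid d n) → Dense A →
    toℚ (gBad k h r A) ≤ℚ ε *ℚ toℚ (g k h r A))
    ×
    (Σ ℕ λ n₀ → (n : ℕ) → n₀ ≤ n → (A : SubsetGrid d n) →
    (∃ λ (p : Point d n) → A p ≡ false) → g k h r A < g k h r (fullGrid d n))
theorem1p1 (suc d′) (suc (suc k″)) (suc (suc h″)) r (s≤s z≤n) (s≤s (s≤s z≤n)) (s≤s (s≤s z≤n)) kh≤r =
  part₁ , part₂ , part₃
  where
  kh = suc (suc k″) * suc (suc h″)
  -- A cluster has (kh)² positions, one for each pair (t , e), encoded by `combine`.
  open Theorem (suc k″) (suc h″) d′ r (s≤s z≤n) (s≤s z≤n) kh≤r {kh * kh}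
    Fin.combine (Fin.remQuot {kh} kh) FinP.remQuot-combine (FinP.combine-remQuot {kh} kh)
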